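{- There exists a function $f$ such that for every $t\in\mathbb{N}$, every circle graph $G$ with pathwidth at least $f(t)$ contains (i) a subdivision of a complete binary tree of height $t$ as an induced subgraph, or (ii) the line graph of a subdivision of a complete binary tree of height $t$ as an induced subgraph, or (iii) an induced subgraph $H$ consisting of $t$ vertex-disjoint cycles $C_1,\dots,C_t$ such that for all $i<j$ every vertex of $C_i$ has at least two neighbours in $C_j$, and moreover every vertex of $G$ has at most four neighbours in any $C_i$ ($1\le i\le t$).
   Context: A chord of a circle is a closed line segment with distinct endpoints on the circle; two chords cross if they intersect at a point other than an endpoint of either. A circle graph is a graph isomorphic to the graph whose vertices are the chords of a finite set of chords of a circle (no three crossing at one point), two chords adjacent iff they cross. -}

module Defs where

open import Data.Nat using (ℕ; zero; suc; _≤_; _<_)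
open import Data.Fin using (Fin; toℕ; fromℕ; inject₁) renaming (zero to fzero; suc to fsuc; _≤_ to _≤ᶠ_; _<_ to _<ᶠ_)
open import Data.Fin.Subset using (Subset; _∈_; ∣_∣)
open import Data.List using (List; []; _∷_; length)
open import Data.Bool using (Bool)
open import Data.Product using (Σ; ∃; ∃₂; _×_; _,_; proj₁; proj₂)
open import Data.Sum using (_⊎_)
open import Relation.Nullary using (¬_)
open import Relation.Binary.PropositionalEquality using (_≡_; _≢_)

record Graph : Set₁ where
  field
    V   : Set
    Adj : V → V → Set
open Graph public

finGraph : (n : ℕ) → (Fin n → Fin n → Set) → Graph
finGraph n E = record { V = Fin n ; Adj = E }

record InducedIn (H G : Graph) : Set where
  field
    emb : V H → V G
    inj : ∀ x y → emb x ≡ emb y → x ≡ y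
    adj : ∀ x y → (Adj H x y → Adj G (emb x) (emb y)) × (Adj G (emb x) (emb y) → Adj H x y)

-- Circle graphs.  Points on the circle are listed in cyclic order
-- (starting from a cut point that is not an endpoint) as natural numbers;
-- a chord is a pair of distinct points lo < hi.  Two chords cross iff
-- their endpoints strictly interleave.

record Chord : Set where
  constructor chord
  field
    lo hi : ℕ
    lo<hi : lo < hi
open Chord public

Cross : Chord → Chord → Set
Cross c d = (lo c < lo d × lo d < hi c × hi c < hi d)
          ⊎ (lo d < lo c × lo c < hi d × hi d < hi c)

IsCircleGraph : (n : ℕ) → (Fin n → Fin n → Set) → Set
IsCircleGraph n E =
  Σ (Fin n → Chord) λ c →
    (∀ u v → lo (c u) ≡ lo (c v) → hi (c u) ≡ hi (c v) → u ≡ v)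
    × (∀ u v → (E u v → Cross (c u) (c v)) × (Cross (c u) (c v) → E u v))

record PathDecomposition (n : ℕ) (E : Fin n → Fin n → Set) : Set where
  field
    m      : ℕ
    bag    : Fin m → Subset n
    cover  : ∀ v → ∃ λ i → v ∈ bag i
    edge   : ∀ u v → E u v → ∃ λ i → u ∈ bag i × v ∈ bag i
    interp : ∀ v (i j k : Fin m) → i ≤ᶠ j → j ≤ᶠ k → v ∈ bag i → v ∈ bag k → v ∈ bag j
open PathDecomposition public

PathwidthAtLeast : (n : ℕ) → (Fin n → Fin n → Set) → ℕ → Set
PathwidthAtLeast n E k = ∀ (D : PathDecomposition n E) → ∃ λ i → k < ∣ bag D i ∣

-- Subdivisions of the complete binary tree of height t.
-- Tree nodes are lists w : List Bool with length w ≤ t (root = [],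
-- children of w are b ∷ w).  s (b ∷ w) is the number of subdivision
-- vertices on the edge between b ∷ w and its parent w.  The vertex
-- node b w p i  (i ≤ s (b ∷ w)) is the tree node b ∷ w when i = 0 and
-- otherwise the i-th subdivision vertex going up towards the parent.

data TVert (t : ℕ) (s : List Bool → ℕ) : Set where
  root : TVert t s
  node : (b : Bool) (w : List Bool) → length (b ∷ w) ≤ t → Fin (suc (s (b ∷ w))) → TVert t s

-- arcs oriented towards the root; each edge of the subdivided tree is
-- exactly one arc
data TArc {t : ℕ} {s : List Bool → ℕ} : TVert t s → TVert t s → Set where
  along    : ∀ {b w p} (j : Fin (s (b ∷ w))) →
             TArc (node b w p (inject₁ j)) (node b w p (fsuc j))
  toRoot   : ∀ {b p} → TArc (node b [] p (fromℕ (s (b ∷ [])))) root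
  toParent : ∀ {b b' w p p'} →
             TArc (node b (b' ∷ w) p (fromℕ (s (b ∷ b' ∷ w)))) (node b' w p' fzero)

SubdivTree : (t : ℕ) → (List Bool → ℕ) → Graph
SubdivTree t s = record
  { V = TVert t s
  ; Adj = λ x y → TArc x y ⊎ TArc y x }

TEdge : (t : ℕ) → (List Bool → ℕ) → Set
TEdge t s = Σ (TVert t s) λ x → Σ (TVert t s) λ y → TArc x y

LineSubdivTree : (t : ℕ) → (List Bool → ℕ) → Graph
LineSubdivTree t s = record
  { V = TEdge t s
  ; Adj = λ { (x , y , _) (x' , y' , _) →
        ¬ (x ≡ x' × y ≡ y')
        × (x ≡ x' ⊎ x ≡ y' ⊎ y ≡ x' ⊎ y ≡ y') } }

record Cycle (n : ℕ) (E : Fin n → Fin n → Set) : Set where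
  field
    len    : ℕ
    3≤len  : 3 ≤ len
    vert   : Fin len → Fin n
    inj    : ∀ a b → vert a ≡ vert b → a ≡ b
    consec : ∀ (a b : Fin len) →
             (suc (toℕ a) ≡ toℕ b ⊎ (suc (toℕ a) ≡ len × toℕ b ≡ 0)) →
             E (vert a) (vert b)
open Cycle public

CycleOutcome : (t n : ℕ) → (Fin n → Fin n → Set) → Set
CycleOutcome t n E =
  Σ (Fin t → Cycle n E) λ C →
    (∀ i j a b → vert (C i) a ≡ vert (C j) b → i ≡ j)
    × (∀ i j → i <ᶠ j → ∀ a → ∃₂ λ b b' →
          b ≢ b' × E (vert (C i) a) (vert (C j) b) × E (vert (C i) a) (vert (C j) b'))
    × (∀ (v : Fin n) (i : Fin t) (e : Fin 5 → Fin (len (C i))) →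
          (∀ k k' → e k ≡ e k' → k ≡ k') →
          ¬ (∀ k → E v (vert (C i) (e k))))

{-# OPTIONS --safe #-}
module Submission where

-- Give every chord one of its two sides so that no two of the opposite arcs
-- cover the circle, as a point of the disc would.  If all arcs cover the
-- circle, the maximal ones contain a minimal cyclic cover, which is a cycle
-- meeting every point of the circle at most twice.  Removing it and repeating,
-- we obtain t cycles as in (iii) unless some point of the circle is on at most
-- 2t arcs.  In the latter case, applied to medians of three points of the
-- circle, every interval separated from its complement by at most K chords
-- splits into two such intervals.
--
-- On the other hand, large pathwidth yields a complete binary tree as a minor.
-- A path-width argument along a chain of cheap intervals places disjoint
-- subtrees in disjoint cheap intervals, so that bags meet only along
-- ancestor lines.  A bag that straddles the intervals of a whole large subtree
-- uses up one of the K chords of each of them; hence, after at most K restarts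
-- inside such a subtree, non-consecutive bags can be made anticomplete.
-- In this induced minor each branching is realised by a claw or a triangle,
-- and a Ramsey argument makes all branchings equal: claws give (i),
-- triangles give (ii).

open import Defs using (Chord; IsCircleGraph; PathDecomposition; PathwidthAtLeast; TVert; root; TArc; along; toRoot; toParent; TEdge; SubdivTree; LineSubdivTree; InducedIn; finGraph; Cycle; CycleOutcome)
import Defs
open import Data.Nat using (ℕ; zero; suc; _+_; _*_; _∸_; _⊔_; _≤_; _<_; z≤n; s≤s; _≤?_; _<?_; _≟_)
open import Data.Nat.Properties
open import Data.Nat.Induction using (<-wellFounded)
open import Induction.WellFounded using (Acc; acc)
open import Data.Fin using (Fin; toℕ; fromℕ; fromℕ<; #_) renaming (zero to fzero; suc to fsuc)
import Data.Fin as Fin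
import Data.Fin.Properties as Finₚ
open import Data.Fin.Subset using (Subset; ∣_∣) renaming (_∈_ to _∈ˢ_)
import Data.Vec as Vec
import Data.Vec.Properties as Vecₚ
open import Data.Bool using (Bool; true; false; if_then_else_)
import Data.Bool.Properties as Boolₚ
open import Data.List using (List; []; _∷_; _++_; length)
import Data.List.Properties as Listₚ
open import Data.List.Membership.Propositional using (_∈_; _∉_)
open import Data.List.Membership.Propositional.Properties using (∈-++⁺ˡ; ∈-++⁺ʳ; ∈-++⁻)
import Data.List.Membership.DecPropositional as DecMem
open import Data.List.Relation.Unary.Any using (here; there)
open import Data.List.Relation.Unary.All using (all?)
import Data.List.Relation.Unary.All as All
open import Data.Unit using (⊤; tt)
open import Data.Product using (Σ; ∃; ∃₂; _×_; _,_; proj₁; proj₂)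
open import Data.Sum using (_⊎_; inj₁; inj₂; [_,_]′)
open import Data.Empty using (⊥; ⊥-elim)
open import Function using (_∘_; id)
open import Relation.Nullary using (¬_; Dec; yes; no; does; ¬?)
open import Relation.Nullary.Decidable using (_×-dec_; _⊎-dec_; map′)
open import Relation.Binary.Definitions using (tri<; tri≈; tri>)
open import Relation.Binary.PropositionalEquality using (_≡_; _≢_; refl; sym; trans; cong; cong₂; subst)

-- A minor says nothing about edges between bags that are not neighbours in the tree; intervals are
-- what controls them. Chords inside disjoint intervals do not cross, so bags on different branches
-- see nothing of each other. A bag that sees a far descendant reaches into the interval of that
-- descendant; as it also reaches another branch, it contains a straddler of the interval, and
-- cheapness limits how often this can happen. Medians enter because two sides that each hold two of
-- three given points share one of them, so a majority vote is an admissible choice of sides. To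
-- split an interval of cost exactly K, a cut `w` first halves its straddlers. If too many chords
-- inside the interval pass over `w`, 2t+1 of them are isolated by a cut `z`, and the vote is taken
-- among `z`, `w` and the right end. The arcs of these 2t+1 chords contain everything outside the
-- interval, so a cut on at most 2t arcs lies strictly inside. Each part then costs at most K/2 +
-- (2t+1) + 2t, which is below K = 4(2t+1).

-- Counting and searching over decidable predicates

module Counting where

  [_]ᵈ : {P : Set} → Dec P → ℕ
  [ yes _ ]ᵈ = 1
  [ no _ ]ᵈ = 0

  cnt : ∀ {n} {P : Fin n → Set} → (∀ v → Dec (P v)) → ℕ
  cnt {zero} P? = 0
  cnt {suc n} P? = [ P? fzero ]ᵈ + cnt (P? ∘ fsuc)

  []ᵈ-mono : {P Q : Set} (p : Dec P) (q : Dec Q) → (P → Q) → [ p ]ᵈ ≤ [ q ]ᵈ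
  []ᵈ-mono (yes p) (yes q) f = ≤-refl
  []ᵈ-mono (yes p) (no ¬q) f = ⊥-elim (¬q (f p))
  []ᵈ-mono (no _) _ f = z≤n

  cnt-mono : ∀ {n} {P Q : Fin n → Set} (P? : ∀ v → Dec (P v)) (Q? : ∀ v → Dec (Q v)) →
             (∀ v → P v → Q v) → cnt P? ≤ cnt Q?
  cnt-mono {zero} P? Q? f = z≤n
  cnt-mono {suc n} P? Q? f =
    +-mono-≤ ([]ᵈ-mono (P? fzero) (Q? fzero) (f fzero)) (cnt-mono (P? ∘ fsuc) (Q? ∘ fsuc) (f ∘ fsuc))

  []ᵈ-∪ : {P Q R : Set} (p : Dec P) (q : Dec Q) (r : Dec R) → (P → Q ⊎ R) → [ p ]ᵈ ≤ [ q ]ᵈ + [ r ]ᵈ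
  []ᵈ-∪ (no _) q r f = z≤n
  []ᵈ-∪ (yes p) (yes _) r f = s≤s z≤n
  []ᵈ-∪ (yes p) (no _) (yes _) f = ≤-refl
  []ᵈ-∪ (yes p) (no ¬q) (no ¬r) f = ⊥-elim ([ ¬q , ¬r ]′ (f p))

  interchange : ∀ a b c d → (a + b) + (c + d) ≡ (a + c) + (b + d)
  interchange a b c d =
    trans (+-assoc a b (c + d))
      (trans (cong (a +_) (trans (sym (+-assoc b c d)) (trans (cong (_+ d) (+-comm b c)) (+-assoc c b d))))
        (sym (+-assoc a c (b + d))))

  cnt-∪ : ∀ {n} {P Q R : Fin n → Set} (P? : ∀ v → Dec (P v)) (Q? : ∀ v → Dec (Q v)) (R? : ∀ v → Dec (R v)) →
          (∀ v → P v → Q v ⊎ R v) → cnt P? ≤ cnt Q? + cnt R?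
  cnt-∪ {zero} P? Q? R? f = z≤n
  cnt-∪ {suc n} P? Q? R? f =
    subst (cnt P? ≤_) (interchange [ Q? fzero ]ᵈ [ R? fzero ]ᵈ (cnt (Q? ∘ fsuc)) (cnt (R? ∘ fsuc)))
      (+-mono-≤ ([]ᵈ-∪ (P? fzero) (Q? fzero) (R? fzero) (f fzero))
                (cnt-∪ (P? ∘ fsuc) (Q? ∘ fsuc) (R? ∘ fsuc) (f ∘ fsuc)))

  cnt-zero : ∀ {n} {P : Fin n → Set} (P? : ∀ v → Dec (P v)) → (∀ v → ¬ P v) → cnt P? ≡ 0
  cnt-zero {zero} P? f = refl
  cnt-zero {suc n} P? f with P? fzero
  ... | yes p = ⊥-elim (f fzero p)
  ... | no _ = cnt-zero (P? ∘ fsuc) (f ∘ fsuc)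

  cnt-strict : ∀ {n} {P Q : Fin n → Set} (P? : ∀ v → Dec (P v)) (Q? : ∀ v → Dec (Q v)) →
               (∀ v → P v → Q v) → ∀ u → Q u → ¬ P u → suc (cnt P?) ≤ cnt Q?
  cnt-strict {suc n} P? Q? f fzero q ¬p with P? fzero | Q? fzero
  ... | yes p | _ = ⊥-elim (¬p p)
  ... | no _ | no ¬q = ⊥-elim (¬q q)
  ... | no _ | yes _ = s≤s (cnt-mono (P? ∘ fsuc) (Q? ∘ fsuc) (f ∘ fsuc))
  cnt-strict {suc n} P? Q? f (fsuc u) q ¬p =
    subst (_≤ cnt Q?) (+-suc [ P? fzero ]ᵈ (cnt (P? ∘ fsuc)))
      (+-mono-≤ ([]ᵈ-mono (P? fzero) (Q? fzero) (f fzero))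
                (cnt-strict (P? ∘ fsuc) (Q? ∘ fsuc) (f ∘ fsuc) u q ¬p))

  cnt-some : ∀ {n} {P : Fin n → Set} (P? : ∀ v → Dec (P v)) → ∃ P → 0 < cnt P?
  cnt-some P? (u , p) = ≤-trans (s≤s z≤n) (cnt-strict {P = λ _ → ⊥} (λ _ → no id) P? (λ _ ()) u p id)

  cnt-pos : ∀ {n} {P : Fin n → Set} (P? : ∀ v → Dec (P v)) → 0 < cnt P? → ∃ P
  cnt-pos {suc n} P? h with P? fzero
  ... | yes p = fzero , p
  ... | no _ with cnt-pos (P? ∘ fsuc) h
  ... | v , p = fsuc v , p

  cnt-single : ∀ {n} {P : Fin n → Set} (P? : ∀ v → Dec (P v)) → (∀ u v → P u → P v → u ≡ v) → cnt P? ≤ 1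
  cnt-single {zero} P? f = z≤n
  cnt-single {suc n} P? f with P? fzero
  ... | yes p = s≤s (≤-reflexive (cnt-zero (P? ∘ fsuc) λ v q → fz≢ (f fzero (fsuc v) p q)))
    where fz≢ : ∀ {n} {v : Fin n} → fzero ≡ fsuc v → ⊥
          fz≢ ()
  ... | no _ = cnt-single (P? ∘ fsuc) λ u v p q → Finₚ.suc-injective (f _ _ p q)

  cnt-remove : ∀ {n} {P : Fin n → Set} (P? : ∀ v → Dec (P v)) (u : Fin n) →
               cnt P? ≤ suc (cnt (λ v → P? v ×-dec ¬? (v Finₚ.≟ u)))
  cnt-remove P? u =
    ≤-trans (cnt-∪ P? (λ v → v Finₚ.≟ u) (λ v → P? v ×-dec ¬? (v Finₚ.≟ u)) split)
            (+-monoˡ-≤ _ (cnt-single (λ v → v Finₚ.≟ u) λ _ _ p q → trans p (sym q)))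
    where
    split : ∀ v → _ → _
    split v p with v Finₚ.≟ u
    ... | yes e = inj₁ e
    ... | no ne = inj₂ (p , ne)

  cnt-pair : ∀ {n} {P : Fin n → Set} (P? : ∀ v → Dec (P v)) →
             (∀ u v w → P u → P v → P w → u ≡ v ⊎ v ≡ w ⊎ u ≡ w) → cnt P? ≤ 2
  cnt-pair P? f with Finₚ.any? P?
  ... | no ¬p = ≤-trans (≤-reflexive (cnt-zero P? λ v p → ¬p (v , p))) z≤n
  ... | yes (u , pu) =
    ≤-trans (cnt-remove P? u) (s≤s (cnt-single (λ v → P? v ×-dec ¬? (v Finₚ.≟ u)) λ { v w (pv , v≢u) (pw , w≢u)
        → go (f u v w pu pv pw) v≢u w≢u }))
    where
    go : ∀ {v w} → u ≡ v ⊎ v ≡ w ⊎ u ≡ w → v ≢ u → w ≢ u → v ≡ w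
    go (inj₁ e) a b = ⊥-elim (a (sym e))
    go (inj₂ (inj₁ e)) a b = e
    go (inj₂ (inj₂ e)) a b = ⊥-elim (b (sym e))

  cnt-length : ∀ {n} (xs : List (Fin n)) {P : Fin n → Set} (P? : ∀ v → Dec (P v)) →
               (∀ v → P v → v ∈ xs) → cnt P? ≤ length xs
  cnt-length [] P? f = ≤-reflexive (cnt-zero P? λ v p → case (f v p))
    where case : ∀ {v} → v ∈ [] → ⊥
          case ()
  cnt-length (x ∷ xs) P? f =
    ≤-trans (cnt-remove P? x) (s≤s (cnt-length xs (λ v → P? v ×-dec ¬? (v Finₚ.≟ x)) λ { v (p , ne) → tl (f v p) ne }))
    where tl : ∀ {v} → v ∈ x ∷ xs → v ≢ x → v ∈ xs
          tl (here e) ne = ⊥-elim (ne e)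
          tl (there m) _ = m

  cnt-disjoint : ∀ {n} {P Q R : Fin n → Set} (P? : ∀ v → Dec (P v)) (Q? : ∀ v → Dec (Q v)) (R? : ∀ v → Dec (R v)) →
    (∀ v → P v → R v) → (∀ v → Q v → R v) → (∀ v → P v → ¬ Q v) → cnt P? + cnt Q? ≤ cnt R?
  cnt-disjoint {zero} P? Q? R? f g d = z≤n
  cnt-disjoint {suc n} P? Q? R? f g d =
    subst (_≤ cnt R?) (sym (interchange [ P? fzero ]ᵈ (cnt (P? ∘ fsuc)) [ Q? fzero ]ᵈ (cnt (Q? ∘ fsuc))))
      (+-mono-≤ (one (P? fzero) (Q? fzero) (R? fzero) (f fzero) (g fzero) (d fzero))
                (cnt-disjoint (P? ∘ fsuc) (Q? ∘ fsuc) (R? ∘ fsuc) (f ∘ fsuc) (g ∘ fsuc) (d ∘ fsuc)))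
    where
    one : {P Q R : Set} (p : Dec P) (q : Dec Q) (r : Dec R) → (P → R) → (Q → R) → (P → ¬ Q) → [ p ]ᵈ + [ q ]ᵈ ≤ [ r ]ᵈ
    one (yes p) (yes q) r f g d = ⊥-elim (d p q)
    one (yes p) (no _) r f g d = []ᵈ-mono (yes p) r f
    one (no _) q r f g d = []ᵈ-mono q r g

  cnt-tabulate : ∀ {m} {P : Fin m → Set} (P? : ∀ v → Dec (P v)) → ∣ Vec.tabulate (λ v → does (P? v)) ∣ ≡ cnt P?
  cnt-tabulate {zero} P? = refl
  cnt-tabulate {suc m} P? with P? fzero
  ... | yes _ = cong suc (cnt-tabulate (P? ∘ fsuc))
  ... | no _ = cnt-tabulate (P? ∘ fsuc)

  does-true : {P : Set} (d : Dec P) → does d ≡ true → P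
  does-true (yes p) _ = p

  does-yes : {P : Set} (d : Dec P) → P → does d ≡ true
  does-yes (yes _) _ = refl
  does-yes (no ¬p) p = ⊥-elim (¬p p)

  maxi : ∀ {m} → (Fin m → ℕ) → ℕ
  maxi {zero} f = 0
  maxi {suc m} f = f fzero ⊔ maxi (f ∘ fsuc)

  ≤maxi : ∀ {m} (f : Fin m → ℕ) v → f v ≤ maxi f
  ≤maxi f fzero = m≤m⊔n _ _
  ≤maxi f (fsuc v) = ≤-trans (≤maxi (f ∘ fsuc) v) (m≤n⊔m (f fzero) _)

  -- Discrete intermediate value theorem: `f` may fall freely but climbs by at most one per step, so
  -- it cannot jump over `m`.
  intermediate : ∀ (f : ℕ → ℕ) (m a b : ℕ) → a ≤ b → f a ≤ m → m ≤ f b → (∀ w → f (suc w) ≤ suc (f w)) →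
                 Σ ℕ λ w → a ≤ w × w ≤ b × f w ≡ m
  intermediate f m a b a≤b fa fb st = go (b ∸ a) a (m∸n+n≡m a≤b) fa
    where
    go : ∀ d a → d + a ≡ b → f a ≤ m → Σ ℕ λ w → a ≤ w × w ≤ b × f w ≡ m
    go zero a refl fa = a , ≤-refl , ≤-refl , ≤-antisym fa fb
    go (suc d) a e fa with m≤n⇒m<n∨m≡n fa
    ... | inj₂ eq = a , ≤-refl , subst (a ≤_) e (m≤n+m a (suc d)) , eq
    ... | inj₁ lt with go d (suc a) (trans (+-suc d a) e) (≤-trans (st a) lt)
    ... | w , a<w , w≤b , eq = w , <⇒≤ a<w , w≤b , eq

  abstract
    argmin : ∀ {n} {P : Fin n → Set} (P? : ∀ v → Dec (P v)) (f : Fin n → ℕ) → ∃ P →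
             Σ (Fin n) λ v → P v × (∀ w → P w → f v ≤ f w)
    argmin {n} {P} P? f (v , p) = go v p (<-wellFounded (f v))
      where
      go : ∀ v → P v → Acc _<_ (f v) → Σ (Fin n) λ v → P v × (∀ w → P w → f v ≤ f w)
      go v p (acc rs) with Finₚ.any? (λ w → P? w ×-dec (f w <? f v))
      ... | yes (w , pw , lt) = go w pw (rs lt)
      ... | no none = v , p , λ w pw → ≮⇒≥ λ lt → none (w , pw , lt)

    argmax : ∀ {n} {P : Fin n → Set} (P? : ∀ v → Dec (P v)) (f : Fin n → ℕ) (M : ℕ) → (∀ v → f v ≤ M) → ∃ P →
             Σ (Fin n) λ v → P v × (∀ w → P w → f w ≤ f v)
    argmax P? f M bd e with argmin P? (λ v → M ∸ f v) e
    ... | v , p , min = v , p , λ w pw →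
      subst (_≤ f v) (m∸[m∸n]≡n (bd w)) (≤-trans (∸-monoʳ-≤ M (min w pw)) (≤-reflexive (m∸[m∸n]≡n (bd v))))

open Counting

-- Rings of crossing chords

-- Distinct ends remove all ties, so that passing one position changes the status of a single chord.
-- `M` makes searches over cuts finite.
record ChordSystem (n : ℕ) : Set where
  field
    L H   : Fin n → ℕ
    L<H   : ∀ v → L v < H v
    L-inj : ∀ {u v} → L u ≡ L v → u ≡ v
    H-inj : ∀ {u v} → H u ≡ H v → u ≡ v
    L≢H   : ∀ {u v} → L u ≢ H v
    M     : ℕ
    H≤M   : ∀ v → H v ≤ M

module Chords {n : ℕ} (𝒞 : ChordSystem n) where
  open ChordSystem 𝒞

  V : Set
  V = Fin n

  Cr : V → V → Set
  Cr u v = (L u < L v × L v < H u × H u < H v) ⊎ (L v < L u × L u < H v × H v < H u)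

  Cr-sym : ∀ {u v} → Cr u v → Cr v u
  Cr-sym (inj₁ p) = inj₂ p
  Cr-sym (inj₂ p) = inj₁ p

  Cr-irrefl : ∀ {u} → ¬ Cr u u
  Cr-irrefl (inj₁ (p , _)) = <-irrefl refl p
  Cr-irrefl (inj₂ (p , _)) = <-irrefl refl p

  Cr? : ∀ u v → Dec (Cr u v)
  Cr? u v = (L u <? L v ×-dec L v <? H u ×-dec H u <? H v) ⊎-dec (L v <? L u ×-dec L u <? H v ×-dec H v <? H u)

  L<-of-≤ : ∀ {u v} → u ≢ v → L u ≤ L v → L u < L v
  L<-of-≤ ne le = ≤∧≢⇒< le (ne ∘ L-inj)

  H<-of-≤ : ∀ {u v} → u ≢ v → H u ≤ H v → H u < H v
  H<-of-≤ ne le = ≤∧≢⇒< le (ne ∘ H-inj)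

  -- An orientation x places a virtual point of the disc on one side of every
  -- chord (x v ≡ true: on the side of the interval from L v to H v).  The
  -- arc of v is the part of the circle on the other side, and Cov q v says
  -- that the cut just before position q lies on that arc.
  module Orientation (x : V → Bool)
    (x-up : ∀ u v → L v < L u → H u < H v → x u ≡ true → x v ≡ true)
    (x-meet : ∀ u v → x u ≡ true → x v ≡ true → ¬ H u < L v) where

    Cov : ℕ → V → Set
    Cov q v = (x v ≡ false × L v < q × q ≤ H v) ⊎ (x v ≡ true × (q ≤ L v ⊎ H v < q))

    Cov? : ∀ q v → Dec (Cov q v)
    Cov? q v = ((x v Boolₚ.≟ false) ×-dec (L v <? q) ×-dec (q ≤? H v))
             ⊎-dec ((x v Boolₚ.≟ true) ×-dec ((q ≤? L v) ⊎-dec (H v <? q)))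

    t≢f : ∀ {v} {A : Set} → x v ≡ true → x v ≡ false → A
    t≢f p q with trans (sym p) q
    ... | ()

    -- A cycle whose arcs wind round the circle with one or two of them on every cut. In outcome
    -- (iii), `covers` supplies the two neighbours and `thin` the bound four.
    record Ring : Set where
      field
        len    : ℕ
        3≤len  : 3 ≤ len
        vert   : Fin len → V
        inj    : ∀ a b → vert a ≡ vert b → a ≡ b
        consec : ∀ a b → (suc (toℕ a) ≡ toℕ b ⊎ (suc (toℕ a) ≡ len × toℕ b ≡ 0)) → Cr (vert a) (vert b)
        covers : ∀ q → ∃ λ a → Cov q (vert a)
        thin   : ∀ q a b c → Cov q (vert a) → Cov q (vert b) → Cov q (vert c) → a ≡ b ⊎ b ≡ c ⊎ a ≡ c

    open Ring

    -- Since no two arcs cover the circle, an arc with both ends of a chord on it contains the whole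
    -- arc of that chord. So this is maximality of the arcs of `C` under inclusion.
    Maximal : (V → Set) → Ring → Set
    Maximal R C = ∀ a d → R d → d ≢ vert C a → Cov (L (vert C a)) d → Cov (H (vert C a)) d → ⊥

    -- Greedy cover of the circle: the first arc is the one through position 0 that starts earliest,
    -- at `h₀`; each further arc covers the cut just behind the previous end and extends as far as
    -- possible, until `h₀` is reached again.
    module Greedy {R : V → Set} (R? : ∀ v → Dec (R v))
      (covered : ∀ q → Σ V λ v → R v × Cov q v) where

      abstract
        -- The clockwise end of the arc: if `x v` is true, the arc runs from `H v` through position
        -- 0 to `L v`.
        reach : V → ℕ
        reach v = if x v then L v else H v

        reach-t : ∀ {v} → x v ≡ true → reach v ≡ L v
        reach-t e rewrite e = refl

        reach-f : ∀ {v} → x v ≡ false → reach v ≡ H v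
        reach-f e rewrite e = refl

        reach≤M : ∀ v → reach v ≤ M
        reach≤M v with x v
        ... | true = ≤-trans (<⇒≤ (L<H v)) (H≤M v)
        ... | false = H≤M v

        L≡reach : ∀ {u v} → L u ≡ reach v → u ≡ v
        L≡reach {u} {v} e with x v
        ... | true = L-inj e
        ... | false = ⊥-elim (L≢H e)

      abstract
        start : Σ V λ v → (R v × x v ≡ true) × (∀ w → R w × x w ≡ true → H v ≤ H w)
        start = argmin (λ v → R? v ×-dec (x v Boolₚ.≟ true)) H (at0 (covered 0))
          where
          at0 : Σ V (λ v → R v × Cov 0 v) → Σ V λ v → R v × x v ≡ true
          -- No interval of a chord contains cut 0, so whatever covers it has `x` true.
          at0 (v , r , inj₁ (_ , () , _))
          at0 (v , r , inj₂ (e , _)) = v , r , e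

        next : ∀ p → Σ V λ v → (R v × Cov (suc p) v) × (∀ w → R w × Cov (suc p) w → reach w ≤ reach v)
        next p = argmax (λ v → R? v ×-dec Cov? (suc p) v) reach M reach≤M (covered (suc p))

        vs : ℕ → V
        vs zero = proj₁ start
        vs (suc i) = proj₁ (next (reach (vs i)))

      v₀ : V
      v₀ = vs 0

      h₀ : ℕ
      h₀ = H v₀

      p : ℕ → ℕ
      p i = reach (vs i)

      abstract
        v₀-t : x v₀ ≡ true
        v₀-t = proj₂ (proj₁ (proj₂ start))

        h₀-min : ∀ w → R w → x w ≡ true → h₀ ≤ H w
        h₀-min w r e = proj₂ (proj₂ start) w (r , e)

        vs-R : ∀ i → R (vs i)
        vs-R zero = proj₁ (proj₁ (proj₂ start))
        vs-R (suc i) = proj₁ (proj₁ (proj₂ (next (p i))))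

        vs-cov : ∀ i → Cov (suc (p i)) (vs (suc i))
        vs-cov i = proj₂ (proj₁ (proj₂ (next (p i))))

        vs-max : ∀ i d → R d → Cov (suc (p i)) d → reach d ≤ p (suc i)
        vs-max i d r c = proj₂ (proj₂ (next (p i))) d (r , c)

      -- By minimality of `h₀`, an arc through position 0 does not start before `h₀`; hence an arc
      -- on a cut up to `h₀` covers it with its final stretch and ends beyond it.
      cov-reach : ∀ {v q} → R v → q < h₀ → Cov (suc q) v → q < reach v
      cov-reach r lt (inj₁ (e , _ , le)) = subst (_ <_) (sym (reach-f e)) le
      cov-reach r lt (inj₂ (e , inj₁ le)) = subst (_ <_) (sym (reach-t e)) le
      cov-reach {v} r lt (inj₂ (e , inj₂ (s≤s le))) = ⊥-elim (<-irrefl refl (≤-<-trans le (<-≤-trans lt (h₀-min v r e))))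

      cov-lo : ∀ {v q} → x v ≡ false → Cov (suc q) v → L v ≤ q
      cov-lo e (inj₁ (_ , s≤s le , _)) = le
      cov-lo e (inj₂ (e' , _)) = t≢f e' e

      abstract
        -- The ends `p i` increase strictly while below `h₀`, so `i ≤ p i` throughout and `h₀` steps
        -- of fuel suffice.
        stop : Σ ℕ λ k → h₀ ≤ p k × (∀ i → i < k → p i < h₀)
        stop = go h₀ 0 (≤-reflexive (sym (+-identityʳ h₀))) z≤n λ _ ()
          where
          go : ∀ f i → h₀ ≤ f + i → i ≤ p i → (∀ j → j < i → p j < h₀) → Σ ℕ λ k → h₀ ≤ p k × (∀ i → i < k → p i < h₀)
          go f i bd le all with h₀ ≤? p i
          ... | yes h = i , h , all
          go zero i bd le all | no h = ⊥-elim (h (≤-trans bd le))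
          go (suc f) i bd le all | no h =
            go f (suc i) (subst (h₀ ≤_) (sym (+-suc f i)) bd)
               (≤-<-trans le (cov-reach (vs-R (suc i)) (≰⇒> h) (vs-cov i))) all'
            where
            all' : ∀ j → j < suc i → p j < h₀
            all' j (s≤s j≤i) with m≤n⇒m<n∨m≡n j≤i
            ... | inj₁ j<i = all j j<i
            ... | inj₂ refl = ≰⇒> h

      k : ℕ
      k = proj₁ stop

      h₀≤pk : h₀ ≤ p k
      h₀≤pk = proj₁ (proj₂ stop)

      p<h₀ : ∀ {i} → i < k → p i < h₀
      p<h₀ {i} = proj₂ (proj₂ stop) i

      step : ∀ {i} → i < k → p i < p (suc i)
      step {i} lt = cov-reach (vs-R (suc i)) (p<h₀ lt) (vs-cov i)

      mono≤ : ∀ {i j} → i ≤ j → j ≤ k → p i ≤ p j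
      mono≤ {i} {j} i≤j j≤k with m≤n⇒m<n∨m≡n i≤j
      ... | inj₂ refl = ≤-refl
      mono≤ {i} {suc j} i≤j j≤k | inj₁ (s≤s i≤j') = ≤-trans (mono≤ i≤j' (<⇒≤ j≤k)) (<⇒≤ (step j≤k))

      mono< : ∀ {i j} → i < j → j ≤ k → p i < p j
      mono< {i} {j} i<j j≤k = <-≤-trans (step (<-≤-trans i<j j≤k)) (mono≤ i<j j≤k)

      vs-inj : ∀ {i j} → i ≤ k → j ≤ k → vs i ≡ vs j → i ≡ j
      vs-inj {i} {j} i≤k j≤k e with <-cmp i j
      ... | tri≈ _ eq _ = eq
      ... | tri< lt _ _ = ⊥-elim (<-irrefl (cong reach e) (mono< lt j≤k))
      ... | tri> _ _ gt = ⊥-elim (<-irrefl (cong reach (sym e)) (mono< gt i≤k))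

      -- If the arc of `vs (i + 2)` passed through position 0, it would contain the cut behind `p i`
      -- and would have beaten `vs (i + 1)` one step earlier. The same comparison proves `late-lo>`,
      -- which keeps arcs two steps apart from overlapping.
      late-f : ∀ {i} → suc (suc i) ≤ k → x (vs (suc (suc i))) ≡ false
      late-f {i} le with x (vs (suc (suc i))) in e
      ... | false = refl
      ... | true = ⊥-elim (<-irrefl refl (<-≤-trans (step le) (vs-max i _ (vs-R _)
                     (inj₂ (e , inj₁ (subst (p i <_) (reach-t e) (<-trans (step (<⇒≤ le)) (step le))))))))

      late-lo> : ∀ {i} → suc (suc i) ≤ k → p i < L (vs (suc (suc i)))
      late-lo> {i} le = ≰⇒> λ bad → <-irrefl refl (<-≤-trans (step le) (vs-max i _ (vs-R _)
        (inj₁ (late-f le , s≤s bad , subst (p i <_) (reach-f (late-f le)) (<-trans (step (<⇒≤ le)) (step le))))))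

      late-lo< : ∀ {i} → suc (suc i) ≤ k → L (vs (suc (suc i))) < p (suc i)
      late-lo< {i} le = ≤∧≢⇒< (cov-lo (late-f le) (vs-cov (suc i)))
        λ e → <-irrefl (cong reach (sym (L≡reach e))) (step le)

      p0≡ : p 0 ≡ L v₀
      p0≡ = reach-t v₀-t

      1≤k : 1 ≤ k
      1≤k = ≰⇒> λ k≤0 → <-irrefl refl (<-≤-trans (L<H v₀)
              (subst (h₀ ≤_) (trans (cong p (n≤0⇒n≡0 k≤0)) p0≡) h₀≤pk))

      v₁ : V
      v₁ = vs 1

      v₁≢v₀ : v₁ ≢ v₀
      v₁≢v₀ e = <-irrefl (cong reach (sym e)) (step 1≤k)

      first-f : x v₁ ≡ false → L v₁ < L v₀ × L v₀ < H v₁ × H v₁ < H v₀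
      first-f e = lo , subst (L v₀ <_) (reach-f e) (subst (_< p 1) p0≡ (step 1≤k)) , hi
        where
        lo : L v₁ < L v₀
        lo = L<-of-≤ v₁≢v₀ (subst (L v₁ ≤_) p0≡ (cov-lo e (vs-cov 0)))
        hi : H v₁ < H v₀
        hi = ≰⇒> λ le → t≢f (x-up v₀ v₁ lo (H<-of-≤ (v₁≢v₀ ∘ sym) le) v₀-t) e

      first-t : x v₁ ≡ true → L v₀ < L v₁ × L v₁ < H v₀ × H v₀ < H v₁
      first-t e = subst (L v₀ <_) (reach-t e) (subst (_< p 1) p0≡ (step 1≤k)) ,
        ≤∧≢⇒< (≮⇒≥ (x-meet v₀ v₁ v₀-t e)) L≢H ,
        H<-of-≤ (v₁≢v₀ ∘ sym) (h₀-min v₁ (vs-R 1) e)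

      -- `x-up` and `x-meet`, through `first-f` and `first-t`, prevent the arcs of `v₀` and `v₁`
      -- from covering the circle, so `h₀` is not yet reached.
      2≤k : 2 ≤ k
      2≤k = ≤∧≢⇒< 1≤k λ e → <-irrefl refl (<-≤-trans p1< (subst (λ j → h₀ ≤ p j) (sym e) h₀≤pk))
        where
        p1< : p 1 < h₀
        p1< with x v₁ in e
        ... | true = subst (_< h₀) (sym (reach-t e)) (proj₁ (proj₂ (first-t e)))
        ... | false = subst (_< h₀) (sym (reach-f e)) (proj₂ (proj₂ (first-f e)))

      cross : ∀ i → i < k → Cr (vs i) (vs (suc i))
      cross zero lt with x v₁ in e
      ... | true = inj₁ (first-t e)
      ... | false = inj₂ (first-f e)
      cross (suc i) lt = go i lt
        where
        hi-lt : ∀ i → suc (suc i) ≤ k → p (suc i) < H (vs (suc (suc i)))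
        hi-lt i lt = subst (p (suc i) <_) (reach-f (late-f lt)) (step lt)
        go : ∀ i → suc (suc i) ≤ k → Cr (vs (suc i)) (vs (suc (suc i)))
        go zero lt with x v₁ in e
        ... | false = inj₁ (<-trans (proj₁ (first-f e)) (subst (_< L (vs 2)) p0≡ (late-lo> lt)) ,
                            subst (L (vs 2) <_) (reach-f e) (late-lo< lt) ,
                            subst (_< H (vs 2)) (reach-f e) (hi-lt 0 lt))
        ... | true = inj₂ (l2< , subst (_< H (vs 2)) (reach-t e) (hi-lt 0 lt) ,
                           ≰⇒> λ le → t≢f (x-up v₁ (vs 2) l2< (H<-of-≤ ne le) e) (late-f lt))
          where
          l2< : L (vs 2) < L v₁
          l2< = subst (L (vs 2) <_) (reach-t e) (late-lo< lt)
          ne : v₁ ≢ vs 2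
          ne e' = <-irrefl (cong reach e') (step lt)
        go (suc i) lt =
          inj₁ (<-trans (late-lo< (<⇒≤ lt)) (late-lo> lt) ,
                subst (L (vs (suc (suc (suc i)))) <_) (reach-f (late-f (<⇒≤ lt))) (late-lo< lt) ,
                subst (_< H (vs (suc (suc (suc i))))) (reach-f (late-f (<⇒≤ lt))) (hi-lt (suc i) lt))

      -- v₀ is redundant exactly in this case.
      Overlap : Set
      Overlap = x v₁ ≡ true × H v₁ < H (vs k)

      last-lo : ∀ j → suc (suc j) ≡ k → p j < L (vs k) × L (vs k) < h₀ × x (vs k) ≡ false
      last-lo j e = subst (λ m → p j < L (vs m) × L (vs m) < h₀ × x (vs m) ≡ false) e
        (late-lo> le , <-trans (late-lo< le) (p<h₀ le) , late-f le)
        where le = ≤-reflexive e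

      v₀≢vk : v₀ ≢ vs k
      v₀≢vk e = <-irrefl (cong reach e) (mono< {0} 1≤k ≤-refl)

      close₀ : Cr (vs k) (vs 0)
      close₀ with k-2
        where
        k-2 : Σ ℕ λ j → suc (suc j) ≡ k
        k-2 = k ∸ 2 , m+[n∸m]≡n 2≤k
      ... | j , e with last-lo j e
      ... | a , b , f = inj₂ (subst (_< L (vs k)) p0≡ (≤-<-trans (mono≤ z≤n (subst (j ≤_) e (m≤n+m j 2))) a) , b ,
                              H<-of-≤ v₀≢vk (subst (h₀ ≤_) (reach-f f) h₀≤pk))

      -- Otherwise `vs 2` is the last chord and its interval contains that of `v₁`, so that their
      -- two arcs cover the circle, against `x-up`.
      3≤k : Overlap → 3 ≤ k
      3≤k (e , lt) = ≤∧≢⇒< 2≤k λ 2≡k → t≢f (x-up v₁ (vs k)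
          (subst (λ j → L (vs j) < L v₁) 2≡k (subst (L (vs 2) <_) (reach-t e) (late-lo< 2≤k))) lt e)
          (subst (λ j → x (vs j) ≡ false) 2≡k (late-f 2≤k))

      close₁ : Overlap → Cr (vs k) (vs 1)
      close₁ o@(e , lt) with k ∸ 2 | m+[n∸m]≡n 2≤k
      ... | j | eq with last-lo j eq
      ... | a , b , f = inj₂ (subst (_< L (vs k)) (reach-t e) (≤-<-trans (mono≤ 1≤j (subst (j ≤_) eq (m≤n+m j 2))) a) ,
                              <-trans b (proj₂ (proj₂ (first-t e))) , lt)
        where
        1≤j : 1 ≤ j
        1≤j with 3≤k o
        ... | h rewrite sym eq with h
        ... | s≤s (s≤s h') = h'

      -- The arc of `l` begins after `p i`, because `j` lies in between. So arc `i` can contain a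
      -- cut of it only with the stretch beyond `h₀`; then arc `j` does likewise, which forces
      -- `i = 0`, `j = 1` and `Overlap`.
      thin< : ∀ q i j l → i < j → j < l → l ≤ k → (i ≡ 0 → ¬ Overlap) → Cov q (vs i) → Cov q (vs j) → Cov q (vs l) → ⊥
      thin< q i (suc j) (suc zero) i<j (s≤s ()) l≤k ¬o ci cj cl
      thin< q i (suc j) (suc (suc l)) i<j (s≤s j<l) l≤k ¬o ci cj (inj₂ (e , _)) = t≢f e (late-f l≤k)
      thin< q i (suc j) (suc (suc l)) (s≤s i≤j) (s≤s (s≤s j≤l)) l≤k ¬o ci cj (inj₁ (_ , Ll<q , q≤Hl)) = at-i ci
        where
        pi<q : p i < q
        pi<q = <-trans (≤-<-trans (mono≤ (≤-trans i≤j j≤l) (≤-trans (m≤n+m l 2) l≤k)) (late-lo> l≤k)) Ll<q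
        pj<h₀ : p (suc j) < h₀
        pj<h₀ = p<h₀ (≤-trans (s≤s (s≤s j≤l)) l≤k)
        q≤pl : q ≤ p (suc (suc l))
        q≤pl = subst (q ≤_) (sym (reach-f (late-f l≤k))) q≤Hl
        at-j : ∀ j → i ≤ j → j ≤ l → h₀ < q → p (suc j) < h₀ → Cov q (vs (suc j)) → ⊥
        at-j j i≤j j≤l h<q pj (inj₁ (e , _ , le)) =
          <-irrefl refl (<-trans h<q (≤-<-trans (subst (q ≤_) (sym (reach-f e)) le) pj))
        at-j j i≤j j≤l h<q pj (inj₂ (e , inj₁ le)) =
          <-irrefl refl (<-trans h<q (≤-<-trans (subst (q ≤_) (sym (reach-t e)) le) pj))
        at-j (suc j) i≤j j≤l h<q pj (inj₂ (e , inj₂ _)) = t≢f e (late-f (≤-trans (s≤s (m≤n⇒m≤1+n j≤l)) l≤k))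
        at-j zero i≤j j≤l h<q pj (inj₂ (e , inj₂ lt)) =
          ¬o (n≤0⇒n≡0 i≤j) (e , subst (λ m → H v₁ < H (vs m)) l≡k (<-≤-trans lt q≤Hl))
          where
          l≡k : suc (suc l) ≡ k
          l≡k with m≤n⇒m<n∨m≡n l≤k
          ... | inj₂ eq = eq
          ... | inj₁ l<k = ⊥-elim (<-irrefl refl (<-trans h<q (≤-<-trans q≤pl (p<h₀ l<k))))
        at-i : Cov q (vs i) → ⊥
        at-i (inj₁ (e , _ , le)) = <-irrefl refl (<-≤-trans pi<q (subst (q ≤_) (sym (reach-f e)) le))
        at-i (inj₂ (e , inj₁ le)) = <-irrefl refl (<-≤-trans pi<q (subst (q ≤_) (sym (reach-t e)) le))
        at-i (inj₂ (e , inj₂ lt)) = at-j j i≤j j≤l (≤-<-trans (h₀-min (vs i) (vs-R i) e) lt) pj<h₀ cj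

      thin≤ : ∀ q i j l → i ≤ k → j ≤ k → l ≤ k → (i ≡ 0 ⊎ j ≡ 0 ⊎ l ≡ 0 → ¬ Overlap) →
              Cov q (vs i) → Cov q (vs j) → Cov q (vs l) → i ≡ j ⊎ j ≡ l ⊎ i ≡ l
      thin≤ q i j l i≤ j≤ l≤ ¬o ci cj cl with <-cmp i j | <-cmp j l | <-cmp i l
      ... | tri≈ _ e _ | _ | _ = inj₁ e
      ... | _ | tri≈ _ e _ | _ = inj₂ (inj₁ e)
      ... | _ | _ | tri≈ _ e _ = inj₂ (inj₂ e)
      ... | tri< a _ _ | tri< b _ _ | _ = ⊥-elim (thin< q i j l a b l≤ (¬o ∘ inj₁) ci cj cl)
      ... | tri< a _ _ | tri> _ _ b | tri< c _ _ = ⊥-elim (thin< q i l j c b j≤ (¬o ∘ inj₁) ci cl cj)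
      ... | tri< a _ _ | tri> _ _ b | tri> _ _ c = ⊥-elim (thin< q l i j c a j≤ (¬o ∘ inj₂ ∘ inj₂) cl ci cj)
      ... | tri> _ _ a | tri< b _ _ | tri< c _ _ = ⊥-elim (thin< q j i l a c l≤ (¬o ∘ inj₂ ∘ inj₁) cj ci cl)
      ... | tri> _ _ a | tri< b _ _ | tri> _ _ c = ⊥-elim (thin< q j l i b c i≤ (¬o ∘ inj₂ ∘ inj₁) cj cl ci)
      ... | tri> _ _ a | tri> _ _ b | _ = ⊥-elim (thin< q l j i b a i≤ (¬o ∘ inj₂ ∘ inj₂) cl cj ci)

      seek : ∀ q d s → d + s ≡ k → p s < q → q ≤ p k → Σ ℕ λ i → s < i × i ≤ k × Cov q (vs i)
      seek q zero s e lt le = ⊥-elim (<-irrefl (cong p e) (<-≤-trans lt le))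
      seek q (suc d) s e lt le with q ≤? p (suc s)
      ... | no gt with seek q d (suc s) (trans (+-suc d s) e) (≰⇒> gt) le
      ... | i , s<i , i≤k , c = i , <-trans (n<1+n s) s<i , i≤k , c
      seek q (suc d) s e lt le | yes q≤ = suc s , ≤-refl , s<k , found
        where
        s<k : s < k
        s<k = subst (s <_) e (s≤s (m≤n+m s d))
        found : Cov q (vs (suc s))
        found with x (vs (suc s)) in ex
        ... | false = inj₁ (refl , ≤-<-trans (cov-lo ex (vs-cov s)) lt , subst (q ≤_) (reach-f ex) q≤)
        ... | true = inj₂ (refl , inj₁ (subst (q ≤_) (reach-t ex) q≤))

      -- An arc containing both ends of `vs i` would reach further than the greedy choice, or start
      -- earlier than `v₀`, or cover the circle together with the arc of `vs i`.
      maxi-vs : ∀ i → i ≤ k → ∀ d → R d → d ≢ vs i → Cov (L (vs i)) d → Cov (H (vs i)) d → ⊥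
      maxi-vs i i≤k d r ne (inj₁ (e , _)) (inj₂ (e' , _)) = t≢f e' e
      maxi-vs i i≤k d r ne (inj₂ (e , _)) (inj₁ (e' , _)) = t≢f e e'
      maxi-vs i i≤k d r ne (inj₁ (e , Ld< , _)) (inj₁ (_ , _ , Hc≤)) = outer i i≤k ne Ld< Hc≤
        where
        outer : ∀ i → i ≤ k → d ≢ vs i → L d < L (vs i) → H (vs i) ≤ H d → ⊥
        outer i i≤k ne Ld< Hc≤ with x (vs i) in ec
        ... | true = t≢f (x-up (vs i) d Ld< (H<-of-≤ (ne ∘ sym) Hc≤) ec) e
        outer zero i≤k ne Ld< Hc≤ | false = t≢f v₀-t ec
        outer (suc i) i≤k ne Ld< Hc≤ | false =
          <-irrefl refl (<-≤-trans (subst (H (vs (suc i)) <_) (sym (reach-f e)) Hc<) (subst (reach d ≤_) (reach-f ec)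
            (vs-max i d r (inj₁ (e , s≤s (<⇒≤ (<-≤-trans Ld< (cov-lo ec (vs-cov i)))) ,
               <-≤-trans (subst (p i <_) (reach-f ec) (step i≤k)) (<⇒≤ Hc<))))))
          where Hc< = H<-of-≤ (ne ∘ sym) Hc≤
      maxi-vs i i≤k d r ne (inj₂ (e , inj₂ Hd<Lc)) _ with x (vs i) in ec
      ... | true = x-meet d (vs i) e ec Hd<Lc
      maxi-vs zero i≤k d r ne (inj₂ (e , inj₂ Hd<Lc)) _ | false = t≢f v₀-t ec
      maxi-vs (suc i) i≤k d r ne (inj₂ (e , inj₂ Hd<Lc)) _ | false =
        <-irrefl refl (<-trans Hd<Lc (≤-<-trans (cov-lo ec (vs-cov i)) (<-≤-trans (p<h₀ i≤k) (h₀-min d r e))))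
      maxi-vs i i≤k d r ne (inj₂ (e , inj₁ Lc≤Ld)) (inj₂ (_ , inj₁ Hc≤Ld)) with x (vs i) in ec
      ... | true = x-meet (vs i) d ec e (≤∧≢⇒< Hc≤Ld (L≢H ∘ sym))
      maxi-vs zero i≤k d r ne (inj₂ (e , inj₁ Lc≤Ld)) (inj₂ (_ , inj₁ Hc≤Ld)) | false = t≢f v₀-t ec
      maxi-vs (suc i) i≤k d r ne (inj₂ (e , inj₁ Lc≤Ld)) (inj₂ (_ , inj₁ Hc≤Ld)) | false =
        <-irrefl refl (<-≤-trans (subst (H (vs (suc i)) <_) (sym (reach-t e)) Hc<) (subst (reach d ≤_) (reach-f ec)
          (vs-max i d r (inj₂ (e , inj₁ (<-≤-trans (subst (p i <_) (reach-f ec) (step i≤k)) Hc≤Ld))))))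
        where Hc< = ≤∧≢⇒< Hc≤Ld (L≢H ∘ sym)
      maxi-vs zero i≤k d r ne (inj₂ (e , inj₁ Lc≤Ld)) (inj₂ (_ , inj₂ Hd<Hc)) =
        <-irrefl refl (<-≤-trans Hd<Hc (h₀-min d r e))
      maxi-vs (suc i) i≤k d r ne (inj₂ (e , inj₁ Lc≤Ld)) (inj₂ (_ , inj₂ Hd<Hc)) =
        <-irrefl refl (<-≤-trans (subst (L (vs (suc i)) <_) (sym (reach-t e)) Lc<) (subst (reach d ≤_) (reach-t ec)
          (vs-max i d r (inj₂ (e , inj₁ (<-≤-trans (subst (p i <_) (reach-t ec) (step i≤k)) Lc≤Ld))))))
        where
        Lc< = L<-of-≤ (ne ∘ sym) Lc≤Ld
        ec : x (vs (suc i)) ≡ true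
        ec = x-up d (vs (suc i)) Lc< Hd<Hc e

      ring₀ : ¬ Overlap → Σ Ring λ C → (∀ a → R (vert C a)) × Maximal R C
      ring₀ ¬o = record
        { len = suc k ; 3≤len = s≤s 2≤k ; vert = λ a → vs (toℕ a)
        ; inj = λ a b e → Finₚ.toℕ-injective (vs-inj (Finₚ.toℕ≤pred[n] a) (Finₚ.toℕ≤pred[n] b) e)
        ; consec = con
        ; covers = cov
        ; thin = λ q a b c ca cb cc → fin (thin≤ q _ _ _ (Finₚ.toℕ≤pred[n] a) (Finₚ.toℕ≤pred[n] b)
            (Finₚ.toℕ≤pred[n] c) (λ _ → ¬o) ca cb cc) }
        , (λ a → vs-R (toℕ a)) , λ a → maxi-vs (toℕ a) (Finₚ.toℕ≤pred[n] a)
        where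
        fin : ∀ {a b c : Fin (suc k)} → toℕ a ≡ toℕ b ⊎ toℕ b ≡ toℕ c ⊎ toℕ a ≡ toℕ c → a ≡ b ⊎ b ≡ c ⊎ a ≡ c
        fin (inj₁ e) = inj₁ (Finₚ.toℕ-injective e)
        fin (inj₂ (inj₁ e)) = inj₂ (inj₁ (Finₚ.toℕ-injective e))
        fin (inj₂ (inj₂ e)) = inj₂ (inj₂ (Finₚ.toℕ-injective e))
        con : ∀ a b → (suc (toℕ a) ≡ toℕ b ⊎ (suc (toℕ a) ≡ suc k × toℕ b ≡ 0)) → Cr (vs (toℕ a)) (vs (toℕ b))
        con a b (inj₁ e) = subst (Cr (vs (toℕ a)) ∘ vs) e (cross (toℕ a) (subst (_≤ k) (sym e) (Finₚ.toℕ≤pred[n] b)))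
        con a b (inj₂ (e , e')) rewrite suc-injective e | e' = close₀
        at : ∀ {q} i → i ≤ k → Cov q (vs i) → ∃ λ (a : Fin (suc k)) → Cov q (vs (toℕ a))
        at {q} i le c = fromℕ< (s≤s le) , subst (Cov q ∘ vs) (sym (Finₚ.toℕ-fromℕ< (s≤s le))) c
        cov : ∀ q → ∃ λ (a : Fin (suc k)) → Cov q (vs (toℕ a))
        cov q with q ≤? L v₀ | h₀ <? q
        ... | yes le | _ = at 0 z≤n (inj₂ (v₀-t , inj₁ le))
        ... | no _ | yes lt = at 0 z≤n (inj₂ (v₀-t , inj₂ lt))
        ... | no gt | no le with seek q k 0 (+-identityʳ k) (subst (_< q) (sym p0≡) (≰⇒> gt)) (≤-trans (≮⇒≥ le) h₀≤pk)
        ... | i , _ , i≤k , c = at i i≤k c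

      ring₁ : Overlap → Σ Ring λ C → (∀ a → R (vert C a)) × Maximal R C
      ring₁ o = record
        { len = k ; 3≤len = 3≤k o ; vert = λ a → vs (suc (toℕ a))
        ; inj = λ a b e → Finₚ.toℕ-injective (suc-injective (vs-inj (Finₚ.toℕ<n a) (Finₚ.toℕ<n b) e))
        ; consec = con
        ; covers = cov
        ; thin = λ q a b c ca cb cc → fin (thin≤ q _ _ _ (Finₚ.toℕ<n a) (Finₚ.toℕ<n b) (Finₚ.toℕ<n c) (λ {
            (inj₁ ()) ; (inj₂ (inj₁ ())) ; (inj₂ (inj₂ ())) }) ca cb cc) }
        , (λ a → vs-R (suc (toℕ a))) , λ a → maxi-vs (suc (toℕ a)) (Finₚ.toℕ<n a)
        where
        fin : ∀ {a b c : Fin k} → suc (toℕ a) ≡ suc (toℕ b) ⊎ suc (toℕ b) ≡ suc (toℕ c) ⊎ suc (toℕ a) ≡ suc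
            (toℕ c) → a ≡ b ⊎ b ≡ c ⊎ a ≡ c
        fin (inj₁ e) = inj₁ (Finₚ.toℕ-injective (suc-injective e))
        fin (inj₂ (inj₁ e)) = inj₂ (inj₁ (Finₚ.toℕ-injective (suc-injective e)))
        fin (inj₂ (inj₂ e)) = inj₂ (inj₂ (Finₚ.toℕ-injective (suc-injective e)))
        con : ∀ a b → (suc (toℕ a) ≡ toℕ b ⊎ (suc (toℕ a) ≡ k × toℕ b ≡ 0)) → Cr (vs (suc (toℕ a))) (vs (suc (toℕ b)))
        con a b (inj₁ e) = subst (Cr (vs (suc (toℕ a))) ∘ vs ∘ suc) e (cross (suc (toℕ a)) (subst (_< k) (sym e) (Finₚ.toℕ<n b)))
        con a b (inj₂ (e , e')) rewrite e' = subst (λ m → Cr (vs m) v₁) (sym e) (close₁ o)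
        at : ∀ {q} i → i < k → Cov q (vs (suc i)) → ∃ λ (a : Fin k) → Cov q (vs (suc (toℕ a)))
        at {q} i le c = fromℕ< le , subst (Cov q ∘ vs ∘ suc) (sym (Finₚ.toℕ-fromℕ< le)) c
        cov : ∀ q → ∃ λ (a : Fin k) → Cov q (vs (suc (toℕ a)))
        cov q with q ≤? L v₁ | H v₁ <? q
        ... | yes le | _ = at 0 1≤k (inj₂ (proj₁ o , inj₁ le))
        ... | no _ | yes lt = at 0 1≤k (inj₂ (proj₁ o , inj₂ lt))
        ... | no gt | no le with seek q (k ∸ 1) 1 (m∸n+n≡m 1≤k) (subst (_< q) (sym (reach-t (proj₁ o))) (≰⇒> gt))
                                 (≤-trans (≮⇒≥ le) (<⇒≤ (subst (H v₁ <_) (sym (reach-f (proj₂ (proj₂ (last-lo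
                                     (k ∸ 2) (m+[n∸m]≡n 2≤k)))))) (proj₂ o))))
        ... | suc i , _ , i≤k , c = at i i≤k c

      ring : Σ Ring λ C → (∀ a → R (vert C a)) × Maximal R C
      ring with (x v₁ Boolₚ.≟ true) ×-dec (H v₁ <? H (vs k))
      ... | yes o = ring₁ o
      ... | no ¬o = ring₀ ¬o

    endpoint-split : ∀ {c d} → c ≢ d → (Cov (L c) d × ¬ Cov (H c) d) ⊎ (Cov (H c) d × ¬ Cov (L c) d) → Cr c d
    endpoint-split {c} {d} ne (inj₁ (inj₁ (e , lt , le) , ¬h)) =
      inj₂ (lt , ≤∧≢⇒< le L≢H , ≰⇒> λ Hc≤ → ¬h (inj₁ (e , <-trans lt (L<H c) , Hc≤)))
    endpoint-split {c} {d} ne (inj₁ (inj₂ (e , inj₁ le) , ¬h)) =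
      inj₁ (L<-of-≤ ne le , ≰⇒> (λ Hc≤ → ¬h (inj₂ (e , inj₁ Hc≤))) ,
            H<-of-≤ ne (≮⇒≥ λ lt → ¬h (inj₂ (e , inj₂ lt))))
    endpoint-split {c} {d} ne (inj₁ (inj₂ (e , inj₂ lt) , ¬h)) = ⊥-elim (¬h (inj₂ (e , inj₂ (<-trans lt (L<H c)))))
    endpoint-split {c} {d} ne (inj₂ (inj₁ (e , lt , le) , ¬l)) =
      inj₁ (L<-of-≤ ne (≮⇒≥ λ lt' → ¬l (inj₁ (e , lt' , <⇒≤ (<-≤-trans (L<H c) le)))) ,
            lt , H<-of-≤ ne le)
    endpoint-split {c} {d} ne (inj₂ (inj₂ (e , inj₁ le) , ¬l)) = ⊥-elim (¬l (inj₂ (e , inj₁ (<⇒≤ (<-≤-trans (L<H c) le)))))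
    endpoint-split {c} {d} ne (inj₂ (inj₂ (e , inj₂ lt) , ¬l)) =
      inj₂ (≰⇒> (λ le → ¬l (inj₂ (e , inj₁ le))) ,
            ≤∧≢⇒< (≮⇒≥ λ lt' → ¬l (inj₂ (e , inj₂ lt'))) L≢H , lt)

    cross-cov : ∀ {c d} → Cr c d → Cov (L c) d ⊎ Cov (H c) d
    cross-cov {c} {d} cr with x d in e
    cross-cov (inj₁ (a , b , h)) | true = inj₁ (inj₂ (refl , inj₁ (<⇒≤ a)))
    cross-cov (inj₁ (a , b , h)) | false = inj₂ (inj₁ (refl , b , <⇒≤ h))
    cross-cov (inj₂ (a , b , h)) | true = inj₂ (inj₂ (refl , inj₂ h))
    cross-cov (inj₂ (a , b , h)) | false = inj₁ (inj₁ (refl , a , <⇒≤ b))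

    three-of-five : {P Q : Fin 5 → Set} → (∀ i → P i ⊎ Q i) →
      Σ (Fin 5) λ a → Σ (Fin 5) λ b → Σ (Fin 5) λ c → (a ≢ b × b ≢ c × a ≢ c) × ((P a × P b × P c) ⊎ (Q a × Q b × Q c))
    three-of-five f with f (# 0) | f (# 1) | f (# 2) | f (# 3) | f (# 4)
    ... | inj₁ a | inj₁ b | inj₁ c | _ | _ = # 0 , # 1 , # 2 , ((λ ()) , (λ ()) , (λ ())) , inj₁ (a , b , c)
    ... | inj₁ a | inj₁ b | inj₂ _ | inj₁ c | _ = # 0 , # 1 , # 3 , ((λ ()) , (λ ()) , (λ ())) , inj₁ (a , b , c)
    ... | inj₁ a | inj₁ b | inj₂ _ | inj₂ _ | inj₁ c = # 0 , # 1 , # 4 , ((λ ()) , (λ ()) , (λ ())) , inj₁ (a , b , c)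
    ... | inj₁ _ | inj₁ _ | inj₂ a | inj₂ b | inj₂ c = # 2 , # 3 , # 4 , ((λ ()) , (λ ()) , (λ ())) , inj₂ (a , b , c)
    ... | inj₁ a | inj₂ _ | inj₁ b | inj₁ c | _ = # 0 , # 2 , # 3 , ((λ ()) , (λ ()) , (λ ())) , inj₁ (a , b , c)
    ... | inj₁ a | inj₂ _ | inj₁ b | inj₂ _ | inj₁ c = # 0 , # 2 , # 4 , ((λ ()) , (λ ()) , (λ ())) , inj₁ (a , b , c)
    ... | inj₁ _ | inj₂ a | inj₁ _ | inj₂ b | inj₂ c = # 1 , # 3 , # 4 , ((λ ()) , (λ ()) , (λ ())) , inj₂ (a , b , c)
    ... | inj₁ _ | inj₂ a | inj₂ b | inj₂ c | _ = # 1 , # 2 , # 3 , ((λ ()) , (λ ()) , (λ ())) , inj₂ (a , b , c)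
    ... | inj₁ _ | inj₂ a | inj₂ b | inj₁ _ | inj₂ c = # 1 , # 2 , # 4 , ((λ ()) , (λ ()) , (λ ())) , inj₂ (a , b , c)
    ... | inj₁ a | inj₂ _ | inj₂ _ | inj₁ b | inj₁ c = # 0 , # 3 , # 4 , ((λ ()) , (λ ()) , (λ ())) , inj₁ (a , b , c)
    ... | inj₂ a | inj₂ b | inj₂ c | _ | _ = # 0 , # 1 , # 2 , ((λ ()) , (λ ()) , (λ ())) , inj₂ (a , b , c)
    ... | inj₂ a | inj₂ b | inj₁ _ | inj₂ c | _ = # 0 , # 1 , # 3 , ((λ ()) , (λ ()) , (λ ())) , inj₂ (a , b , c)
    ... | inj₂ a | inj₂ b | inj₁ _ | inj₁ _ | inj₂ c = # 0 , # 1 , # 4 , ((λ ()) , (λ ()) , (λ ())) , inj₂ (a , b , c)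
    ... | inj₂ _ | inj₂ _ | inj₁ a | inj₁ b | inj₁ c = # 2 , # 3 , # 4 , ((λ ()) , (λ ()) , (λ ())) , inj₁ (a , b , c)
    ... | inj₂ a | inj₁ _ | inj₂ b | inj₂ c | _ = # 0 , # 2 , # 3 , ((λ ()) , (λ ()) , (λ ())) , inj₂ (a , b , c)
    ... | inj₂ a | inj₁ _ | inj₂ b | inj₁ _ | inj₂ c = # 0 , # 2 , # 4 , ((λ ()) , (λ ()) , (λ ())) , inj₂ (a , b , c)
    ... | inj₂ _ | inj₁ a | inj₂ _ | inj₁ b | inj₁ c = # 1 , # 3 , # 4 , ((λ ()) , (λ ()) , (λ ())) , inj₁ (a , b , c)
    ... | inj₂ _ | inj₁ a | inj₁ b | inj₁ c | _ = # 1 , # 2 , # 3 , ((λ ()) , (λ ()) , (λ ())) , inj₁ (a , b , c)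
    ... | inj₂ _ | inj₁ a | inj₁ b | inj₂ _ | inj₁ c = # 1 , # 2 , # 4 , ((λ ()) , (λ ()) , (λ ())) , inj₁ (a , b , c)
    ... | inj₂ a | inj₁ _ | inj₁ _ | inj₂ b | inj₂ c = # 0 , # 3 , # 4 , ((λ ()) , (λ ()) , (λ ())) , inj₂ (a , b , c)

    -- Each endpoint of v lies on at most two arcs of the ring.
    four-neighbours : ∀ C v (e : Fin 5 → Fin (len C)) → (∀ k k' → e k ≡ e k' → k ≡ k') → ¬ (∀ k → Cr v (vert C (e k)))
    four-neighbours C v e einj nb with three-of-five (λ k → cross-cov (nb k))
    ... | a , b , c , (ab , bc , ac) , covs = clash (same covs)
      where
      same : _ → e a ≡ e b ⊎ e b ≡ e c ⊎ e a ≡ e c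
      same (inj₁ (p , q , r)) = thin C _ _ _ _ p q r
      same (inj₂ (p , q , r)) = thin C _ _ _ _ p q r
      clash : e a ≡ e b ⊎ e b ≡ e c ⊎ e a ≡ e c → ⊥
      clash (inj₁ p) = ab (einj _ _ p)
      clash (inj₂ (inj₁ p)) = bc (einj _ _ p)
      clash (inj₂ (inj₂ p)) = ac (einj _ _ p)

    record Family (m : ℕ) (R : V → Set) : Set where
      field
        C    : Fin m → Ring
        C-R  : ∀ i a → R (vert (C i) a)
        disj : ∀ i j a b → vert (C i) a ≡ vert (C j) b → i ≡ j
        twice : ∀ i j → i Fin.< j → ∀ a → ∃₂ λ b b' →
                b ≢ b' × Cr (vert (C i) a) (vert (C j) b) × Cr (vert (C i) a) (vert (C j) b')

    -- A ring puts at most two arcs on any cut, whence `2 * m`. The ring removed first is maximal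
    -- among all chords that remain, including those of later rings: a later ring covers both ends
    -- of each of its chords, but no single arc does, so two different chords of the later ring
    -- cross it.
    peel : ∀ m {R : V → Set} (R? : ∀ v → Dec (R v)) →
           (Σ ℕ λ q → cnt (λ v → R? v ×-dec Cov? q v) ≤ 2 * m) ⊎ Family m R
    peel zero R? = inj₂ (record { C = λ () ; C-R = λ () ; disj = λ () ; twice = λ () })
    -- All cuts beyond `M + 1` lie on the same arcs as `M + 1`, so testing the cuts up to there is
    -- enough.
    peel (suc m) {R} R? with Finₚ.any? {n = suc (suc M)} (λ q → Finₚ.all? (λ v → ¬? (R? v ×-dec Cov? (toℕ q) v)))
    ... | yes (q , none) = inj₁ (toℕ q , ≤-trans (≤-reflexive (cnt-zero (λ v → R? v ×-dec Cov? (toℕ q) v) none)) z≤n)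
    ... | no ¬free = rest (Greedy.ring R? covered)
      where
      covered≤ : ∀ q → q < suc (suc M) → Σ V λ v → R v × Cov q v
      covered≤ q lt with Finₚ.any? (λ v → R? v ×-dec Cov? q v)
      ... | yes c = c
      ... | no ¬c = ⊥-elim (¬free (fromℕ< lt , λ v c → ¬c (v , subst (λ q → R v × Cov q v) (Finₚ.toℕ-fromℕ< lt) c)))

      beyond : ∀ {q} → suc M < q → (Σ V λ v → R v × Cov (suc M) v) → Σ V λ v → R v × Cov q v
      beyond lt (v , r , inj₁ (_ , _ , le)) = ⊥-elim (<-irrefl refl (≤-trans le (H≤M v)))
      beyond lt (v , r , inj₂ (e , _)) = v , r , inj₂ (e , inj₂ (≤-<-trans (H≤M v) (<-trans (n<1+n M) lt)))

      covered : ∀ q → Σ V λ v → R v × Cov q v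
      covered q with q <? suc (suc M)
      ... | yes lt = covered≤ q lt
      ... | no ge = beyond (≮⇒≥ ge) (covered≤ (suc M) ≤-refl)

      rest : (Σ Ring λ C → (∀ a → R (vert C a)) × Maximal R C) →
             (Σ ℕ λ q → cnt (λ v → R? v ×-dec Cov? q v) ≤ 2 * suc m) ⊎ Family (suc m) R
      rest (C₀ , C₀-R , mx) = combine (peel m (λ v → R? v ×-dec Finₚ.all? (λ a → ¬? (vert C₀ a Finₚ.≟ v))))
        where
        R' : V → Set
        R' v = R v × (∀ a → vert C₀ a ≢ v)
        R'? : ∀ v → Dec (R' v)
        R'? v = R? v ×-dec Finₚ.all? (λ a → ¬? (vert C₀ a Finₚ.≟ v))

        combine : (Σ ℕ λ q → cnt (λ v → R'? v ×-dec Cov? q v) ≤ 2 * m) ⊎ Family m R' →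
                  (Σ ℕ λ q → cnt (λ v → R? v ×-dec Cov? q v) ≤ 2 * suc m) ⊎ Family (suc m) R
        combine (inj₁ (q , bd)) = inj₁ (q , ≤-trans
          (cnt-∪ (λ v → R? v ×-dec Cov? q v) on? (λ v → R'? v ×-dec Cov? q v) split)
          (≤-trans (+-mono-≤ (cnt-pair on? pair) bd) (≤-reflexive (sym (*-suc 2 m)))))
          where
          On : V → Set
          On v = (∃ λ a → vert C₀ a ≡ v) × Cov q v
          on? : ∀ v → Dec (On v)
          on? v = Finₚ.any? (λ a → vert C₀ a Finₚ.≟ v) ×-dec Cov? q v
          split : ∀ v → R v × Cov q v → On v ⊎ (R' v × Cov q v)
          split v (r , c) with Finₚ.any? (λ a → vert C₀ a Finₚ.≟ v)
          ... | yes a = inj₁ (a , c)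
          ... | no ¬a = inj₂ ((r , λ a e → ¬a (a , e)) , c)
          pair : ∀ u v w → On u → On v → On w → u ≡ v ⊎ v ≡ w ⊎ u ≡ w
          pair u v w ((a , refl) , ca) ((b , refl) , cb) ((c , refl) , cc) with thin C₀ q a b c ca cb cc
          ... | inj₁ e = inj₁ (cong (vert C₀) e)
          ... | inj₂ (inj₁ e) = inj₂ (inj₁ (cong (vert C₀) e))
          ... | inj₂ (inj₂ e) = inj₂ (inj₂ (cong (vert C₀) e))
        combine (inj₂ F) = inj₂ (record
          { C = C' ; C-R = C'-R ; disj = disj' ; twice = twice' })
          where
          open Family F
          C' : Fin (suc m) → Ring
          C' fzero = C₀
          C' (fsuc i) = C i
          C'-R : ∀ i a → R (vert (C' i) a)
          C'-R fzero a = C₀-R a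
          C'-R (fsuc i) a = proj₁ (C-R i a)
          disj' : ∀ i j a b → vert (C' i) a ≡ vert (C' j) b → i ≡ j
          disj' fzero fzero a b e = refl
          disj' fzero (fsuc j) a b e = ⊥-elim (proj₂ (C-R j b) a e)
          disj' (fsuc i) fzero a b e = ⊥-elim (proj₂ (C-R i a) b (sym e))
          disj' (fsuc i) (fsuc j) a b e = cong fsuc (disj i j a b e)
          twice' : ∀ i j → i Fin.< j → ∀ a → ∃₂ λ b b' →
                   b ≢ b' × Cr (vert (C' i) a) (vert (C' j) b) × Cr (vert (C' i) a) (vert (C' j) b')
          twice' (fsuc i) (fsuc j) (s≤s lt) a = twice i j lt a
          twice' fzero (fsuc j) lt a with covers (C j) (L (vert C₀ a)) | covers (C j) (H (vert C₀ a))
          ... | b , cb | b' , cb' =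
            b , b' , (λ e → nc b cb (subst (λ b → Cov _ (vert (C j) b)) (sym e) cb')) ,
            endpoint-split (ne b) (inj₁ (cb , nc b cb)) ,
            endpoint-split (ne b') (inj₂ (cb' , λ c → nc b' c cb'))
            where
            ne : ∀ b → vert C₀ a ≢ vert (C j) b
            ne b = proj₂ (C-R j b) a
            nc : ∀ b → Cov (L (vert C₀ a)) (vert (C j) b) → Cov (H (vert C₀ a)) (vert (C j) b) → ⊥
            nc b = mx a _ (proj₁ (C-R j b)) (ne b ∘ sym)

    toOutcome : ∀ {m R} → Family m R → CycleOutcome m n Cr
    toOutcome F =
      (λ i → record { len = len (C i) ; 3≤len = 3≤len (C i) ; vert = vert (C i) ; inj = inj (C i) ; consec = consec (C i) }) ,
      disj , twice , λ v i → four-neighbours (C i) v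
      where open Family F

-- Cheap cuts

module Cuts {n : ℕ} (𝒞 : ChordSystem n) where
  open ChordSystem 𝒞
  open Chords 𝒞

  In : ℕ → V → Set
  In q v = L v < q × q ≤ H v

  In? : ∀ q v → Dec (In q v)
  In? q v = L v <? q ×-dec q ≤? H v

  ¬In : ∀ {q v} → ¬ In q v → q ≤ L v ⊎ H v < q
  ¬In {q} {v} h with L v <? q
  ... | no ge = inj₁ (≮⇒≥ ge)
  ... | yes lt = inj₂ (≰⇒> λ le → h (lt , le))

  -- The chords separating two cuts; for `a ≤ b`, those with exactly one end in [a, b). Being a
  -- symmetric difference, it obeys the triangle inequality `St-split`.
  St : ℕ → ℕ → V → Set
  St a b v = (In a v × ¬ In b v) ⊎ (¬ In a v × In b v)

  St? : ∀ a b v → Dec (St a b v)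
  St? a b v = (In? a v ×-dec ¬? (In? b v)) ⊎-dec (¬? (In? a v) ×-dec In? b v)

  cost : ℕ → ℕ → ℕ
  cost a b = cnt (St? a b)

  St-split : ∀ {a b v} c → St a b v → St a c v ⊎ St c b v
  St-split {v = v} c s with In? c v
  St-split c (inj₁ (ia , ¬ib)) | yes i = inj₂ (inj₁ (i , ¬ib))
  St-split c (inj₁ (ia , ¬ib)) | no ¬i = inj₁ (inj₁ (ia , ¬i))
  St-split c (inj₂ (¬ia , ib)) | yes i = inj₁ (inj₂ (¬ia , i))
  St-split c (inj₂ (¬ia , ib)) | no ¬i = inj₂ (inj₂ (¬i , ib))

  St-suc : ∀ {q v} → St q (suc q) v → L v ≡ q ⊎ H v ≡ q
  St-suc (inj₁ ((lt , le) , ¬i)) with ¬In ¬i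
  ... | inj₁ bad = ⊥-elim (<-irrefl refl (<-trans lt bad))
  ... | inj₂ (s≤s le') = inj₂ (≤-antisym le' le)
  St-suc (inj₂ (¬i , (s≤s le , lt))) with ¬In ¬i
  ... | inj₁ ge = inj₁ (≤-antisym le ge)
  ... | inj₂ bad = ⊥-elim (<-irrefl refl (<-trans lt bad))

  cost-suc : ∀ q → cost q (suc q) ≤ 1
  cost-suc q = cnt-single (St? q (suc q)) λ u v su sv → same (St-suc su) (St-suc sv)
    where
    same : ∀ {u v} → L u ≡ q ⊎ H u ≡ q → L v ≡ q ⊎ H v ≡ q → u ≡ v
    same (inj₁ a) (inj₁ b) = L-inj (trans a (sym b))
    same (inj₁ a) (inj₂ b) = ⊥-elim (L≢H (trans a (sym b)))
    same (inj₂ a) (inj₁ b) = ⊥-elim (L≢H (trans b (sym a)))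
    same (inj₂ a) (inj₂ b) = H-inj (trans a (sym b))

  -- `Mid` is the majority vote of the three cuts: as `z ≤ w ≤ b`, an interval containing two of
  -- them contains `w`. Any two intervals chosen by the vote thus share `w`, and the vote is
  -- monotone under inclusion.
  module Median (z w b : ℕ) (z≤w : z ≤ w) (w≤b : w ≤ b) where

    Mid : V → Set
    Mid v = In w v × (In z v ⊎ In b v)

    Mid? : ∀ v → Dec (Mid v)
    Mid? v = In? w v ×-dec (In? z v ⊎-dec In? b v)

    side : V → Bool
    side v = does (Mid? v)

    In-up : ∀ {u v q} → L v < L u → H u < H v → In q u → In q v
    In-up l h (p , r) = <-trans l p , ≤-trans r (<⇒≤ h)

    side-up : ∀ u v → L v < L u → H u < H v → side u ≡ true → side v ≡ true
    side-up u v l h e with does-true (Mid? u) e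
    ... | iw , inj₁ i = does-yes (Mid? v) (In-up l h iw , inj₁ (In-up l h i))
    ... | iw , inj₂ i = does-yes (Mid? v) (In-up l h iw , inj₂ (In-up l h i))

    side-meet : ∀ u v → side u ≡ true → side v ≡ true → ¬ H u < L v
    side-meet u v eu ev lt =
      <-irrefl refl (<-trans lt (<-≤-trans (proj₁ (proj₁ (does-true (Mid? v) ev))) (proj₂ (proj₁ (does-true (Mid? u) eu)))))

    open Orientation side side-up side-meet public

    ¬Cov-Mid : ∀ {q v} → ¬ Cov q v → In q v → Mid v
    ¬Cov-Mid {q} {v} ¬c (l , h) with side v in e
    ... | true = does-true (Mid? v) e
    ... | false = ⊥-elim (¬c (inj₁ (refl , l , h)))

    ¬Cov-¬Mid : ∀ {q v} → ¬ Cov q v → ¬ In q v → ¬ Mid v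
    ¬Cov-¬Mid {q} {v} ¬c ¬i m = ¬c (inj₂ (does-yes (Mid? v) m , ¬In ¬i))

  module _ (t : ℕ) where

    -- `D` is the number of arcs that `peel` may leave on a cut. Half of `K` is `2D + 2`, just
    -- enough for the `(D + 1) + D` chords that a new cut pays for on top of half the old
    -- straddlers.
    D K : ℕ
    D = 2 * t
    K = (suc D + suc D) + (suc D + suc D)

    Split : ℕ → ℕ → Set
    Split a b = Σ ℕ λ r → a < r × r < b × cost a r ≤ K × cost r b ≤ K

    private
      half≤ : ∀ {x} → x ≤ (suc D + suc D) + (suc D + D) → x ≤ K
      half≤ le = ≤-trans le (+-monoʳ-≤ (suc D + suc D) (+-monoʳ-≤ (suc D) (n≤1+n D)))

    module Tight (a b : ℕ) (a+1<b : suc a < b) (ab≡K : cost a b ≡ K) where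
      m : ℕ
      m = suc D + suc D
      a≤b : a ≤ b
      a≤b = <⇒≤ (<-trans (n<1+n a) a+1<b)

      Aw Bw : ℕ → V → Set
      Aw w v = St a b v × St a w v
      Bw w v = St a b v × St w b v
      A? : ∀ w v → Dec (Aw w v)
      A? w v = St? a b v ×-dec St? a w v
      B? : ∀ w v → Dec (Bw w v)
      B? w v = St? a b v ×-dec St? w b v

      -- Chords within [a, b) that span the stretch from `z` to `w`: they cost nothing at the ends
      -- `a` and `b`, but every cut on that stretch pays for them.
      G : ℕ → ℕ → V → Set
      G z w v = a ≤ L v × L v < z × w ≤ H v × H v < b
      G? : ∀ z w v → Dec (G z w v)
      G? z w v = a ≤? L v ×-dec L v <? z ×-dec w ≤? H v ×-dec H v <? b

      St-irrefl : ∀ {q v} → ¬ St q q v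
      St-irrefl (inj₁ (i , ¬i)) = ¬i i
      St-irrefl (inj₂ (¬i , i)) = ¬i i

      A-step : ∀ w → cnt (A? (suc w)) ≤ suc (cnt (A? w))
      A-step w = ≤-trans (cnt-∪ (A? (suc w)) (St? w (suc w)) (A? w) sp) (+-monoˡ-≤ _ (cost-suc w))
        where
        sp : ∀ v → Aw (suc w) v → St w (suc w) v ⊎ Aw w v
        sp v (s , s') with St-split w s'
        ... | inj₁ l = inj₂ (s , l)
        ... | inj₂ r = inj₁ r

      A-a : cnt (A? a) ≡ 0
      A-a = cnt-zero (A? a) λ v → St-irrefl ∘ proj₂

      K≤A-b : K ≤ cnt (A? b)
      K≤A-b = subst (_≤ cnt (A? b)) ab≡K (cnt-mono (St? a b) (A? b) λ v s → s , s)

      -- The balanced cut: half of the `K` straddlers have their end in [a, b) before `w`. Moving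
      -- `w` by one position changes this number by at most one.
      found : Σ ℕ λ w → a ≤ w × w ≤ b × cnt (A? w) ≡ m
      found = intermediate (λ w → cnt (A? w)) m a b a≤b (subst (_≤ m) (sym A-a) z≤n)
                (≤-trans (m≤m+n m m) K≤A-b) A-step
      module AtW (w : ℕ) (a≤w : a ≤ w) (w≤b : w ≤ b) (α≡m : cnt (A? w) ≡ m) where

        a<w : a < w
        a<w = ≤∧≢⇒< a≤w λ e → 0≢1+n (trans (sym A-a) (trans (cong (cnt ∘ A?) e) α≡m))

        w<b : w < b
        w<b = ≤∧≢⇒< w≤b λ e → <-irrefl refl (<-≤-trans (m<m+n m {m} (s≤s z≤n))
                (≤-trans K≤A-b (≤-reflexive (trans (cong (cnt ∘ A?) (sym e)) α≡m))))

        β≤m : cnt (B? w) ≤ m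
        β≤m = +-cancelˡ-≤ m _ _ (subst (λ k → k + cnt (B? w) ≤ m + m) α≡m
                (subst (cnt (A? w) + cnt (B? w) ≤_) ab≡K (cnt-disjoint (A? w) (B? w) (St? a b) (λ _ → proj₁) (λ _ → proj₁) disj)))
          where
          disj : ∀ v → Aw w v → ¬ Bw w v
          disj v (inj₁ (ia , ¬ib) , inj₁ (_ , ¬iw)) (_ , inj₁ (iw , _)) = ¬iw iw
          disj v (inj₁ (ia , ¬ib) , inj₁ (_ , ¬iw)) (_ , inj₂ (_ , ib)) = ¬ib ib
          disj v (inj₁ (ia , ¬ib) , inj₂ (¬ia , _)) _ = ¬ia ia
          disj v (inj₂ (¬ia , ib) , inj₁ (ia , _)) _ = ¬ia ia
          disj v (inj₂ (¬ia , ib) , inj₂ (_ , iw)) (_ , inj₁ (_ , ¬ib)) = ¬ib ib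
          disj v (inj₂ (¬ia , ib) , inj₂ (_ , iw)) (_ , inj₂ (¬iw , _)) = ¬iw iw

        over : ∀ {v z} → z ≤ w → ¬ In a v → ¬ In b v → In w v → L v < z → G z w v
        over z≤w ¬a ¬b (l , h) lz with ¬In ¬a | ¬In ¬b
        ... | inj₂ bad | _ = ⊥-elim (<-irrefl refl (<-≤-trans bad (≤-trans a≤w h)))
        ... | inj₁ _ | inj₁ bad = ⊥-elim (<-irrefl refl (≤-<-trans bad (<-≤-trans l w≤b)))
        ... | inj₁ ge | inj₂ lt = ge , lz , h , lt

        left-w : ∀ v → St a w v → Aw w v ⊎ G w w v
        left-w v s with St? a b v
        ... | yes s' = inj₁ (s' , s)
        left-w v (inj₁ (ia , ¬iw)) | no ¬s with In? b v
        ... | yes ib = ⊥-elim (¬iw (<-≤-trans (proj₁ ia) a≤w , ≤-trans w≤b (proj₂ ib)))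
        ... | no ¬ib = ⊥-elim (¬s (inj₁ (ia , ¬ib)))
        left-w v (inj₂ (¬ia , iw)) | no ¬s = inj₂ (over ≤-refl ¬ia (λ ib → ¬s (inj₂ (¬ia , ib))) iw (proj₁ iw))

        right-w : ∀ v → St w b v → Bw w v ⊎ G w w v
        right-w v s with St? a b v
        ... | yes s' = inj₁ (s' , s)
        right-w v (inj₁ (iw , ¬ib)) | no ¬s = inj₂ (over ≤-refl (λ ia → ¬s (inj₁ (ia , ¬ib))) ¬ib iw (proj₁ iw))
        right-w v (inj₂ (¬iw , ib)) | no ¬s with In? a v
        ... | yes ia = ⊥-elim (¬iw (<-≤-trans (proj₁ ia) a≤w , ≤-trans w≤b (proj₂ ib)))
        ... | no ¬ia = ⊥-elim (¬s (inj₂ (¬ia , ib)))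

        shallow : cnt (G? w w) ≤ D → Split a b
        shallow γ = w , a<w , w<b ,
          half≤ (≤-trans (cnt-∪ (St? a w) (A? w) (G? w w) left-w) (+-mono-≤ (≤-reflexive α≡m) (≤-trans γ (m≤n+m D (suc D))))) ,
          half≤ (≤-trans (cnt-∪ (St? w b) (B? w) (G? w w) right-w) (+-mono-≤ β≤m (≤-trans γ (m≤n+m D (suc D)))))

        G-step : ∀ z → cnt (G? (suc z) w) ≤ suc (cnt (G? z w))
        G-step z = ≤-trans (cnt-∪ (G? (suc z) w) (λ v → L v ≟ z) (G? z w) sp)
                     (+-monoˡ-≤ _ (cnt-single (λ v → L v ≟ z) λ u v e e' → L-inj (trans e (sym e'))))
          where
          sp : ∀ v → G (suc z) w v → L v ≡ z ⊎ G z w v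
          sp v (p , s≤s q , r) with m≤n⇒m<n∨m≡n q
          ... | inj₂ e = inj₁ e
          ... | inj₁ lt = inj₂ (p , lt , r)

        foundz : D < cnt (G? w w) → Σ ℕ λ z → a ≤ z × z ≤ w × cnt (G? z w) ≡ suc D
        foundz γ = intermediate (λ z → cnt (G? z w)) (suc D) a w a≤w
                   (≤-trans (≤-reflexive (cnt-zero (G? a w) λ { v (p , q , _) → <-irrefl refl (≤-<-trans p q) })) z≤n) γ G-step

        -- The chords of `G z w` win the vote, having `z` and `w` in their intervals, so their arcs
        -- contain every cut up to `a` and from `b` on. There are `D + 1` of them, which drives a
        -- cut on at most `D` arcs strictly between `a` and `b`.
        module AtZ (z : ℕ) (a≤z : a ≤ z) (z≤w : z ≤ w) (g≡ : cnt (G? z w) ≡ suc D) where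

          open Median z w b z≤w w≤b

          G-t : ∀ {v} → G z w v → side v ≡ true
          G-t {v} (_ , lt , le , _) = does-yes (Mid? v) ((<-≤-trans lt z≤w , le) , inj₁ (lt , ≤-trans z≤w le))

          -- A chord whose arc misses `q` contains `q` in its interval exactly if it wins the vote.
          -- If it also separates `q` from an end of the interval, it is one of the straddlers
          -- charged to that half at `w`, or it belongs to `G z w`.
          cut : (Σ ℕ λ q → cnt (λ v → yes tt ×-dec Cov? q v) ≤ 2 * t) → Split a b
          cut (q , bd) = q , a<q , q<b ,
            half≤ (≤-trans (cnt-∪ (St? a q) (A? w) (λ v → G? z w v ⊎-dec (yes tt ×-dec Cov? q v)) left)
                           (+-mono-≤ (≤-reflexive α≡m) rest)) ,
            half≤ (≤-trans (cnt-∪ (St? q b) (B? w) (λ v → G? z w v ⊎-dec (yes tt ×-dec Cov? q v)) right)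
                           (+-mono-≤ β≤m rest))
            where
            rest : cnt (λ v → G? z w v ⊎-dec (yes tt ×-dec Cov? q v)) ≤ suc D + D
            rest = ≤-trans (cnt-∪ _ (G? z w) (λ v → yes tt ×-dec Cov? q v) (λ _ → id)) (+-mono-≤ (≤-reflexive g≡) bd)

            tooMany : (∀ v → G z w v → Cov q v) → ⊥
            tooMany f = <-irrefl refl (≤-trans (≤-trans (≤-reflexive (sym g≡))
                          (cnt-mono (G? z w) (λ v → yes tt ×-dec Cov? q v) λ v g → tt , f v g)) bd)

            a<q : a < q
            a<q = ≰⇒> λ le → tooMany λ v g → inj₂ (G-t g , inj₁ (≤-trans le (proj₁ g)))

            q<b : q < b
            q<b = ≰⇒> λ le → tooMany λ v g → inj₂ (G-t g , inj₂ (<-≤-trans (proj₂ (proj₂ (proj₂ g))) le))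

            left : ∀ v → St a q v → Aw w v ⊎ (G z w v ⊎ (⊤ × Cov q v))
            left v s with Cov? q v
            ... | yes c = inj₂ (inj₂ (tt , c))
            left v (inj₂ (¬ia , iq)) | no ¬c with ¬Cov-Mid ¬c iq
            ... | iw , inj₂ ib = inj₁ (inj₂ (¬ia , ib) , inj₂ (¬ia , iw))
            ... | iw , inj₁ iz with In? b v
            ... | yes ib = inj₁ (inj₂ (¬ia , ib) , inj₂ (¬ia , iw))
            ... | no ¬ib = inj₂ (inj₁ (over z≤w ¬ia ¬ib iw (proj₁ iz)))
            left v (inj₁ (ia , ¬iq)) | no ¬c = inj₁ (inj₁ (ia , ¬ib) , inj₁ (ia , ¬iw))
              where
              ¬mid = ¬Cov-¬Mid ¬c ¬iq
              ¬iw : ¬ In w v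
              ¬iw iw = ¬mid (iw , inj₁ (<-≤-trans (proj₁ ia) a≤z , ≤-trans z≤w (proj₂ iw)))
              ¬ib : ¬ In b v
              ¬ib ib = ¬iw (<-≤-trans (proj₁ ia) a≤w , ≤-trans w≤b (proj₂ ib))

            right : ∀ v → St q b v → Bw w v ⊎ (G z w v ⊎ (⊤ × Cov q v))
            right v s with Cov? q v
            ... | yes c = inj₂ (inj₂ (tt , c))
            right v (inj₁ (iq , ¬ib)) | no ¬c with ¬Cov-Mid ¬c iq
            ... | iw , inj₂ ib = ⊥-elim (¬ib ib)
            ... | iw , inj₁ iz with In? a v
            ... | yes ia = inj₁ (inj₁ (ia , ¬ib) , inj₁ (iw , ¬ib))
            ... | no ¬ia = inj₂ (inj₁ (over z≤w ¬ia ¬ib iw (proj₁ iz)))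
            right v (inj₂ (¬iq , ib)) | no ¬c = inj₁ (inj₂ (¬ia , ib) , inj₂ (¬iw , ib))
              where
              ¬iw : ¬ In w v
              ¬iw iw = ¬Cov-¬Mid ¬c ¬iq (iw , inj₂ ib)
              ¬ia : ¬ In a v
              ¬ia ia = ¬iw (<-≤-trans (proj₁ ia) a≤w , ≤-trans w≤b (proj₂ ib))

          deep : Split a b ⊎ CycleOutcome t n Cr
          deep = [ inj₁ ∘ cut , inj₂ ∘ toOutcome ]′ (peel t {λ _ → ⊤} (λ _ → yes tt))

        result : Split a b ⊎ CycleOutcome t n Cr
        result with cnt (G? w w) ≤? D
        ... | yes le = inj₁ (shallow le)
        ... | no gt with foundz (≰⇒> gt)
        ... | z , a≤z , z≤w , g≡ = AtZ.deep z a≤z z≤w g≡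

      tight : Split a b ⊎ CycleOutcome t n Cr
      tight with found
      ... | w , a≤w , w≤b , α≡m = AtW.result w a≤w w≤b α≡m

    split : ∀ a b → suc a < b → cost a b ≤ K → Split a b ⊎ CycleOutcome t n Cr
    split a b a+1<b le with m≤n⇒m<n∨m≡n le
    ... | inj₂ e = Tight.tight a b a+1<b e
    -- Below the limit there is room for one more chord, and moving an end by one position costs no
    -- more than that.
    ... | inj₁ lt = inj₁ (suc a , ≤-refl , a+1<b , ≤-trans (cost-suc a) (s≤s z≤n) ,
      ≤-trans (cnt-∪ (St? (suc a) b) (St? a (suc a)) (St? a b) sp) (≤-trans (+-monoˡ-≤ _ (cost-suc a)) lt))
      where
      St-sym : ∀ {a b v} → St a b v → St b a v
      St-sym (inj₁ (p , q)) = inj₂ (q , p)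
      St-sym (inj₂ (p , q)) = inj₁ (q , p)
      sp : ∀ v → St (suc a) b v → St a (suc a) v ⊎ St a b v
      sp v s with St-split a s
      ... | inj₁ p = inj₁ (St-sym p)
      ... | inj₂ p = inj₂ p

-- Complete binary trees as minors of graphs of large pathwidth

-- The number of nodes of the complete binary tree of height `h`, hence the largest number of tokens
-- in play.
sz : ℕ → ℕ
sz zero = 1
sz (suc h) = suc (sz h + sz h)

record SimpleGraph (n : ℕ) : Set₁ where
  field
    Adj    : Fin n → Fin n → Set
    Adj?   : ∀ u v → Dec (Adj u v)
    symA   : ∀ {u v} → Adj u v → Adj v u
    irrefl : ∀ {u} → ¬ Adj u u

module Bags {n : ℕ} (𝒢 : SimpleGraph n) where
  open SimpleGraph 𝒢 public

  V : Set
  V = Fin n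

  open DecMem (Finₚ._≟_ {n}) using (_∈?_) public

  infix 4 _⊑_
  _⊑_ : List V → List V → Set
  E ⊑ F = ∀ {x} → x ∈ E → x ∈ F

  data Walk (E : List V) : V → V → Set where
    stay : ∀ {x} → x ∈ E → Walk E x x
    step : ∀ {x y z} → x ∈ E → Adj x y → Walk E y z → Walk E x z

  Conn : List V → Set
  Conn E = ∀ {x y} → x ∈ E → y ∈ E → Walk E x y

  Touch : List V → List V → Set
  Touch E F = Σ V λ x → Σ V λ y → x ∈ E × y ∈ F × Adj x y

  Disj : List V → List V → Set
  Disj E F = ∀ {x} → x ∈ E → x ∈ F → ⊥

  Anti : List V → List V → Set
  Anti E F = ∀ {x y} → x ∈ E → y ∈ F → ¬ Adj x y

  walk-mono : ∀ {E F x y} → E ⊑ F → Walk E x y → Walk F x y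
  walk-mono f (stay x) = stay (f x)
  walk-mono f (step x a w) = step (f x) a (walk-mono f w)

  walk-trans : ∀ {E x y z} → Walk E x y → Walk E y z → Walk E x z
  walk-trans (stay _) w' = w'
  walk-trans (step x a w) w' = step x a (walk-trans w w')

  walk-start : ∀ {E x y} → Walk E x y → x ∈ E
  walk-start (stay x) = x
  walk-start (step x _ _) = x

  walk-sym : ∀ {E x y} → Walk E x y → Walk E y x
  walk-sym (stay x) = stay x
  walk-sym (step x a w) = walk-trans (walk-sym w) (step (walk-start w) (symA a) (stay x))

  conn-link : ∀ {E F x y} → Conn E → Conn F → x ∈ E → y ∈ F → Walk (E ++ F) x y → Conn (E ++ F)
  conn-link {E} {F} {x} {y} cE cF xE yF w p q with ∈-++⁻ E p | ∈-++⁻ E q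
  ... | inj₁ p' | inj₁ q' = walk-mono ∈-++⁺ˡ (cE p' q')
  ... | inj₂ p' | inj₂ q' = walk-mono (∈-++⁺ʳ E) (cF p' q')
  ... | inj₁ p' | inj₂ q' =
    walk-trans (walk-mono ∈-++⁺ˡ (cE p' xE)) (walk-trans w (walk-mono (∈-++⁺ʳ E) (cF yF q')))
  ... | inj₂ p' | inj₁ q' =
    walk-trans (walk-mono (∈-++⁺ʳ E) (cF p' yF)) (walk-trans (walk-sym w) (walk-mono ∈-++⁺ˡ (cE xE q')))

  conn-touch : ∀ {E F} → Conn E → Conn F → Touch E F → Conn (E ++ F)
  conn-touch {E} cE cF (x , y , xE , yF , a) =
    conn-link cE cF xE yF (step (∈-++⁺ˡ xE) a (stay (∈-++⁺ʳ E yF)))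

  conn-meet : ∀ {E F x} → Conn E → Conn F → x ∈ E → x ∈ F → Conn (E ++ F)
  conn-meet cE cF xE xF = conn-link cE cF xE xF (stay (∈-++⁺ˡ xE))

  conn-single : ∀ {v} → Conn (v ∷ [])
  conn-single (here refl) (here refl) = stay (here refl)

  ⊑-++ : ∀ {E F G} → E ⊑ G → F ⊑ G → E ++ F ⊑ G
  ⊑-++ {E} f g p = [ f , g ]′ (∈-++⁻ E p)

  disj-++ˡ : ∀ {E F G} → Disj E G → Disj F G → Disj (E ++ F) G
  disj-++ˡ {E} f g p q = [ (λ e → f e q) , (λ e → g e q) ]′ (∈-++⁻ E p)

  touch-sym : ∀ {E F} → Touch E F → Touch F E
  touch-sym (x , y , p , q , a) = y , x , q , p , symA a

  touch-mono : ∀ {E E' F F'} → E ⊑ E' → F ⊑ F' → Touch E F → Touch E' F'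
  touch-mono f g (x , y , p , q , a) = x , y , f p , g q , a

  -- Trees of bags.  The two numbers at a node are the ends of an interval of
  -- cuts; they are meaningless (0, 0) as long as no interval is assigned.
  data Tree : ℕ → Set where
    leaf : ℕ → ℕ → List V → Tree 0
    node : ∀ {h} → ℕ → ℕ → List V → Tree h → Tree h → Tree (suc h)

  bag : ∀ {h} → Tree h → List V
  bag (leaf _ _ E) = E
  bag (node _ _ E _ _) = E

  flat : ∀ {h} → Tree h → List V
  flat (leaf _ _ E) = E
  flat (node _ _ E l r) = E ++ flat l ++ flat r

  -- A minor model only: any two bags may have further edges between them.
  Valid : ∀ {h} → Tree h → Set
  Valid (leaf _ _ E) = (∃ λ x → x ∈ E) × Conn E
  Valid (node _ _ E l r) =
    (∃ λ x → x ∈ E) × Conn E × Touch E (bag l) × Touch E (bag r) ×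
    Disj E (flat l) × Disj E (flat r) × Disj (flat l) (flat r) × Valid l × Valid r

  -- The token algorithm of Cattell, Dinneen and Fellows.  A partial tree
  -- keeps one token per bag; a token with a free slot is either extended to an
  -- untouched neighbour or, when there is none, retired.
  data Partial : ℕ → Set where
    none : ∀ {h} → Partial h
    tip  : V → List V → Partial 0
    fork : ∀ {h} → V → List V → Partial h → Partial h → Partial (suc h)

  tokens : ∀ {h} → Partial h → List V
  tokens none = []
  tokens (tip u _) = u ∷ []
  tokens (fork u _ l r) = u ∷ tokens l ++ tokens r

  pflat : ∀ {h} → Partial h → List V
  pflat none = []
  pflat (tip _ E) = E
  pflat (fork _ E l r) = E ++ pflat l ++ pflat r

  Top : ∀ {h} → List V → Partial h → Set
  Top F none = ⊤
  Top F (tip _ E) = Touch F E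
  Top F (fork _ E _ _) = Touch F E

  PValid : ∀ {h} → Partial h → Set
  PValid none = ⊤
  PValid (tip u E) = u ∈ E × Conn E
  PValid (fork u E l r) = u ∈ E × Conn E × Top E l × Top E r ×
    Disj E (pflat l) × Disj E (pflat r) × Disj (pflat l) (pflat r) × PValid l × PValid r

  tokens-sz : ∀ {h} (T : Partial h) → length (tokens T) ≤ sz h
  tokens-sz {zero} none = z≤n
  tokens-sz {suc h} none = z≤n
  tokens-sz (tip u E) = ≤-refl
  tokens-sz (fork u E l r) =
    s≤s (subst (_≤ _) (sym (Listₚ.length-++ (tokens l))) (+-mono-≤ (tokens-sz l) (tokens-sz r)))

  tokens⊑pflat : ∀ {h} (T : Partial h) → PValid T → tokens T ⊑ pflat T
  tokens⊑pflat (tip u E) (uE , _) (here refl) = uE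
  tokens⊑pflat (fork u E l r) (uE , _) (here refl) = ∈-++⁺ˡ uE
  tokens⊑pflat (fork u E l r) (_ , _ , _ , _ , _ , _ , _ , vl , vr) (there p) with ∈-++⁻ (tokens l) p
  ... | inj₁ q = ∈-++⁺ʳ E (∈-++⁺ˡ (tokens⊑pflat l vl q))
  ... | inj₂ q = ∈-++⁺ʳ E (∈-++⁺ʳ (pflat l) (tokens⊑pflat r vr q))

  -- Moves a subtree into the place of its retired parent; its former leaves thereby gain two free
  -- slots.
  raise : ∀ {h} → Partial h → Partial (suc h)
  raise none = none
  raise (tip u E) = fork u E none none
  raise (fork u E l r) = fork u E (raise l) (raise r)

  tokens-raise : ∀ {h} (T : Partial h) → tokens (raise T) ≡ tokens T
  tokens-raise none = refl
  tokens-raise (tip u E) = refl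
  tokens-raise (fork u E l r) = cong (u ∷_) (cong₂ _++_ (tokens-raise l) (tokens-raise r))

  pflat-raise : ∀ {h} (T : Partial h) → pflat (raise T) ≡ pflat T
  pflat-raise none = refl
  pflat-raise (tip u E) = Listₚ.++-identityʳ E
  pflat-raise (fork u E l r) = cong (E ++_) (cong₂ _++_ (pflat-raise l) (pflat-raise r))

  top-raise : ∀ {h F} (T : Partial h) → Top F T → Top F (raise T)
  top-raise none t = t
  top-raise (tip _ _) t = t
  top-raise (fork _ _ _ _) t = t

  valid-raise : ∀ {h} (T : Partial h) → PValid T → PValid (raise T)
  valid-raise none v = v
  valid-raise (tip u E) (uE , c) = uE , c , tt , tt , (λ _ ()) , (λ _ ()) , (λ ()) , tt , tt
  valid-raise (fork u E l r) (uE , c , tl , tr , dl , dr , dlr , vl , vr) =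
    uE , c , top-raise l tl , top-raise r tr ,
    subst (Disj E) (sym (pflat-raise l)) dl , subst (Disj E) (sym (pflat-raise r)) dr ,
    (λ {x} p q → dlr (subst (x ∈_) (pflat-raise l) p) (subst (x ∈_) (pflat-raise r) q)) ,
    valid-raise l vl , valid-raise r vr

  -- Contracts a retired node into its only child. The old bag stays connected to what lies above,
  -- so no contact is lost, while its token becomes free.
  absorb : ∀ {h} → List V → Partial h → Partial h
  absorb E none = none
  absorb E (tip u F) = tip u (E ++ F)
  absorb E (fork u F l r) = fork u (E ++ F) l r

  tokens-absorb : ∀ {h} E (T : Partial h) → tokens (absorb E T) ≡ tokens T
  tokens-absorb E none = refl
  tokens-absorb E (tip _ _) = refl
  tokens-absorb E (fork _ _ _ _) = refl

  pflat-absorb : ∀ {h} E (T : Partial h) → pflat (absorb E T) ⊑ E ++ pflat T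
  pflat-absorb E none ()
  pflat-absorb E (tip _ _) p = p
  pflat-absorb E (fork _ F l r) p with ∈-++⁻ (E ++ F) p
  ... | inj₂ q = ∈-++⁺ʳ E (∈-++⁺ʳ F q)
  ... | inj₁ q with ∈-++⁻ E q
  ... | inj₁ e = ∈-++⁺ˡ e
  ... | inj₂ f = ∈-++⁺ʳ E (∈-++⁺ˡ f)

  top-absorb : ∀ {h F E} (T : Partial h) → Touch F E → Top F (absorb E T)
  top-absorb none t = tt
  top-absorb (tip _ _) t = touch-mono id ∈-++⁺ˡ t
  top-absorb (fork _ _ _ _) t = touch-mono id ∈-++⁺ˡ t

  top-mono : ∀ {h E F} (T : Partial h) → E ⊑ F → Top E T → Top F T
  top-mono none s t = tt
  top-mono (tip _ _) s t = touch-mono s id t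
  top-mono (fork _ _ _ _) s t = touch-mono s id t

  valid-absorb : ∀ {h E} (T : Partial h) → Conn E → Disj E (pflat T) → Top E T → PValid T → PValid (absorb E T)
  valid-absorb none c d t v = tt
  valid-absorb {E = E} (tip u F) c d t (uF , cF) = ∈-++⁺ʳ E uF , conn-touch c cF t
  valid-absorb {E = E} (fork u F l r) c d t (uF , cF , tl , tr , dl , dr , dlr , vl , vr) =
    ∈-++⁺ʳ E uF , conn-touch c cF t , top-mono l (∈-++⁺ʳ E) tl , top-mono r (∈-++⁺ʳ E) tr ,
    disj-++ˡ (λ p q → d p (∈-++⁺ʳ F (∈-++⁺ˡ q))) dl ,
    disj-++ˡ (λ p q → d p (∈-++⁺ʳ F (∈-++⁺ʳ (pflat l) q))) dr , dlr , vl , vr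

  fresh : ∀ h → V → Partial h
  fresh zero v = tip v (v ∷ [])
  fresh (suc h) v = fork v (v ∷ []) none none

  tokens-fresh : ∀ h v → tokens (fresh h v) ≡ v ∷ []
  tokens-fresh zero v = refl
  tokens-fresh (suc h) v = refl

  pflat-fresh : ∀ h v → pflat (fresh h v) ≡ v ∷ []
  pflat-fresh zero v = refl
  pflat-fresh (suc h) v = refl

  valid-fresh : ∀ h v → PValid (fresh h v)
  valid-fresh zero v = here refl , conn-single
  valid-fresh (suc h) v = here refl , conn-single , tt , tt , (λ _ ()) , (λ _ ()) , (λ ()) , tt , tt

  top-fresh : ∀ {F} h v {u} → u ∈ F → Adj u v → Top F (fresh h v)
  top-fresh zero v uF a = _ , v , uF , here refl , a
  top-fresh (suc h) v uF a = _ , v , uF , here refl , a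

  -- A node with token `u` and a missing child, seen independently of its place in the tree: `plant`
  -- hangs a new vertex there, `retire` gives up the token. Mirror images then come from
  -- `slot-swap`.
  record Slot {h : ℕ} (T : Partial h) : Set where
    field
      u            : V
      u-token      : u ∈ tokens T
      plant        : V → Partial h
      plant-valid  : ∀ {v} → v ∉ pflat T → Adj u v → PValid (plant v)
      plant-top    : ∀ {F v} → Top F T → Top F (plant v)
      plant-tok    : ∀ {x v} → x ∈ tokens (plant v) → x ≡ v ⊎ x ∈ tokens T
      plant-new    : ∀ {v} → v ∈ tokens (plant v)
      plant-keep   : ∀ {x v} → x ∈ tokens T → x ∈ tokens (plant v)
      plant-flat   : ∀ {x v} → x ∈ pflat (plant v) → x ≡ v ⊎ x ∈ pflat T
      retire       : Partial h
      retire-valid : PValid retire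
      retire-top   : ∀ {F} → Top F T → Top F retire
      retire-tok   : ∀ {x} → x ∈ tokens retire → x ∈ tokens T × x ≢ u
      retire-keep  : ∀ {x} → x ∈ tokens T → x ≢ u → x ∈ tokens retire
      retire-flat  : pflat retire ⊑ pflat T

  private
    ∈-mid : ∀ {x : V} A B {C} → x ∈ A ++ B → (x ∈ A → x ∈ C) → (x ∈ B → x ∈ C) → x ∈ C
    ∈-mid A B p f g = [ f , g ]′ (∈-++⁻ A p)

  slot-hereˡ : ∀ {h u E} {r : Partial h} → PValid (fork u E none r) → Slot (fork u E none r)
  slot-hereˡ {h} {u} {E} {r} (uE , c , _ , tr , _ , dr , _ , _ , vr) = record
    { u = u ; u-token = here refl
    ; plant = λ v → fork u E (fresh h v) r
    ; plant-valid = λ {v} v∉ a → uE , c , top-fresh h v uE a , tr ,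
        (λ {x} p q → v∉ (∈-++⁺ˡ (subst (_∈ E) (fr q) p))) , dr ,
        (λ {x} p q → v∉ (∈-++⁺ʳ E (subst (_∈ pflat r) (fr p) q))) , valid-fresh h v , vr
    ; plant-top = id
    ; plant-tok = tk
    ; plant-new = λ {v} → there (∈-++⁺ˡ (subst (v ∈_) (sym (tokens-fresh h v)) (here refl)))
    ; plant-keep = λ { (here e) → here e ; {v = v} (there p) → there (∈-++⁺ʳ (tokens (fresh h v)) p) }
    ; plant-flat = fl
    ; retire = absorb E (raise r)
    ; retire-valid = valid-absorb (raise r) c (subst (Disj E) (sym (pflat-raise r)) dr) (top-raise r tr) (valid-raise r vr)
    ; retire-top = top-absorb (raise r)
    ; retire-tok = λ {x} p → let q = subst (x ∈_) (trans (tokens-absorb E (raise r)) (tokens-raise r)) p in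
        there q , λ { refl → dr uE (tokens⊑pflat r vr q) }
    ; retire-keep = λ { (here e) ne → ⊥-elim (ne e)
                      ; {x} (there p) ne → subst (x ∈_) (sym (trans (tokens-absorb E (raise r)) (tokens-raise r))) p }
    ; retire-flat = λ {x} p → subst (λ l → x ∈ E ++ l) (pflat-raise r) (pflat-absorb E (raise r) p)
    }
    where
    fr : ∀ {x v} → x ∈ pflat (fresh h v) → x ≡ v
    fr {x} {v} p with subst (x ∈_) (pflat-fresh h v) p
    ... | here e = e
    tk : ∀ {x v} → x ∈ tokens (fork u E (fresh h v) r) → x ≡ v ⊎ x ∈ tokens (fork u E none r)
    tk (here e) = inj₂ (here e)
    tk {x} {v} (there p) with ∈-++⁻ (tokens (fresh h v)) p
    ... | inj₂ q = inj₂ (there q)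
    ... | inj₁ q with subst (x ∈_) (tokens-fresh h v) q
    ... | here e = inj₁ e
    fl : ∀ {x v} → x ∈ pflat (fork u E (fresh h v) r) → x ≡ v ⊎ x ∈ pflat (fork u E none r)
    fl {x} {v} p with ∈-++⁻ E p
    ... | inj₁ q = inj₂ (∈-++⁺ˡ q)
    ... | inj₂ q with ∈-++⁻ (pflat (fresh h v)) q
    ... | inj₁ f = inj₁ (fr f)
    ... | inj₂ s = inj₂ (∈-++⁺ʳ E s)

  swapP : ∀ {h} → Partial (suc h) → Partial (suc h)
  swapP none = none
  swapP (fork u E l r) = fork u E r l

  swap-tokens : ∀ {h} (T : Partial (suc h)) → tokens T ⊑ tokens (swapP T)
  swap-tokens (fork u E l r) (here e) = here e
  swap-tokens (fork u E l r) (there p) = there (∈-mid (tokens l) (tokens r) p (∈-++⁺ʳ (tokens r)) ∈-++⁺ˡ)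

  swap-tokens⁻ : ∀ {h} (T : Partial (suc h)) → tokens (swapP T) ⊑ tokens T
  swap-tokens⁻ (fork u E l r) = swap-tokens (fork u E r l)

  swap-flat : ∀ {h} (T : Partial (suc h)) → pflat T ⊑ pflat (swapP T)
  swap-flat (fork u E l r) p =
    ∈-mid E (pflat l ++ pflat r) p ∈-++⁺ˡ λ q → ∈-++⁺ʳ E (∈-mid (pflat l) (pflat r) q (∈-++⁺ʳ (pflat r)) ∈-++⁺ˡ)

  swap-flat⁻ : ∀ {h} (T : Partial (suc h)) → pflat (swapP T) ⊑ pflat T
  swap-flat⁻ (fork u E l r) = swap-flat (fork u E r l)

  swap-valid : ∀ {h} (T : Partial (suc h)) → PValid T → PValid (swapP T)
  swap-valid none v = tt
  swap-valid (fork u E l r) (uE , c , tl , tr , dl , dr , dlr , vl , vr) =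
    uE , c , tr , tl , dr , dl , (λ p q → dlr q p) , vr , vl

  swap-top : ∀ {h F} (T : Partial (suc h)) → Top F T → Top F (swapP T)
  swap-top none t = tt
  swap-top (fork u E l r) t = t

  slot-swap : ∀ {h} {T : Partial (suc h)} → Slot T → Slot (swapP T)
  slot-swap {T = T} s = record
    { u = u ; u-token = swap-tokens T u-token
    ; plant = swapP ∘ plant
    ; plant-valid = λ {v} v∉ a → swap-valid (plant v) (plant-valid (v∉ ∘ swap-flat T) a)
    ; plant-top = λ {F} {v} t → swap-top (plant v) (plant-top (unswap T t))
    ; plant-tok = λ {x} {v} p → [ inj₁ , inj₂ ∘ swap-tokens T ]′ (plant-tok (swap-tokens⁻ (plant v) p))
    ; plant-new = λ {v} → swap-tokens (plant v) plant-new
    ; plant-keep = λ {x} {v} p → swap-tokens (plant v) (plant-keep (swap-tokens⁻ T p))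
    ; plant-flat = λ {x} {v} p → [ inj₁ , inj₂ ∘ swap-flat T ]′ (plant-flat (swap-flat⁻ (plant v) p))
    ; retire = swapP retire
    ; retire-valid = swap-valid retire retire-valid
    ; retire-top = λ t → swap-top retire (retire-top (unswap T t))
    ; retire-tok = λ p → let (q , ne) = retire-tok (swap-tokens⁻ retire p) in swap-tokens T q , ne
    ; retire-keep = λ p ne → swap-tokens retire (retire-keep (swap-tokens⁻ T p) ne)
    ; retire-flat = λ p → swap-flat T (retire-flat (swap-flat⁻ retire p))
    }
    where
    open Slot s
    unswap : ∀ {F} T → Top F (swapP T) → Top F T
    unswap none t = t
    unswap (fork _ _ _ _) t = t

  slot-left : ∀ {h u E} {l r : Partial h} → PValid (fork u E l r) → Slot l → Slot (fork u E l r)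
  slot-left {h} {u} {E} {l} {r} (uE , c , tl , tr , dl , dr , dlr , vl , vr) s = record
    { u = S.u ; u-token = there (∈-++⁺ˡ S.u-token)
    ; plant = λ v → fork u E (S.plant v) r
    ; plant-valid = λ {v} v∉ a → uE , c , S.plant-top tl , tr ,
        (λ p q → [ (λ { refl → v∉ (∈-++⁺ˡ p) }) , dl p ]′ (S.plant-flat q)) , dr ,
        (λ p q → [ (λ { refl → v∉ (∈-++⁺ʳ E (∈-++⁺ʳ (pflat l) q)) }) , (λ p' → dlr p' q) ]′ (S.plant-flat p)) ,
        S.plant-valid (v∉ ∘ ∈-++⁺ʳ E ∘ ∈-++⁺ˡ) a , vr
    ; plant-top = id
    ; plant-tok = λ { (here e) → inj₂ (here e)
                    ; {v = v} (there p) → [ (λ q → [ inj₁ , inj₂ ∘ there ∘ ∈-++⁺ˡ ]′ (S.plant-tok q)) ,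
                                    inj₂ ∘ there ∘ ∈-++⁺ʳ (tokens l) ]′ (∈-++⁻ (tokens (S.plant v)) p) }
    ; plant-new = there (∈-++⁺ˡ S.plant-new)
    ; plant-keep = λ { (here e) → here e
                     ; {v = v} (there p) → there (∈-mid (tokens l) (tokens r) p (∈-++⁺ˡ ∘ S.plant-keep) (∈-++⁺ʳ
                         (tokens (S.plant v)))) }
    ; plant-flat = λ {x} {v} p → [ inj₂ ∘ ∈-++⁺ˡ , (λ q → [ (λ q' → [ inj₁ , inj₂ ∘ ∈-++⁺ʳ E ∘ ∈-++⁺ˡ ]′ (S.plant-flat q')) ,
                        inj₂ ∘ ∈-++⁺ʳ E ∘ ∈-++⁺ʳ (pflat l) ]′ (∈-++⁻ (pflat (S.plant v)) q)) ]′ (∈-++⁻ E p)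
    ; retire = fork u E S.retire r
    ; retire-valid = uE , c , S.retire-top tl , tr , (λ p q → dl p (S.retire-flat q)) , dr ,
        (λ p q → dlr (S.retire-flat p) q) , S.retire-valid , vr
    ; retire-top = id
    ; retire-tok = rt
    ; retire-keep = λ { (here e) ne → here e
                      ; (there p) ne → there (∈-mid (tokens l) (tokens r) p (λ q → ∈-++⁺ˡ (S.retire-keep q ne))
                          (∈-++⁺ʳ (tokens S.retire))) }
    ; retire-flat = λ p → ∈-mid E _ p ∈-++⁺ˡ λ q → ∈-++⁺ʳ E (∈-mid (pflat S.retire) (pflat r) q (∈-++⁺ˡ ∘
        S.retire-flat) (∈-++⁺ʳ (pflat l)))
    }
    where
    module S = Slot s
    rt : ∀ {x} → x ∈ tokens (fork u E S.retire r) → x ∈ tokens (fork u E l r) × x ≢ S.u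
    rt (here refl) = here refl , λ e → dl uE (subst (_∈ pflat l) (sym e) (tokens⊑pflat l vl S.u-token))
    rt (there p) with ∈-++⁻ (tokens S.retire) p
    ... | inj₁ q = there (∈-++⁺ˡ (proj₁ (S.retire-tok q))) , proj₂ (S.retire-tok q)
    ... | inj₂ q = there (∈-++⁺ʳ (tokens l) q) ,
                   λ e → dlr (tokens⊑pflat l vl S.u-token) (subst (_∈ pflat r) e (tokens⊑pflat r vr q))

  Full : ∀ {h} → Partial h → Set
  Full none = ⊥
  Full (tip _ _) = ⊤
  Full (fork _ _ l r) = Full l × Full r

  toTree : ∀ {h} (T : Partial h) → Full T → Tree h
  toTree (tip _ E) _ = leaf 0 0 E
  toTree (fork _ E l r) (fl , fr) = node 0 0 E (toTree l fl) (toTree r fr)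

  flat-toTree : ∀ {h} (T : Partial h) (f : Full T) → flat (toTree T f) ≡ pflat T
  flat-toTree (tip _ E) f = refl
  flat-toTree (fork _ E l r) (fl , fr) = cong (E ++_) (cong₂ _++_ (flat-toTree l fl) (flat-toTree r fr))

  top-toTree : ∀ {h F} (T : Partial h) (f : Full T) → Top F T → Touch F (bag (toTree T f))
  top-toTree (tip _ _) f t = t
  top-toTree (fork _ _ _ _) f t = t

  valid-toTree : ∀ {h} (T : Partial h) (f : Full T) → PValid T → Valid (toTree T f)
  valid-toTree (tip u E) f (uE , c) = (u , uE) , c
  valid-toTree (fork u E l r) (fl , fr) (uE , c , tl , tr , dl , dr , dlr , vl , vr) =
    (u , uE) , c , top-toTree l fl tl , top-toTree r fr tr ,
    subst (Disj E) (sym (flat-toTree l fl)) dl , subst (Disj E) (sym (flat-toTree r fr)) dr ,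
    (λ {x} p q → dlr (subst (x ∈_) (flat-toTree l fl) p) (subst (x ∈_) (flat-toTree r fr) q)) ,
    valid-toTree l fl vl , valid-toTree r fr vr

  data Progress {h} : Partial h → Set where
    empty : Progress none
    full  : ∀ {T} → Full T → Progress T
    slot  : ∀ {T} → Slot T → Progress T

  progress : ∀ {h} (T : Partial h) → PValid T → Progress T
  progress none v = empty
  progress (tip u E) v = full tt
  progress (fork u E l r) v@(_ , _ , _ , _ , _ , _ , _ , vl , vr) with progress l vl
  ... | empty = slot (slot-hereˡ v)
  ... | slot s = slot (slot-left v s)
  ... | full fl with progress r vr
  ... | empty = slot (slot-swap (slot-hereˡ (swap-valid (fork u E l none) v)))
  ... | slot s = slot (slot-swap (slot-left (swap-valid (fork u E l r) v) s))
  ... | full fr = full (fl , fr)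

  -- A path decomposition in interval form: `v` is present from time `inn v` to `out v`. Applied in
  -- both orders, `meets` makes the intervals of neighbours intersect. `now` puts the current tokens
  -- in the first bag, so that an earlier bag can be placed in front.
  record Layout (N T : V → Set) (k : ℕ) : Set₁ where
    field
      inn out : V → ℕ
      inn≤out : ∀ v → inn v ≤ out v
      now     : ∀ v → T v → inn v ≡ 0
      meets   : ∀ u v → N u → N v → Adj u v → inn u ≤ out v
      small   : ∀ i {P : V → Set} (P? : ∀ v → Dec (P v)) → (∀ v → P v → N v × inn v ≤ i × i ≤ out v) → cnt P? ≤ k

  module _ (h : ℕ) where

    Live : (V → Set) → Partial h → V → Set
    Live B T v = B v ⊎ v ∈ tokens T

    -- Planting moves a vertex from `B` to the tokens and retiring removes a token, so twice the
    -- size of `B` plus the number of tokens decreases. Only retiring creates a bag of the layout,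
    -- namely the current tokens: `u` may leave after it, having no neighbour left in `B`.
    run : ∀ f {B : V → Set} (B? : ∀ v → Dec (B v)) (T : Partial h) → PValid T → (∀ v → B v → v ∉ pflat T) →
          (cnt B? + cnt B?) + cnt (λ v → v ∈? tokens T) < f →
          Σ (Tree h) Valid ⊎ Layout (Live B T) (λ v → v ∈ tokens T) (sz h)
    run (suc f) {B} B? T valid sep (s≤s bd) with progress T valid
    ... | full F = inj₁ (toTree T F , valid-toTree T F valid)
    ... | empty with Finₚ.any? B?
    ... | no ¬b = inj₂ (record { inn = λ _ → 0 ; out = λ _ → 0 ; inn≤out = λ _ → z≤n ; now = λ _ _ → refl ;
          meets = λ _ _ _ _ _ → z≤n
                   ; small = λ i P? P⇒ → ≤-trans (≤-reflexive (cnt-zero P? λ v p → dead v (proj₁ (P⇒ v p)))) z≤n })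
      where
      dead : ∀ v → Live B none v → ⊥
      dead v (inj₁ b) = ¬b (v , b)
    ... | yes (v , b) with run f {λ x → B x × x ≢ v} (λ x → B? x ×-dec ¬? (x Finₚ.≟ v)) (fresh h v) (valid-fresh h v)
                       (λ x (_ , ne) p → ne (∈1 (subst (x ∈_) (pflat-fresh h v) p)))
                       (≤-trans (s≤s (+-mono-≤ ≤-refl one≤)) (≤-trans (dec≤ (cnt-strict (λ x → B? x ×-dec ¬? (x
                           Finₚ.≟ v)) B? (λ _ → proj₁) v b (λ (_ , ne) → ne refl))) (≤-trans (m≤m+n _ _) bd)))
      where
      ∈1 : ∀ {x y : V} → x ∈ y ∷ [] → x ≡ y
      ∈1 (here e) = e
      one≤ : cnt (λ x → x ∈? tokens (fresh h v)) ≤ 1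
      one≤ = subst (λ l → cnt (λ x → x ∈? l) ≤ 1) (sym (tokens-fresh h v)) (cnt-length (v ∷ []) (λ x → x ∈? (v ∷ [])) λ _ → id)
      dec≤ : ∀ {a b} → suc a ≤ b → suc (a + a + 1) ≤ b + b
      dec≤ {a} {b} lt = ≤-trans (≤-reflexive (trans (cong suc (+-comm (a + a) 1)) (cong suc (sym (+-suc a a))))) (+-mono-≤ lt lt)
    ... | inj₁ r = inj₁ r
    ... | inj₂ 𝓛 = inj₂ (record
      { inn = inn ; out = out ; inn≤out = inn≤out
      ; now = λ _ ()
      ; meets = λ x y lx ly → meets x y (live x lx) (live y ly)
      ; small = λ i P? P⇒ → small i P? λ x p → let (l , q) = P⇒ x p in live x l , q })
      where
      open Layout 𝓛
      live : ∀ x → Live B none x → Live (λ x → B x × x ≢ v) (fresh h v) x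
      live x (inj₁ b) with x Finₚ.≟ v
      ... | yes refl = inj₂ (subst (x ∈_) (sym (tokens-fresh h v)) (here refl))
      ... | no ne = inj₁ (b , ne)
    run (suc f) {B} B? T valid sep (s≤s bd) | slot s with Finₚ.any? (λ v → B? v ×-dec Adj? (Slot.u s) v)
    ... | yes (v , b , a) with run f {λ x → B x × x ≢ v} (λ x → B? x ×-dec ¬? (x Finₚ.≟ v)) (Slot.plant s v)
                       (Slot.plant-valid s (sep v b) a)
                       (λ x (bx , ne) p → [ ne , sep x bx ]′ (Slot.plant-flat s p))
                       (≤-trans (s≤s (+-mono-≤ ≤-refl (≤-trans (cnt-remove (λ x → x ∈? tokens (Slot.plant s v)) v)
                            (s≤s (cnt-mono _ (λ x → x ∈? tokens T) λ x (p , ne) → [ (λ e → ⊥-elim (ne e)) , id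
                                ]′ (Slot.plant-tok s p))))))
                         (≤-trans (dec≤ _ (cnt-strict (λ x → B? x ×-dec ¬? (x Finₚ.≟ v)) B? (λ _ → proj₁) v b
                             (λ (_ , ne) → ne refl))) bd))
      where
      dec≤ : ∀ {a b} c → suc a ≤ b → suc (a + a + suc c) ≤ b + b + c
      dec≤ {a} {b} c lt = ≤-trans (≤-reflexive (trans (cong suc (+-suc (a + a) c)) (cong (λ z → suc z + c) (sym
          (+-suc a a))))) (+-monoˡ-≤ c (+-mono-≤ lt lt))
    ... | inj₁ r = inj₁ r
    ... | inj₂ 𝓛 = inj₂ (record
      { inn = inn ; out = out ; inn≤out = inn≤out
      ; now = λ x p → now x (plant-keep p)
      ; meets = λ x y lx ly → meets x y (live x lx) (live y ly)
      ; small = λ i P? P⇒ → small i P? λ x p → let (l , q) = P⇒ x p in live x l , q })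
      where
      open Layout 𝓛
      open Slot s
      live : ∀ x → Live B T x → Live (λ x → B x × x ≢ v) (plant v) x
      live x (inj₂ p) = inj₂ (plant-keep p)
      live x (inj₁ b) with x Finₚ.≟ v
      ... | yes refl = inj₂ plant-new
      ... | no ne = inj₁ (b , ne)
    run (suc f) {B} B? T valid sep (s≤s bd) | slot s | no ¬nb
      with run f B? (Slot.retire s) (Slot.retire-valid s) (λ v b p → sep v b (Slot.retire-flat s p))
             (≤-trans (≤-reflexive (sym (+-suc _ _))) (≤-trans (+-monoʳ-≤ (cnt B? + cnt B?)
               (cnt-strict (λ v → v ∈? tokens (Slot.retire s)) (λ v → v ∈? tokens T) (λ v p → proj₁ (Slot.retire-tok s p))
                  (Slot.u s) (Slot.u-token s) λ p → proj₂ (Slot.retire-tok s p) refl)) bd))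
    ... | inj₁ r = inj₁ r
    ... | inj₂ 𝓛 = inj₂ (record
      { inn = inn' ; out = out' ; inn≤out = le' ; now = now' ; meets = meets' ; small = small' })
      where
      open Layout 𝓛
      open Slot s
      -- The layout of the rest is delayed by one. At time 0 exactly the tokens are present, and `u`
      -- is present only then.
      inn' out' : V → ℕ
      inn' v with v ∈? tokens T
      ... | yes _ = 0
      ... | no _ = suc (inn v)
      out' v with v Finₚ.≟ u
      ... | yes _ = 0
      ... | no _ = suc (out v)
      now' : ∀ v → v ∈ tokens T → inn' v ≡ 0
      now' v p with v ∈? tokens T
      ... | yes _ = refl
      ... | no ¬p = ⊥-elim (¬p p)
      inn'≤ : ∀ v → inn' v ≤ suc (inn v)
      inn'≤ v with v ∈? tokens T
      ... | yes _ = z≤n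
      ... | no _ = ≤-refl
      live : ∀ x → Live B T x → x ≢ u → Live B retire x
      live x (inj₁ b) ne = inj₁ b
      live x (inj₂ p) ne = inj₂ (retire-keep p ne)
      le' : ∀ v → inn' v ≤ out' v
      le' v with v Finₚ.≟ u
      ... | yes refl = ≤-reflexive (now' v u-token)
      ... | no _ = ≤-trans (inn'≤ v) (s≤s (inn≤out v))
      meets' : ∀ x y → Live B T x → Live B T y → Adj x y → inn' x ≤ out' y
      meets' x y lx ly a with y Finₚ.≟ u
      meets' x y (inj₁ b) ly a | yes refl = ⊥-elim (¬nb (x , b , symA a))
      meets' x y (inj₂ p) ly a | yes refl = ≤-reflexive (now' x p)
      ... | no ne with x Finₚ.≟ u
      ... | yes refl = ≤-trans (≤-reflexive (now' x u-token)) z≤n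
      ... | no ne' = ≤-trans (inn'≤ x) (s≤s (meets x y (live x lx ne') (live y ly ne) a))
      small' : ∀ i {P : V → Set} (P? : ∀ v → Dec (P v)) → (∀ v → P v → Live B T v × inn' v ≤ i × i ≤ out' v) → cnt P? ≤ sz h
      small' zero P? P⇒ = ≤-trans (cnt-length (tokens T) P? λ v p → tok v (proj₁ (proj₂ (P⇒ v p)))) (tokens-sz T)
        where
        tok : ∀ v → inn' v ≤ 0 → v ∈ tokens T
        tok v le with v ∈? tokens T
        ... | yes p = p
        tok v () | no _
      small' (suc i) P? P⇒ = small i P? λ v p → let (l , le , ge) = P⇒ v p in
          live v l (ne v ge) , lo v (ne v ge) le , hi v ge
        where
        ne : ∀ v → suc i ≤ out' v → v ≢ u
        ne v ge with v Finₚ.≟ u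
        ne v () | yes _
        ... | no ne = ne
        hi : ∀ v → suc i ≤ out' v → i ≤ out v
        hi v ge with v Finₚ.≟ u
        hi v () | yes _
        hi v (s≤s ge) | no _ = ge
        lo : ∀ v → v ≢ u → inn' v ≤ suc i → inn v ≤ i
        lo v ne le with v ∈? tokens T
        ... | yes p = ≤-trans (≤-reflexive (now v (retire-keep p ne))) z≤n
        lo v ne (s≤s le) | no _ = le

    minor-or-layout : Σ (Tree h) Valid ⊎ Layout (λ _ → ⊤) (λ _ → ⊥) (sz h)
    minor-or-layout with run _ {λ _ → ⊤} (λ _ → yes tt) none tt (λ _ _ ()) ≤-refl
    ... | inj₁ T = inj₁ T
    ... | inj₂ 𝓛 = inj₂ (record { inn = inn ; out = out ; inn≤out = inn≤out ; now = λ _ () ; meets = λ u v _ _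
          → meets u v (inj₁ tt) (inj₁ tt)
                  ; small = λ i P? P⇒ → small i P? λ v p → inj₁ tt , proj₂ (P⇒ v p) })
      where open Layout 𝓛

    minor : PathwidthAtLeast n Adj (sz h) → Σ (Tree h) Valid
    minor pw with minor-or-layout
    ... | inj₁ T = T
    ... | inj₂ 𝓛 = ⊥-elim (<-irrefl refl (≤-trans (proj₂ (pw pd)) (≤-trans (≤-reflexive (cnt-tabulate (At? (toℕ
          (proj₁ (pw pd))))))
                     (small (toℕ (proj₁ (pw pd))) (At? _) λ v p → tt , p))))
      where
      open Layout 𝓛
      At : ℕ → V → Set
      At i v = inn v ≤ i × i ≤ out v
      At? : ∀ i v → Dec (At i v)
      At? i v = inn v ≤? i ×-dec i ≤? out v
      B : Fin (suc (maxi out)) → Subset n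
      B i = Vec.tabulate (λ v → does (At? (toℕ i) v))
      ∈⁺ : ∀ {i v} → At (toℕ i) v → v ∈ˢ B i
      ∈⁺ {i} {v} p = Vecₚ.lookup⇒[]= v (B i) (trans (Vecₚ.lookup∘tabulate _ v) (does-yes (At? (toℕ i) v) p))
      ∈⁻ : ∀ {i v} → v ∈ˢ B i → At (toℕ i) v
      ∈⁻ {i} {v} p = does-true (At? (toℕ i) v) (trans (sym (Vecₚ.lookup∘tabulate _ v)) (Vecₚ.[]=⇒lookup p))
      idx : ∀ j v → j ≤ out v → Fin (suc (maxi out))
      idx j v le = fromℕ< (s≤s (≤-trans le (≤maxi out v)))
      idx≡ : ∀ j v le → toℕ (idx j v le) ≡ j
      idx≡ j v le = Finₚ.toℕ-fromℕ< _
      in-idx : ∀ j v le u → At j u → u ∈ˢ B (idx j v le)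
      in-idx j v le u p = ∈⁺ {idx j v le} (subst (λ i → At i u) (sym (idx≡ j v le)) p)
      pd : PathDecomposition n Adj
      pd = record
        { m = suc (maxi out) ; bag = B
        ; cover = λ v → idx (inn v) v (inn≤out v) , in-idx _ v (inn≤out v) v (≤-refl , inn≤out v)
        ; edge = ed
        ; interp = λ v i j k i≤j j≤k p q → ∈⁺ {j} (≤-trans (proj₁ (∈⁻ {i} p)) i≤j , ≤-trans j≤k (proj₂ (∈⁻ {k} q))) }
        where
        ed : ∀ u v → Adj u v → ∃ λ i → u ∈ˢ B i × v ∈ˢ B i
        ed u v a with ≤-total (inn u) (inn v)
        ... | inj₁ le = idx (inn v) v (inn≤out v) ,
                        in-idx _ v (inn≤out v) u (le , meets v u tt tt (symA a)) , in-idx _ v (inn≤out v) v (≤-refl , inn≤out v)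
        ... | inj₂ le = idx (inn u) u (inn≤out u) ,
                        in-idx _ u (inn≤out u) u (≤-refl , inn≤out u) , in-idx _ u (inn≤out u) v (le , meets u v tt tt a)

-- Nested intervals

module Subtrees {n : ℕ} (𝒢 : SimpleGraph n) where
  open Bags 𝒢

  data Sub {m} (s : Tree m) : ∀ {h} → Tree h → Set where
    hereS  : Sub s s
    leftS  : ∀ {h a b E} {l r : Tree h} → Sub s l → Sub s (node a b E l r)
    rightS : ∀ {h a b E} {l r : Tree h} → Sub s r → Sub s (node a b E l r)

  sub-trans : ∀ {k m h} {s : Tree k} {T : Tree m} {T' : Tree h} → Sub s T → Sub T T' → Sub s T'
  sub-trans s hereS = s
  sub-trans s (leftS p) = leftS (sub-trans s p)
  sub-trans s (rightS p) = rightS (sub-trans s p)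

  bag⊑flat : ∀ {h} (T : Tree h) → bag T ⊑ flat T
  bag⊑flat (leaf _ _ E) p = p
  bag⊑flat (node _ _ E l r) p = ∈-++⁺ˡ p

  flatˡ : ∀ {h a b E} {l r : Tree h} → flat l ⊑ flat (node a b E l r)
  flatˡ {E = E} p = ∈-++⁺ʳ E (∈-++⁺ˡ p)

  flatʳ : ∀ {h a b E} {l r : Tree h} → flat r ⊑ flat (node a b E l r)
  flatʳ {E = E} {l} p = ∈-++⁺ʳ E (∈-++⁺ʳ (flat l) p)

  ∈-node : ∀ {h a b E x} {l r : Tree h} → x ∈ flat (node a b E l r) → x ∈ E ⊎ x ∈ flat l ⊎ x ∈ flat r
  ∈-node {E = E} {l = l} p with ∈-++⁻ E p
  ... | inj₁ q = inj₁ q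
  ... | inj₂ q = inj₂ (∈-++⁻ (flat l) q)

  sub-flat : ∀ {m h} {s : Tree m} {T : Tree h} → Sub s T → flat s ⊑ flat T
  sub-flat hereS p = p
  sub-flat (leftS {a = a} {b} {E} {l} {r} s) p = flatˡ {a = a} {b} {E} {l} {r} (sub-flat s p)
  sub-flat (rightS {a = a} {b} {E} {l} {r} s) p = flatʳ {a = a} {b} {E} {l} {r} (sub-flat s p)

  validˡ : ∀ {h a b E} {l r : Tree h} → Valid (node a b E l r) → Valid l
  validˡ (_ , _ , _ , _ , _ , _ , _ , v , _) = v

  validʳ : ∀ {h a b E} {l r : Tree h} → Valid (node a b E l r) → Valid r
  validʳ (_ , _ , _ , _ , _ , _ , _ , _ , v) = v

  sub-valid : ∀ {m h} {s : Tree m} {T : Tree h} → Sub s T → Valid T → Valid s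
  sub-valid hereS v = v
  sub-valid (leftS {a = a} {b} {E} {l} {r} s) v = sub-valid s (validˡ {a = a} {b} {E} {l} {r} v)
  sub-valid (rightS {a = a} {b} {E} {l} {r} s) v = sub-valid s (validʳ {a = a} {b} {E} {l} {r} v)

  inhabited : ∀ {h} (T : Tree h) → Valid T → ∃ λ x → x ∈ flat T
  inhabited (leaf _ _ E) (i , _) = i
  inhabited (node _ _ E l r) ((x , p) , _) = x , ∈-++⁺ˡ p

  conn-≋ : ∀ {E F} → E ⊑ F → F ⊑ E → Conn E → Conn F
  conn-≋ f g c p q = walk-mono f (c (g p) (g q))

  conn-flat : ∀ {h} (T : Tree h) → Valid T → Conn (flat T)
  conn-flat (leaf _ _ E) (_ , c) = c
  conn-flat (node _ _ E l r) ((x , xE) , c , tl , tr , _ , _ , _ , vl , vr) =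
    conn-≋ (⊑-++ {E ++ flat l} (⊑-++ {E} ∈-++⁺ˡ (∈-++⁺ʳ E ∘ ∈-++⁺ˡ)) (⊑-++ {E} ∈-++⁺ˡ (∈-++⁺ʳ E ∘ ∈-++⁺ʳ (flat l))))
           (⊑-++ {E} (∈-++⁺ˡ ∘ ∈-++⁺ˡ) (⊑-++ {flat l} (∈-++⁺ˡ ∘ ∈-++⁺ʳ E) (∈-++⁺ʳ (E ++ flat l) ∘ ∈-++⁺ʳ E)))
           (conn-meet (conn-touch c (conn-flat l vl) (touch-mono id (bag⊑flat l) tl))
                      (conn-touch c (conn-flat r vr) (touch-mono id (bag⊑flat r) tr)) (∈-++⁺ˡ xE) (∈-++⁺ˡ xE))

  -- When the levels between `e` and `s` are given up, their bags on the way are merged with `e`, so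
  -- that `e` becomes a neighbour of `s`.
  record Route (e : List V) {m h} (s : Tree m) (T : Tree h) : Set where
    field
      E     : List V
      from  : e ⊑ E
      range : E ⊑ e ++ flat T
      conn  : Conn E
      to    : Touch E (bag s)
      off   : Disj E (flat s)

  route : ∀ {m h} {s : Tree m} {T : Tree h} {e} → Conn e → Disj e (flat T) → Touch e (bag T) → Valid T → Sub s T → Route e s T
  route {e = e} c d t v hereS = record { E = e ; from = id ; range = ∈-++⁺ˡ ; conn = c ; to = t ; off = d }
  route {e = e} c d t v@(_ , cE , tl , _ , dl , _ , _ , vl , _) (leftS {a = a} {b} {E'} {l} {r} s) = record
    { E = e ++ R.E ; from = ∈-++⁺ˡ
    ; range = ⊑-++ {e} ∈-++⁺ˡ λ p → ∈-++⁺ʳ e (⊑-++ {E'} ∈-++⁺ˡ (flatˡ {a = a} {b} {E'} {l} {r}) (R.range p))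
    ; conn = conn-touch c R.conn (touch-mono id R.from t)
    ; to = touch-mono (∈-++⁺ʳ e) id R.to
    ; off = disj-++ˡ (λ p q → d p (flatˡ {a = a} {b} {E'} {l} {r} (sub-flat s q))) R.off }
    where module R = Route (route cE dl tl vl s)
  route {e = e} c d t v@(_ , cE , _ , tr , _ , dr , _ , _ , vr) (rightS {a = a} {b} {E'} {l} {r} s) = record
    { E = e ++ R.E ; from = ∈-++⁺ˡ
    ; range = ⊑-++ {e} ∈-++⁺ˡ λ p → ∈-++⁺ʳ e (⊑-++ {E'} ∈-++⁺ˡ (flatʳ {a = a} {b} {E'} {l} {r}) (R.range p))
    ; conn = conn-touch c R.conn (touch-mono id R.from t)
    ; to = touch-mono (∈-++⁺ʳ e) id R.to
    ; off = disj-++ˡ (λ p q → d p (flatʳ {a = a} {b} {E'} {l} {r} (sub-flat s q))) R.off }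
    where module R = Route (route cE dr tr vr s)

  -- The bag of a new parent for `s₀` and `s₁`. Containing `bag T` keeps its contact with the bag
  -- above, lying in `flat T` keeps it in the interval of `T`.
  record Joint {m h} (s₀ s₁ : Tree m) (T : Tree h) : Set where
    field
      E     : List V
      from  : bag T ⊑ E
      range : E ⊑ flat T
      conn  : Conn E
      to₀   : Touch E (bag s₀)
      to₁   : Touch E (bag s₁)
      off₀  : Disj E (flat s₀)
      off₁  : Disj E (flat s₁)

  joint-swap : ∀ {m h} {s₀ s₁ : Tree m} {T : Tree h} → Joint s₀ s₁ T → Joint s₁ s₀ T
  joint-swap j = record { E = E ; from = from ; range = range ; conn = conn ; to₀ = to₁ ; to₁ = to₀ ; off₀ = off₁ ; off₁ = off₀ }
    where open Joint j

  joint-apart : ∀ {m h a b e} {s₀ s₁ : Tree m} {l r : Tree h} → Valid (node a b e l r) → Sub s₀ l → Sub s₁ r →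
      Joint s₀ s₁ (node a b e l r)
  joint-apart {a = a} {b} {e} {s₀} {s₁} {l} {r} ((x , xe) , c , tl , tr , dl , dr , dlr , vl , vr) p q = record
    { E = R₀.E ++ R₁.E
    ; from = ∈-++⁺ˡ ∘ R₀.from
    ; range = ⊑-++ {R₀.E} (λ p → ⊑-++ {e} ∈-++⁺ˡ (flatˡ {a = a} {b} {e} {l} {r}) (R₀.range p))
                          (λ p → ⊑-++ {e} ∈-++⁺ˡ (flatʳ {a = a} {b} {e} {l} {r}) (R₁.range p))
    ; conn = conn-meet R₀.conn R₁.conn (R₀.from xe) (R₁.from xe)
    ; to₀ = touch-mono ∈-++⁺ˡ id R₀.to
    ; to₁ = touch-mono (∈-++⁺ʳ R₀.E) id R₁.to
    ; off₀ = disj-++ˡ R₀.off λ p' q' → [ (λ k → dl k (sub-flat p q')) , (λ k → dlr (sub-flat p q') k) ]′ (∈-++⁻ e (R₁.range p'))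
    ; off₁ = disj-++ˡ (λ p' q' → [ (λ k → dr k (sub-flat q q')) , (λ k → dlr k (sub-flat q q')) ]′ (∈-++⁻ e
        (R₀.range p'))) R₁.off }
    where
    module R₀ = Route (route c dl tl vl p)
    module R₁ = Route (route c dr tr vr q)

  joint-mirror : ∀ {m h a b e} {s₀ s₁ : Tree m} {l r : Tree h} → Valid (node a b e l r) → Sub s₀ r → Sub s₁ l →
      Joint s₀ s₁ (node a b e l r)
  joint-mirror {a = a} {b} {e} {s₀} {s₁} {l} {r} v p q = joint-swap (joint-apart v q p)

  joint : ∀ {m h} {s₀ s₁ : Tree m} {T : Tree h} → Valid T → Sub s₀ T → Sub s₁ T → Disj (flat s₀) (flat s₁) → Joint s₀ s₁ T
  joint {s₁ = s₁} v hereS q d with inhabited s₁ (sub-valid q v)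
  ... | x , x∈ = ⊥-elim (d (sub-flat q x∈) x∈)
  joint {s₀ = s₀} v p@(leftS _) hereS d with inhabited s₀ (sub-valid p v)
  ... | x , x∈ = ⊥-elim (d x∈ (sub-flat p x∈))
  joint {s₀ = s₀} v p@(rightS _) hereS d with inhabited s₀ (sub-valid p v)
  ... | x , x∈ = ⊥-elim (d x∈ (sub-flat p x∈))
  joint v (leftS p) (rightS q) d = joint-apart v p q
  joint v (rightS p) (leftS q) d = joint-mirror v p q
  joint (_ , c , tl , _ , dl , _ , _ , vl , _) (leftS {a = a} {b} {e} {l} {r} p) (leftS q) d = record
    { E = e ++ J.E ; from = ∈-++⁺ˡ
    ; range = ⊑-++ {e} ∈-++⁺ˡ (flatˡ {a = a} {b} {e} {l} {r} ∘ J.range)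
    ; conn = conn-touch c J.conn (touch-mono id J.from tl)
    ; to₀ = touch-mono (∈-++⁺ʳ e) id J.to₀ ; to₁ = touch-mono (∈-++⁺ʳ e) id J.to₁
    ; off₀ = disj-++ˡ (λ x y → dl x (sub-flat p y)) J.off₀ ; off₁ = disj-++ˡ (λ x y → dl x (sub-flat q y)) J.off₁ }
    where module J = Joint (joint vl p q d)
  joint (_ , c , _ , tr , _ , dr , _ , _ , vr) (rightS {a = a} {b} {e} {l} {r} p) (rightS q) d = record
    { E = e ++ J.E ; from = ∈-++⁺ˡ
    ; range = ⊑-++ {e} ∈-++⁺ˡ (flatʳ {a = a} {b} {e} {l} {r} ∘ J.range)
    ; conn = conn-touch c J.conn (touch-mono id J.from tr)
    ; to₀ = touch-mono (∈-++⁺ʳ e) id J.to₀ ; to₁ = touch-mono (∈-++⁺ʳ e) id J.to₁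
    ; off₀ = disj-++ˡ (λ x y → dr x (sub-flat p y)) J.off₀ ; off₁ = disj-++ˡ (λ x y → dr x (sub-flat q y)) J.off₁ }
    where module J = Joint (joint vr p q d)

-- Two levels for each straddler gained in `hit`, so `h + 2k` in all.
ht : ℕ → ℕ → ℕ
ht zero h = h
ht (suc k) h = suc (suc (ht k h))

crossing : ∀ {n} → ChordSystem n → SimpleGraph n
crossing 𝒞 = record { Adj = Cr ; Adj? = Cr? ; symA = Cr-sym ; irrefl = Cr-irrefl }
  where open Chords 𝒞

module Intervals {n : ℕ} (𝒞 : ChordSystem n) where
  open ChordSystem 𝒞
  open Chords 𝒞 using (Cr)
  open Cuts 𝒞
  open Bags (crossing 𝒞)
  open Subtrees (crossing 𝒞)

  Inside : ℕ → ℕ → V → Set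
  Inside a b v = a ≤ L v × H v < b

  Outside : ℕ → ℕ → V → Set
  Outside a b v = (L v < a ⊎ b ≤ L v) × (H v < a ⊎ b ≤ H v)

  Inside? : ∀ a b v → Dec (Inside a b v)
  Inside? a b v = a ≤? L v ×-dec H v <? b

  Outside? : ∀ a b v → Dec (Outside a b v)
  Outside? a b v = (L v <? a ⊎-dec b ≤? L v) ×-dec (H v <? a ⊎-dec b ≤? H v)

  trichotomy : ∀ {a b v} → ¬ St a b v → Inside a b v ⊎ Outside a b v
  trichotomy {a} {b} {v} ¬s with In? a v | In? b v
  ... | yes i | no ¬i = ⊥-elim (¬s (inj₁ (i , ¬i)))
  ... | no ¬i | yes i = ⊥-elim (¬s (inj₂ (¬i , i)))
  ... | yes (la , _) | yes (_ , bh) = inj₂ (inj₁ la , inj₂ bh)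
  ... | no ¬a | no ¬b with ¬In ¬a | ¬In ¬b
  ... | inj₂ ha | _ = inj₂ (inj₁ (<-trans (L<H v) ha) , inj₁ ha)
  ... | inj₁ al | inj₁ bl = inj₂ (inj₂ bl , inj₂ (≤-trans bl (<⇒≤ (L<H v))))
  ... | inj₁ al | inj₂ hb = inj₁ (al , hb)

  inside-¬outside : ∀ {a b v} → Inside a b v → ¬ Outside a b v
  inside-¬outside {v = v} (al , hb) (inj₁ la , _) = <-irrefl refl (≤-<-trans al la)
  inside-¬outside {v = v} (al , hb) (inj₂ bl , _) = <-irrefl refl (<-trans hb (≤-<-trans bl (L<H v)))

  inside-¬St : ∀ {a b v} → Inside a b v → ¬ St a b v
  inside-¬St (al , hb) (inj₁ ((la , _) , _)) = <-irrefl refl (≤-<-trans al la)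
  inside-¬St (al , hb) (inj₂ (_ , (_ , bh))) = <-irrefl refl (≤-<-trans bh hb)

  outside-¬St : ∀ {a b v} → a ≤ b → Outside a b v → ¬ St a b v
  outside-¬St a≤b (_ , inj₁ ha) (inj₁ ((_ , ah) , _)) = <-irrefl refl (≤-<-trans ah ha)
  outside-¬St a≤b (_ , inj₂ bh) (inj₁ ((la , _) , ¬b)) = ¬b (<-≤-trans la a≤b , bh)
  outside-¬St a≤b (inj₁ la , _) (inj₂ (¬a , (_ , bh))) = ¬a (la , ≤-trans a≤b bh)
  outside-¬St a≤b (inj₂ bl , _) (inj₂ (_ , (lb , _))) = <-irrefl refl (≤-<-trans bl lb)

  inside-outside-anti : ∀ {a b u v} → Inside a b u → Outside a b v → ¬ Cr u v
  inside-outside-anti (al , hb) (inj₁ la , _) (inj₁ (p , q , r)) = <-irrefl refl (<-trans la (≤-<-trans al p))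
  inside-outside-anti (al , hb) (inj₂ bl , _) (inj₁ (p , q , r)) = <-irrefl refl (<-trans q (<-≤-trans hb bl))
  inside-outside-anti (al , hb) (_ , inj₁ ha) (inj₂ (p , q , r)) = <-irrefl refl (<-trans ha (≤-<-trans al q))
  inside-outside-anti (al , hb) (_ , inj₂ bh) (inj₂ (p , q , r)) = <-irrefl refl (<-trans r (<-≤-trans hb bh))

  inside-mono : ∀ {a b a' b' v} → a' ≤ a → b ≤ b' → Inside a b v → Inside a' b' v
  inside-mono p q (x , y) = ≤-trans p x , <-≤-trans y q

  outside-mono : ∀ {a b a' b' v} → a ≤ a' → b' ≤ b → Outside a b v → Outside a' b' v
  outside-mono p q (x , y) = w x , w y
    where
    w : ∀ {z} → z < _ ⊎ _ ≤ z → z < _ ⊎ _ ≤ z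
    w (inj₁ s) = inj₁ (<-≤-trans s p)
    w (inj₂ s) = inj₂ (≤-trans q s)

  inside-apart : ∀ {a b c d v} → b ≤ c ⊎ d ≤ a → Inside a b v → Outside c d v
  inside-apart {v = v} (inj₁ bc) (al , hb) = inj₁ (<-trans (L<H v) (<-≤-trans hb bc)) , inj₁ (<-≤-trans hb bc)
  inside-apart {v = v} (inj₂ da) (al , hb) = inj₂ (≤-trans da al) , inj₂ (≤-trans da (≤-trans al (<⇒≤ (L<H v))))

  InsideL : ℕ → ℕ → List V → Set
  InsideL a b E = ∀ {x} → x ∈ E → Inside a b x

  OutsideL : ℕ → ℕ → List V → Set
  OutsideL a b E = ∀ {x} → x ∈ E → Outside a b x

  InsideL? : ∀ a b E → Dec (InsideL a b E)
  InsideL? a b E = map′ All.lookup (λ f → All.tabulate f) (all? (Inside? a b) E)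

  OutsideL? : ∀ a b E → Dec (OutsideL a b E)
  OutsideL? a b E = map′ All.lookup (λ f → All.tabulate f) (all? (Outside? a b) E)

  stays-inside : ∀ {a b E x y} → (∀ {z} → z ∈ E → ¬ St a b z) → Walk E x y → Inside a b x → Inside a b y
  stays-inside ¬s (stay _) i = i
  stays-inside ¬s (step x∈ adj w) i with trichotomy (¬s (walk-start w))
  ... | inj₁ i' = stays-inside ¬s w i'
  ... | inj₂ o = ⊥-elim (inside-outside-anti i o adj)

  -- Chords inside an interval do not cross chords outside it, so a walk can only leave the inside
  -- through a straddler.
  straddler : ∀ {a b E x y} → Conn E → x ∈ E → y ∈ E → ¬ Outside a b x → ¬ Inside a b y → Σ V λ z → z ∈ E × St a b z
  straddler {a} {b} {E} {x} {y} c xE yE ¬o ¬i with Finₚ.any? (λ z → z ∈? E ×-dec St? a b z)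
  ... | yes r = r
  ... | no ¬any = ⊥-elim (¬i (stays-inside (λ z∈ s → ¬any (_ , z∈ , s)) (c xE yE)
                    ([ id , (λ o → ⊥-elim (¬o o)) ]′ (trichotomy λ s → ¬any (x , xE , s)))))

  module Nesting (t : ℕ) where
    private
      κ : ℕ
      κ = K t

    module Search (h : ℕ) {top : ℕ} (S : Tree top) where

      Has : ℕ → ℕ → Set
      Has a b = Σ (Tree h) λ s → Sub s S × InsideL a b (flat s)

      has? : ∀ a b {m} (T : Tree m) → Dec (Σ (Tree h) λ s → Sub s T × InsideL a b (flat s))
      has? a b {m} T with m ≟ h
      has? a b T | yes refl with InsideL? a b (flat T)
      ... | yes i = yes (T , hereS , i)
      has? a b (leaf _ _ _) | yes refl | no ¬i = no λ { (_ , hereS , i) → ¬i i }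
      has? a b (node _ _ _ l r) | yes refl | no ¬i with has? a b l | has? a b r
      ... | yes (s , p , i) | _ = yes (s , leftS p , i)
      ... | no _ | yes (s , p , i) = yes (s , rightS p , i)
      ... | no ¬l | no ¬r = no λ { (_ , hereS , i) → ¬i i ; (s , leftS p , i) → ¬l (s , p , i) ; (s , rightS p
            , i) → ¬r (s , p , i) }
      has? a b (leaf _ _ _) | no ne = no λ { (_ , hereS , i) → ne refl }
      has? a b (node _ _ _ l r) | no ne with has? a b l | has? a b r
      ... | yes (s , p , i) | _ = yes (s , leftS p , i)
      ... | no _ | yes (s , p , i) = yes (s , rightS p , i)
      ... | no ¬l | no ¬r = no λ { (_ , hereS , i) → ne refl ; (s , leftS p , i) → ¬l (s , p , i) ; (s , rightS
            p , i) → ¬r (s , p , i) }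

      -- The trace of a failed search: nested cheap intervals, each step discarding a part that
      -- holds no subtree of height `h`. It plays the role of a path decomposition of `S`, with the
      -- straddlers as separators.
      record Chain (a b : ℕ) : Set where
        field
          len    : ℕ
          A B    : ℕ → ℕ
          A0     : A 0 ≡ a
          B0     : B 0 ≡ b
          A≤B    : ∀ i → A i ≤ B i
          A-up   : ∀ i → A i ≤ A (suc i)
          B-down : ∀ i → B (suc i) ≤ B i
          low    : ∀ i → i ≤ len → cost (A i) (B i) ≤ κ
          end    : ¬ Has (A len) (B len)
          side   : ∀ i → i < len → ∃₂ λ c d → ¬ Has c d ×
                   (∀ v → Inside (A i) (B i) v → Outside (A (suc i)) (B (suc i)) v → Inside c d v)

      chain-stop : ∀ {a b} → a ≤ b → cost a b ≤ κ → ¬ Has a b → Chain a b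
      chain-stop {a} {b} a≤b lo ¬h = record
        { len = 0 ; A = λ _ → a ; B = λ _ → b ; A0 = refl ; B0 = refl ; A≤B = λ _ → a≤b
        ; A-up = λ _ → ≤-refl ; B-down = λ _ → ≤-refl ; low = λ _ _ → lo ; end = ¬h ; side = λ _ () }

      chain-cons : ∀ {a b a' b' c d} → a ≤ b → a ≤ a' → b' ≤ b → cost a b ≤ κ → ¬ Has c d →
        (∀ v → Inside a b v → Outside a' b' v → Inside c d v) → Chain a' b' → Chain a b
      chain-cons {a} {b} {a'} {b'} {c} {d} a≤b aa bb lo ¬h sib ch = record
        { len = suc len ; A = A' ; B = B' ; A0 = refl ; B0 = refl ; A≤B = λ { zero → a≤b ; (suc i) → A≤B i }
        ; A-up = λ { zero → subst (a ≤_) (sym A0) aa ; (suc i) → A-up i }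
        ; B-down = λ { zero → subst (_≤ b) (sym B0) bb ; (suc i) → B-down i }
        ; low = λ { zero _ → lo ; (suc i) (s≤s le) → low i le }
        ; end = end
        ; side = λ { zero _ → c , d , ¬h , λ v i o → sib v i (subst (λ p → Outside p b' v) A0 (subst (λ q →
            Outside (A 0) q v) B0 o))
                   ; (suc i) (s≤s lt) → side i lt } }
        where
        open Chain ch
        A' B' : ℕ → ℕ
        A' zero = a
        A' (suc i) = A i
        B' zero = b
        B' (suc i) = B i

      record Found (a b : ℕ) : Set where
        field
          a' r b' : ℕ
          aa'     : a ≤ a'
          a'r     : a' ≤ r
          rb'     : r ≤ b'
          b'b     : b' ≤ b
          low₀    : cost a' r ≤ κ
          low₁    : cost r b' ≤ κ
          has₀    : Has a' r
          has₁    : Has r b'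

      found-mono : ∀ {a b c d} → a ≤ c → d ≤ b → Found c d → Found a b
      found-mono p q F = record { a' = a' ; r = r ; b' = b' ; aa' = ≤-trans p aa' ; a'r = a'r ; rb' = rb' ; b'b = ≤-trans b'b q
                                ; low₀ = low₀ ; low₁ = low₁ ; has₀ = has₀ ; has₁ = has₁ }
        where open Found F

      left-over : ∀ {a r b} v → Inside a b v → Outside a r v → Inside r b v
      left-over v (al , hb) (inj₁ la , _) = ⊥-elim (<-irrefl refl (≤-<-trans al la))
      left-over v (al , hb) (inj₂ rl , _) = rl , hb

      right-over : ∀ {a r b} v → Inside a b v → Outside r b v → Inside a r v
      right-over v (al , hb) (_ , inj₁ hr) = al , hr
      right-over v (al , hb) (_ , inj₂ bh) = ⊥-elim (<-irrefl refl (≤-<-trans bh hb))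

      -- Splits repeatedly. If both parts hold a subtree of height `h`, the search succeeds;
      -- otherwise a part without one is recorded as a side of the chain and the search goes on in
      -- the other. The fuel `f` bounds the length of the interval.
      descend : Valid S → ∀ f a b → a ≤ b → b ∸ a ≤ f → cost a b ≤ κ → Found a b ⊎ Chain a b ⊎ CycleOutcome t n Cr
      descend vS f a b a≤b bd lo with has? a b S
      ... | no ¬h = inj₂ (inj₁ (chain-stop a≤b lo ¬h))
      ... | yes (s , p , i) with inhabited s (sub-valid p vS)
      ... | x , x∈ with split t a b (≤-<-trans (≤-<-trans (proj₁ (i x∈)) (L<H x)) (proj₂ (i x∈))) lo
      ... | inj₂ c = inj₂ (inj₂ c)
      descend vS zero a b a≤b bd lo | yes _ | _ | inj₁ (r , ar , rb , _) =
        ⊥-elim (<-irrefl refl (<-≤-trans (m<n⇒0<n∸m (<-trans ar rb)) bd))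
      descend vS (suc f) a b a≤b bd lo | yes _ | _ | inj₁ (r , ar , rb , lo₀ , lo₁) with has? a r S | has? r b S
      ... | yes h₀ | yes h₁ = inj₁ (record { a' = a ; r = r ; b' = b ; aa' = ≤-refl ; a'r = <⇒≤ ar ; rb' = <⇒≤ rb ; b'b = ≤-refl
                                           ; low₀ = lo₀ ; low₁ = lo₁ ; has₀ = h₀ ; has₁ = h₁ })
      ... | _ | no ¬h₁ with descend vS f a r (<⇒≤ ar) (≤-pred (≤-trans (∸-monoˡ-< rb (<⇒≤ ar)) bd)) lo₀
      ... | inj₁ F = inj₁ (found-mono ≤-refl (<⇒≤ rb) F)
      ... | inj₂ (inj₁ ch) = inj₂ (inj₁ (chain-cons a≤b ≤-refl (<⇒≤ rb) lo ¬h₁ left-over ch))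
      ... | inj₂ (inj₂ c) = inj₂ (inj₂ c)
      descend vS (suc f) a b a≤b bd lo | yes _ | _ | inj₁ (r , ar , rb , lo₀ , lo₁) | no ¬h₀ | yes _
        with descend vS f r b (<⇒≤ rb) (≤-pred (≤-trans (∸-monoʳ-< ar (<⇒≤ rb)) bd)) lo₁
      ... | inj₁ F = inj₁ (found-mono (<⇒≤ ar) ≤-refl F)
      ... | inj₂ (inj₁ ch) = inj₂ (inj₁ (chain-cons a≤b (<⇒≤ ar) ≤-refl lo ¬h₀ right-over ch))
      ... | inj₂ (inj₂ c) = inj₂ (inj₂ c)

      module OnChain {a b : ℕ} (ch : Chain a b) where
        open Chain ch

        A-mono : ∀ {i j} → i ≤ j → A i ≤ A j
        A-mono {i} {j} le with m≤n⇒m<n∨m≡n le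
        ... | inj₂ refl = ≤-refl
        A-mono {i} {suc j} le | inj₁ (s≤s le') = ≤-trans (A-mono le') (A-up j)

        B-mono : ∀ {i j} → i ≤ j → B j ≤ B i
        B-mono {i} {j} le with m≤n⇒m<n∨m≡n le
        ... | inj₂ refl = ≤-refl
        B-mono {i} {suc j} le | inj₁ (s≤s le') = ≤-trans (B-down j) (B-mono le')

        On : ℕ → List V → V → Set
        On i F v = St (A i) (B i) v × v ∈ F

        On? : ∀ i F v → Dec (On i F v)
        On? i F v = St? (A i) (B i) v ×-dec v ∈? F

        Hit : ℕ → List V → Set
        Hit k F = Σ ℕ λ i → i ≤ len × suc k ≤ cnt (On? i F)

        -- Being connected, a subtree that is never straddled would remain inside up to the end of
        -- the chain or fall as a whole into a discarded side, and neither holds a subtree of height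
        -- `h`.
        hit₀ : ∀ (T : Tree h) → Valid T → Sub T S → InsideL a b (flat T) → Hit 0 (flat T)
        hit₀ T vT sT ins = go len 0 (+-identityʳ len) (λ x∈ → subst (λ p → Inside p (B 0) _) (sym A0) (subst (λ
            q → Inside a q _) (sym B0) (ins x∈)))
          where
          go : ∀ d i → d + i ≡ len → InsideL (A i) (B i) (flat T) → Hit 0 (flat T)
          go zero i refl ins = ⊥-elim (end (T , sT , ins))
          go (suc d) i e ins with InsideL? (A (suc i)) (B (suc i)) (flat T)
          ... | yes ins' = go d (suc i) (trans (+-suc d i) e) ins'
          ... | no ¬ins' with Finₚ.any? (On? (suc i) (flat T))
          ... | yes (v , on) = suc i , subst (suc i ≤_) e (s≤s (m≤n+m i d)) ,
                cnt-some (On? (suc i) (flat T)) (v , on)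
          ... | no ¬any with side i (subst (suc i ≤_) e (s≤s (m≤n+m i d)))
          ... | c , d' , ¬h , sib = ⊥-elim (¬h (T , sT , λ {x} x∈ → sib x (ins x∈) (out x∈)))
            where
            out : ∀ {x} → x ∈ flat T → Outside (A (suc i)) (B (suc i)) x
            out {x} x∈ with trichotomy (λ s → ¬any (x , s , x∈))
            ... | inj₂ o = o
            ... | inj₁ i' = ⊥-elim (¬ins' λ y∈ → stays-inside (λ z∈ s → ¬any (_ , s , z∈)) (conn-flat T vT x∈ y∈) i')

        -- A connected set that reaches both the inside and the outside of the
        -- middle interval contributes a straddler of its own.
        extra : ∀ {k i i₁ i₃ M C F} → i₁ ≤ i → i ≤ i₃ → suc k ≤ cnt (On? i M) → 0 < cnt (On? i₁ C) → 0 < cnt (On? i₃ C) →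
          Conn C → Disj C M → M ⊑ F → C ⊑ F → suc (suc k) ≤ cnt (On? i F)
        extra {k} {i} {i₁} {i₃} {M} {C} {F} le₁ le₃ hM h₁ h₃ conn dj MF CF with cnt-pos (On? i₁ C) h₁ | cnt-pos (On? i₃ C) h₃
        ... | u₁ , s₁ , u₁C | u₃ , s₃ , u₃C
          with straddler {A i} {B i} conn u₃C u₁C
                 (λ o → outside-¬St (A≤B i₃) (outside-mono (A-mono le₃) (B-mono le₃) o) s₃)
                 (λ ins → inside-¬St (inside-mono (A-mono le₁) (B-mono le₁) ins) s₁)
        ... | z , zC , sz = ≤-trans (s≤s hM)
          (cnt-strict (On? i M) (On? i F) (λ v (s , m) → s , MF m) z (sz , CF zC) λ (_ , m) → dj zC m)

        weaken : ∀ {k i E F} → E ⊑ F → suc k ≤ cnt (On? i E) → 0 < cnt (On? i F)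
        weaken {i = i} {E} {F} sub le = ≤-trans (≤-trans (s≤s z≤n) le) (cnt-mono (On? i E) (On? i F) λ v (s , m) → s , sub m)

        -- The classical lower bound for the pathwidth of trees: order the three subtrees by the
        -- stages at which they are hit. The connected set joining the two outer ones avoids the
        -- middle one and adds a straddler at its stage.
        middle : ∀ {k X Y Z CX CY CZ F} → Hit k X → Hit k Y → Hit k Z →
          Conn CX → Conn CY → Conn CZ → Y ⊑ CX → Z ⊑ CX → X ⊑ CY → Z ⊑ CY → X ⊑ CZ → Y ⊑ CZ →
          Disj CX X → Disj CY Y → Disj CZ Z → X ⊑ F → Y ⊑ F → Z ⊑ F → CX ⊑ F → CY ⊑ F → CZ ⊑ F → Hit (suc k) F
        middle (i , i≤ , hx) (j , j≤ , hy) (l , l≤ , hz) cX cY cZ YX ZX XY ZY XZ YZ dX dY dZ XF YF ZF CXF CYF CZF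
          with ≤-total i j | ≤-total j l | ≤-total i l
        ... | inj₁ ij | inj₁ jl | _ = j , j≤ , extra ij jl hy (weaken XY hx) (weaken ZY hz) cY dY YF CYF
        ... | inj₁ ij | inj₂ lj | inj₁ il = l , l≤ , extra il lj hz (weaken XZ hx) (weaken YZ hy) cZ dZ ZF CZF
        ... | inj₁ ij | inj₂ lj | inj₂ li = i , i≤ , extra li ij hx (weaken ZX hz) (weaken YX hy) cX dX XF CXF
        ... | inj₂ ji | inj₁ jl | inj₁ il = i , i≤ , extra ji il hx (weaken YX hy) (weaken ZX hz) cX dX XF CXF
        ... | inj₂ ji | inj₁ jl | inj₂ li = l , l≤ , extra jl li hz (weaken YZ hy) (weaken XZ hx) cZ dZ ZF CZF
        ... | inj₂ ji | inj₂ lj | _ = j , j≤ , extra lj ji hy (weaken ZY hz) (weaken XY hx) cY dY YF CYF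

        hit : ∀ k (T : Tree (ht k h)) → Valid T → Sub T S → InsideL a b (flat T) → Hit k (flat T)
        hit zero T vT sT ins = hit₀ T vT sT ins
        -- Three disjoint subtrees, any two of them joined without the third, take two levels: both
        -- grandchildren on the left and one on the right.
        hit (suc k) T@(node _ _ e T₀@(node _ _ e₀ X Y) T₁@(node _ _ e₁ Z Z'))
            vT@(_ , c , t₀ , t₁ , d₀ , d₁ , d₀₁ , v₀@(_ , c₀ , tX , tY , dX , dY , dXY , vX , vY) , v₁@(_ , c₁
                , tZ , _ , dZ , _ , _ , vZ , _)) sT ins =
          middle (hit k X vX (sub-trans (leftS (leftS hereS)) sT) (ins ∘ XF)) (hit k Y vY (sub-trans (leftS
              (rightS hereS)) sT) (ins ∘ YF))
                 (hit k Z vZ (sub-trans (rightS (leftS hereS)) sT) (ins ∘ ZF))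
                 cX cY cZ
                 (∈-++⁺ˡ ∘ ∈-++⁺ʳ e₀) (∈-++⁺ʳ (e₀ ++ flat Y) ∘ ∈-++⁺ʳ e ∘ ∈-++⁺ʳ e₁)
                 (∈-++⁺ˡ ∘ ∈-++⁺ʳ e₀) (∈-++⁺ʳ (e₀ ++ flat X) ∘ ∈-++⁺ʳ e ∘ ∈-++⁺ʳ e₁)
                 (∈-++⁺ˡ ∘ ∈-++⁺ʳ e₀) (∈-++⁺ʳ (e₀ ++ flat X) ∘ ∈-++⁺ʳ e₀)
                 (disj-++ˡ (disj-++ˡ dX (λ p q → dXY q p)) (disj-far X XT₀))
                 (disj-++ˡ (disj-++ˡ dY dXY) (disj-far Y YT₀))
                 (λ p q → d₀₁ (⊑-++ {e₀ ++ flat X} (⊑-++ {e₀} ∈-++⁺ˡ XT₀) (⊑-++ {e₀} ∈-++⁺ˡ YT₀) p) (ZT₁ q))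
                 XF YF ZF
                 (⊑-++ {e₀ ++ flat Y} (⊑-++ {e₀} (T₀F ∘ ∈-++⁺ˡ) YF) farF)
                 (⊑-++ {e₀ ++ flat X} (⊑-++ {e₀} (T₀F ∘ ∈-++⁺ˡ) XF) farF)
                 (⊑-++ {e₀ ++ flat X} (⊑-++ {e₀} (T₀F ∘ ∈-++⁺ˡ) XF) (⊑-++ {e₀} (T₀F ∘ ∈-++⁺ˡ) YF))
          where
          XT₀ : flat X ⊑ flat T₀
          XT₀ = ∈-++⁺ʳ e₀ ∘ ∈-++⁺ˡ
          YT₀ : flat Y ⊑ flat T₀
          YT₀ = ∈-++⁺ʳ e₀ ∘ ∈-++⁺ʳ (flat X)
          ZT₁ : flat Z ⊑ flat T₁
          ZT₁ = ∈-++⁺ʳ e₁ ∘ ∈-++⁺ˡ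
          T₀F : flat T₀ ⊑ flat T
          T₀F = ∈-++⁺ʳ e ∘ ∈-++⁺ˡ
          T₁F : flat T₁ ⊑ flat T
          T₁F = ∈-++⁺ʳ e ∘ ∈-++⁺ʳ (flat T₀)
          XF : flat X ⊑ flat T
          XF = T₀F ∘ XT₀
          YF : flat Y ⊑ flat T
          YF = T₀F ∘ YT₀
          ZF : flat Z ⊑ flat T
          ZF = T₁F ∘ ZT₁
          far : List V
          far = e ++ (e₁ ++ flat Z)
          farF : far ⊑ flat T
          farF = ⊑-++ {e} ∈-++⁺ˡ (⊑-++ {e₁} (T₁F ∘ ∈-++⁺ˡ) ZF)
          c-far : Conn far
          c-far = conn-touch c (conn-touch c₁ (conn-flat Z vZ) (touch-mono id (bag⊑flat Z) tZ)) (touch-mono id ∈-++⁺ˡ t₁)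
          disj-far : ∀ (W : Tree _) → flat W ⊑ flat T₀ → Disj far (flat W)
          disj-far W WT₀ = disj-++ˡ (λ p q → d₀ p (WT₀ q)) (disj-++ˡ (λ p q → d₀₁ (WT₀ q) (∈-++⁺ˡ p)) (λ p q →
              d₀₁ (WT₀ q) (ZT₁ p)))
          near : ∀ (W : Tree _) → Valid W → Touch e₀ (bag W) → Conn (e₀ ++ flat W)
          near W vW tW = conn-touch c₀ (conn-flat W vW) (touch-mono id (bag⊑flat W) tW)
          cX : Conn ((e₀ ++ flat Y) ++ far)
          cX = conn-touch (near Y vY tY) c-far (touch-sym (touch-mono ∈-++⁺ˡ ∈-++⁺ˡ t₀))
          cY : Conn ((e₀ ++ flat X) ++ far)
          cY = conn-touch (near X vX tX) c-far (touch-sym (touch-mono ∈-++⁺ˡ ∈-++⁺ˡ t₀))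
          cZ : Conn ((e₀ ++ flat X) ++ (e₀ ++ flat Y))
          cZ = conn-meet (near X vX tX) (near Y vY tY) (∈-++⁺ˡ (proj₂ (proj₁ v₀))) (∈-++⁺ˡ (proj₂ (proj₁ v₀)))

      -- A failed search would exhibit `κ + 1` straddlers of an interval of cost at most `κ`.
      nest : (eq : top ≡ ht κ h) → Valid S → ∀ {a b} → a ≤ b → InsideL a b (flat S) → cost a b ≤ κ → Found a b
          ⊎ CycleOutcome t n Cr
      nest refl vS {a} {b} a≤b ins lo with descend vS (b ∸ a) a b a≤b ≤-refl lo
      ... | inj₁ F = inj₁ F
      ... | inj₂ (inj₂ c) = inj₂ c
      ... | inj₂ (inj₁ ch) with OnChain.hit ch κ S vS hereS ins
      ... | i , i≤ , many = ⊥-elim (<-irrefl refl (≤-trans many (≤-trans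
              (cnt-mono (OnChain.On? ch i (flat S)) (St? (Chain.A ch i) (Chain.B ch i)) λ v → proj₁) (Chain.low ch i i≤))))

-- Induced minors

module InducedMinor {n : ℕ} (𝒢 : SimpleGraph n) where
  open Bags 𝒢

  lower : ∀ {h} → Tree h → List V
  lower (leaf _ _ _) = []
  lower (node _ _ _ l r) = flat l ++ flat r

  Induced : ∀ {h} → Tree h → Set
  Induced (leaf _ _ _) = ⊤
  Induced (node _ _ E l r) = Anti E (lower l) × Anti E (lower r) × Anti (flat l) (flat r) × Induced l × Induced r

-- Each level that receives intervals is produced by one application of `nest`, at the price of `2k`
-- levels.
nested-height : ℕ → ℕ → ℕ
nested-height k zero = 0
nested-height k (suc m) = ht k (nested-height k m)

-- One level is kept; the `d` levels after it either contain a place that the bag above avoids, or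
-- form a tree large enough for a restart.
sparse-height : ℕ → ℕ → ℕ
sparse-height d zero = 0
sparse-height d (suc j) = suc (d + sparse-height d j)

-- Recursion on the number `k` of straddlers still available: a restart needs the height for `k`.
-- The outer `suc` is for the root, whose bag serves as the first bag above.
induced-height : ℕ → ℕ → ℕ
induced-height zero h = 1
induced-height (suc k) h = suc (sparse-height (induced-height k h) h)

module ArcTrees {n : ℕ} (𝒞 : ChordSystem n) where
  open ChordSystem 𝒞
  open Chords 𝒞 using (Cr; Cr-sym)
  open Cuts 𝒞
  open Bags (crossing 𝒞)
  open Subtrees (crossing 𝒞)
  open Intervals 𝒞
  open InducedMinor (crossing 𝒞)

  lo hi : ∀ {h} → Tree h → ℕ
  lo (leaf a _ _) = a
  lo (node a _ _ _ _) = a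
  hi (leaf _ b _) = b
  hi (node _ b _ _ _) = b

  Arced : ∀ {h} → Tree h → Set
  Arced (leaf a b E) = a ≤ b × InsideL a b E
  Arced (node a b E l r) = a ≤ b × InsideL a b E × (a ≤ lo l × hi l ≤ lo r × hi r ≤ b) × Arced l × Arced r

  -- Restricting the count to `W` is what makes restarts pay: a bag that stabs every interval of a
  -- subtree is disjoint from the subtree, so it no longer counts once `W` shrinks to the vertices
  -- of the latter.
  Low : ∀ {h} → ℕ → List V → Tree h → Set
  Low k W (leaf a b _) = cnt (λ v → St? a b v ×-dec v ∈? W) ≤ k
  Low k W (node a b _ l r) = cnt (λ v → St? a b v ×-dec v ∈? W) ≤ k × Low k W l × Low k W r

  arced-≤ : ∀ {h} (T : Tree h) → Arced T → lo T ≤ hi T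
  arced-≤ (leaf _ _ _) (p , _) = p
  arced-≤ (node _ _ _ _ _) (p , _) = p

  arced-sub : ∀ {m h} {s : Tree m} {T : Tree h} → Sub s T → Arced T → Arced s × lo T ≤ lo s × hi s ≤ hi T
  arced-sub hereS ar = ar , ≤-refl , ≤-refl
  arced-sub (leftS {l = l} {r} s) (_ , _ , (p , q , q') , al , ar) with arced-sub s al
  ... | as , x , y = as , ≤-trans p x , ≤-trans y (≤-trans q (≤-trans (arced-≤ r ar) q'))
  arced-sub (rightS {l = l} {r} s) (_ , _ , (p , q , q') , al , ar) with arced-sub s ar
  ... | as , x , y = as , ≤-trans p (≤-trans (arced-≤ l al) (≤-trans q x)) , ≤-trans y q'

  arced-flat : ∀ {h} (T : Tree h) → Arced T → InsideL (lo T) (hi T) (flat T)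
  arced-flat (leaf _ _ _) (_ , i) = i
  arced-flat (node a b E l r) ar@(_ , i , _ , al , ar') p with ∈-node {a = a} {b} {E} {l = l} {r} p
  ... | inj₁ q = i q
  ... | inj₂ (inj₁ q) with arced-sub (leftS {a = a} {b} {E} {l} {r} hereS) ar
  ... | _ , x , y = inside-mono x y (arced-flat l al q)
  arced-flat (node a b E l r) ar@(_ , i , _ , al , ar') p | inj₂ (inj₂ q) with arced-sub (rightS {a = a} {b} {E} {l} {r} hereS) ar
  ... | _ , x , y = inside-mono x y (arced-flat r ar' q)

  low-sub : ∀ {k W m h} {s : Tree m} {T : Tree h} → Sub s T → Low k W T → Low k W s
  low-sub hereS l = l
  low-sub (leftS s) (_ , l , _) = low-sub s l
  low-sub (rightS s) (_ , _ , l) = low-sub s l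

  -- Assigning nested intervals to the bags

  module Assign (t : ℕ) where
    open Nesting t

    private
      κ : ℕ
      κ = K t

    record Assigned {h m} (a b : ℕ) (S : Tree h) (T : Tree m) : Set where
      field
        valid : Valid T
        arced : Arced T
        low   : ∀ W → Low κ W T
        lo≡   : lo T ≡ a
        hi≡   : hi T ≡ b
        bag⊒  : bag S ⊑ bag T
        flat⊑ : flat T ⊑ flat S

    few : ∀ {a b} → cost a b ≤ κ → ∀ W → cnt (λ v → St? a b v ×-dec v ∈? W) ≤ κ
    few {a} {b} le W = ≤-trans (cnt-mono (λ v → St? a b v ×-dec v ∈? W) (St? a b) λ v → proj₁) le

    -- `nest` provides two subtrees in consecutive cheap intervals. Lying in disjoint intervals they
    -- are disjoint, so a `Joint` of them exists and becomes the bag of the node.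
    assign : ∀ m a b (S : Tree (nested-height κ m)) → Valid S → a ≤ b → InsideL a b (flat S) → cost a b ≤ κ →
             Σ (Tree m) (Assigned a b S) ⊎ CycleOutcome t n Cr
    assign zero a b (leaf _ _ E) vS a≤b ins le = inj₁ (leaf a b E , record
      { valid = vS ; arced = a≤b , ins ; low = few le ; lo≡ = refl ; hi≡ = refl ; bag⊒ = id ; flat⊑ = id })
    assign (suc m) a b S vS a≤b ins le with Search.nest (nested-height κ m) S refl vS a≤b ins le
    ... | inj₂ c = inj₂ c
    ... | inj₁ F with Search.Found.has₀ F | Search.Found.has₁ F
    ... | s₀ , p₀ , i₀ | s₁ , p₁ , i₁
      with assign m _ _ s₀ (sub-valid p₀ vS) (Search.Found.a'r F) i₀ (Search.Found.low₀ F)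
         | assign m _ _ s₁ (sub-valid p₁ vS) (Search.Found.rb' F) i₁ (Search.Found.low₁ F)
    ... | inj₂ c | _ = inj₂ c
    ... | _ | inj₂ c = inj₂ c
    ... | inj₁ (T₀ , A₀) | inj₁ (T₁ , A₁) = inj₁ (node a b E T₀ T₁ , record
      { valid = (proj₁ ne , from (proj₂ ne)) , conn , touch-mono id A₀.bag⊒ to₀ , touch-mono id A₁.bag⊒ to₁ ,
          (λ x y → off₀ x (A₀.flat⊑ y)) , (λ x y → off₁ x (A₁.flat⊑ y)) , (λ x y → sep (A₀.flat⊑ x) (A₁.flat⊑
              y)) , A₀.valid , A₁.valid
      ; arced = a≤b , ins ∘ range ,
          (subst (a ≤_) (sym A₀.lo≡) aa' , ≤-reflexive (trans A₀.hi≡ (sym A₁.lo≡)) , subst (_≤ b) (sym A₁.hi≡)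
              b'b) , A₀.arced , A₁.arced
      ; low = λ W → few le W , A₀.low W , A₁.low W
      ; lo≡ = refl ; hi≡ = refl ; bag⊒ = from
      ; flat⊑ = ⊑-++ {E} range (⊑-++ {flat T₀} (sub-flat p₀ ∘ A₀.flat⊑) (sub-flat p₁ ∘ A₁.flat⊑)) })
      where
      open Search.Found F
      module A₀ = Assigned A₀
      module A₁ = Assigned A₁
      sep : Disj (flat s₀) (flat s₁)
      sep x y = inside-¬outside (i₁ y) (inside-apart (inj₁ ≤-refl) (i₀ x))
      open Joint (joint vS p₀ p₁ sep)
      bag-inhabited : ∀ {h} (T : Tree h) → Valid T → ∃ λ x → x ∈ bag T
      bag-inhabited (leaf _ _ _) v = proj₁ v
      bag-inhabited (node _ _ _ _ _) v = proj₁ v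
      ne = bag-inhabited S vS

  -- Making non-consecutive bags anticomplete

  Stab : ∀ {h} → List V → Tree h → Set
  Stab U (leaf a b _) = Σ V λ u → u ∈ U × St a b u
  Stab U (node a b _ l r) = (Σ V λ u → u ∈ U × St a b u) × Stab U l × Stab U r

  trunc : ∀ d {m} → Tree (d + m) → Tree d
  trunc zero T = leaf (lo T) (hi T) (bag T)
  trunc (suc d) (node a b E l r) = node a b E (trunc d l) (trunc d r)

  trunc-flat : ∀ d {m} (T : Tree (d + m)) → flat (trunc d T) ⊑ flat T
  trunc-flat zero T = bag⊑flat T
  trunc-flat (suc d) (node a b E l r) =
    ⊑-++ {E} ∈-++⁺ˡ (⊑-++ {flat (trunc d l)} (flatˡ {a = a} {b} {E} {l} {r} ∘ trunc-flat d l) (flatʳ {a = a}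
        {b} {E} {l} {r} ∘ trunc-flat d r))

  trunc-bag : ∀ d {m} (T : Tree (d + m)) → bag T ⊑ bag (trunc d T)
  trunc-bag zero T p = p
  trunc-bag (suc d) (node _ _ _ _ _) p = p

  trunc-valid : ∀ d {m} (T : Tree (d + m)) → Valid T → Valid (trunc d T)
  trunc-valid zero (leaf _ _ _) v = v
  trunc-valid zero (node _ _ _ _ _) (i , c , _) = i , c
  trunc-valid (suc d) (node a b E l r) (i , c , tl , tr , dl , dr , dlr , vl , vr) =
    i , c , touch-mono id (trunc-bag d l) tl , touch-mono id (trunc-bag d r) tr ,
    (λ x y → dl x (trunc-flat d l y)) , (λ x y → dr x (trunc-flat d r y)) ,
    (λ x y → dlr (trunc-flat d l x) (trunc-flat d r y)) , trunc-valid d l vl , trunc-valid d r vr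

  trunc-lo : ∀ d {m} (T : Tree (d + m)) → lo (trunc d T) ≡ lo T × hi (trunc d T) ≡ hi T
  trunc-lo zero T = refl , refl
  trunc-lo (suc d) (node _ _ _ _ _) = refl , refl

  trunc-arced : ∀ d {m} (T : Tree (d + m)) → Arced T → Arced (trunc d T)
  trunc-arced zero (leaf _ _ _) ar = ar
  trunc-arced zero (node _ _ _ _ _) (p , i , _) = p , i
  trunc-arced (suc d) (node a b E l r) (p , i , q , al , ar)
    rewrite sym (proj₁ (trunc-lo d l)) | sym (proj₂ (trunc-lo d l)) | sym (proj₁ (trunc-lo d r)) | sym (proj₂ (trunc-lo d r)) =
    p , i , q , trunc-arced d l al , trunc-arced d r ar

  trunc-low : ∀ {k W} d {m} (T : Tree (d + m)) → Low k W T → Low k W (trunc d T)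
  trunc-low zero (leaf _ _ _) l = l
  trunc-low zero (node _ _ _ _ _) (l , _) = l
  trunc-low (suc d) (node _ _ _ l r) (p , q , q') = p , trunc-low d l q , trunc-low d r q'

  deep : ∀ d {m} (T : Tree (d + m)) → Σ (Tree m) λ T' → Sub T' T
  deep zero T = T , hereS
  deep (suc d) (node _ _ _ l r) with deep d l
  ... | T' , s = T' , leftS s

  -- If `U` lies outside the interval of some node, it also lies outside every interval below, and
  -- any subtree deep enough will do. Otherwise `U`, being connected and containing `u`, has a
  -- straddler at each of the top `d` levels.
  avoid-or-stab : ∀ d {m} (T : Tree (d + m)) {U u} → Arced T → Conn U → u ∈ U → ¬ Inside (lo T) (hi T) u →
    (Σ (Tree m) λ T' → Sub T' T × OutsideL (lo T') (hi T') U) ⊎ Stab U (trunc d T)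
  avoid-or-stab d T {U} {u} arT c uU ¬i with OutsideL? (lo T) (hi T) U
  ... | yes o with deep d T
  ... | T' , s with arced-sub s arT
  ... | _ , x , y = inj₁ (T' , s , λ p → outside-mono x y (o p))
  avoid-or-stab d T {U} {u} arT c uU ¬i | no ¬o with Finₚ.any? (λ z → z ∈? U ×-dec ¬? (Outside? (lo T) (hi T) z))
  ... | no ¬z = ⊥-elim (¬o λ {x} p → [ id , (λ q → ⊥-elim (¬z (x , p , q))) ]′ (dec x))
    where
    dec : ∀ x → Outside (lo T) (hi T) x ⊎ ¬ Outside (lo T) (hi T) x
    dec x with Outside? (lo T) (hi T) x
    ... | yes o = inj₁ o
    ... | no ¬o = inj₂ ¬o
  avoid-or-stab zero T arT c uU ¬i | no ¬o | yes (z , zU , ¬oz) = inj₂ (straddler c zU uU ¬oz ¬i)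
  avoid-or-stab (suc d) T@(node a b E l r) arT@(_ , _ , _ , al , ar) c uU ¬i | no ¬o | yes (z , zU , ¬oz)
    with avoid-or-stab d l al c uU (λ i → ¬i (let (_ , x , y) = arced-sub (leftS {a = a} {b} {E} {l} {r} hereS) arT in inside-mono x y i))
       | avoid-or-stab d r ar c uU (λ i → ¬i (let (_ , x , y) = arced-sub (rightS {a = a} {b} {E} {l} {r} hereS) arT in inside-mono x y i))
  ... | inj₁ (T' , s , o) | _ = inj₁ (T' , leftS s , o)
  ... | inj₂ _ | inj₁ (T' , s , o) = inj₁ (T' , rightS s , o)
  ... | inj₂ sl | inj₂ sr = inj₂ (straddler c zU uU ¬oz ¬i , sl , sr)

  -- At every node, the straddler in `U` is counted for `W` but not for `W'`.
  stab-low : ∀ {k W W' U h} (T : Tree h) → W' ⊑ W → U ⊑ W → Disj U W' → Stab U T → Low (suc k) W T → Low k W' T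
  stab-low {k} {W} {W'} {U} (leaf a b _) s s' dj (u , uU , st) le =
    ≤-pred (≤-trans (cnt-strict (λ v → St? a b v ×-dec v ∈? W') (λ v → St? a b v ×-dec v ∈? W) (λ v (p , q) → p , s q)
                       u (st , s' uU) λ (_ , q) → dj uU q) le)
  stab-low {k} {W} {W'} {U} (node a b _ l r) s s' dj ((u , uU , st) , sl , sr) (le , ll , lr) =
    ≤-pred (≤-trans (cnt-strict (λ v → St? a b v ×-dec v ∈? W') (λ v → St? a b v ×-dec v ∈? W) (λ v (p , q) → p , s q)
                       u (st , s' uU) λ (_ , q) → dj uU q) le) ,
    stab-low l s s' dj sl ll , stab-low r s s' dj sr lr

  IM : ℕ → Set
  IM h = Σ (Tree h) λ M → Valid M × Induced M

  touch-¬outside : ∀ {a b u v} → Inside a b v → Cr u v → ¬ Outside a b u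
  touch-¬outside i cr o = inside-outside-anti i o (Cr-sym cr)

  touch-¬inside : ∀ {a b c d u v} → b ≤ c ⊎ d ≤ a → Inside c d v → Cr u v → ¬ Inside a b u
  touch-¬inside s iv cr iu = inside-outside-anti iv (inside-apart s iu) (Cr-sym cr)

  -- `U` stands for the bag above: it may see the root bag of `M`, which contains that of `A`, but
  -- nothing below.
  record Sparse {j h} (U : List V) (A : Tree h) (M : Tree j) : Set where
    field
      valid   : Valid M
      induced : Induced M
      bag⊒    : bag A ⊑ bag M
      flat⊑   : flat M ⊑ flat A
      anti    : Anti U (lower M)

  module Sparsify (k h : ℕ) (ih : ∀ (T : Tree (induced-height k h)) → Valid T → Arced T → Low k (flat T) T → IM
      h) (W : List V) where
    d : ℕ
    d = induced-height k h

    -- Either `U` stabs the top `d` levels under a child, where `ih` restarts with one straddler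
    -- less, or `U` avoids an interval under each child. In the latter case the joint `E'` of the
    -- two avoided subtrees becomes the next bag above: touching both, it is contained in neither
    -- interval, as the recursion requires.
    sparsify : ∀ j (A : Tree (sparse-height d j)) → Valid A → Arced A → Low (suc k) W A → flat A ⊑ W →
      ∀ U → Conn U → U ⊑ W → Disj U (flat A) → (Σ V λ u → u ∈ U × ¬ Inside (lo A) (hi A) u) → IM h ⊎ Σ (Tree j) (Sparse U A)
    sparsify zero A@(leaf _ _ _) vA arA low sub U c sU dj u =
      inj₂ (A , record { valid = vA ; induced = tt ; bag⊒ = id ; flat⊑ = id ; anti = λ _ () })
    sparsify (suc j) A@(node a b E l r) vA@(ne , cE , tl , tr , dl , dr , dlr , vl , vr) arA@(_ , _ , (_ , lr ,
        _) , al , ar) (_ , ll , lr') sub U c sU dj (u , uU , ¬i)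
      with avoid-or-stab d l al c uU (λ i → ¬i (let (_ , x , y) = arced-sub (leftS {a = a} {b} {E} {l} {r} hereS) arA in inside-mono x y i))
         | avoid-or-stab d r ar c uU (λ i → ¬i (let (_ , x , y) = arced-sub (rightS {a = a} {b} {E} {l} {r} hereS) arA in inside-mono x y i))
    ... | inj₂ st | _ = inj₁ (ih (trunc d l) (trunc-valid d l vl) (trunc-arced d l al)
            (stab-low (trunc d l) (sub ∘ flatˡ {a = a} {b} {E} {l} {r} ∘ trunc-flat d l) sU
              (λ x y → dj x (flatˡ {a = a} {b} {E} {l} {r} (trunc-flat d l y))) st (trunc-low d l ll)))
    ... | inj₁ _ | inj₂ st = inj₁ (ih (trunc d r) (trunc-valid d r vr) (trunc-arced d r ar)
            (stab-low (trunc d r) (sub ∘ flatʳ {a = a} {b} {E} {l} {r} ∘ trunc-flat d r) sU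
              (λ x y → dj x (flatʳ {a = a} {b} {E} {l} {r} (trunc-flat d r y))) st (trunc-low d r lr')))
    ... | inj₁ (A₀ , s₀ , o₀) | inj₁ (A₁ , s₁ , o₁) = finish rec₀ rec₁
      where
      J = joint-apart {a = a} {b} {E} vA s₀ s₁
      open Joint J renaming (E to E'; range to range')
      ar₀ = arced-sub s₀ al
      ar₁ = arced-sub s₁ ar
      apart : hi A₀ ≤ lo A₁
      apart = ≤-trans (proj₂ (proj₂ ar₀)) (≤-trans lr (proj₁ (proj₂ ar₁)))
      flat₀ : flat A₀ ⊑ flat A
      flat₀ = flatˡ {a = a} {b} {E} {l} {r} ∘ sub-flat s₀
      flat₁ : flat A₁ ⊑ flat A
      flat₁ = flatʳ {a = a} {b} {E} {l} {r} ∘ sub-flat s₁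
      ins₀ : InsideL (lo A₀) (hi A₀) (flat A₀)
      ins₀ = arced-flat A₀ (proj₁ ar₀)
      ins₁ : InsideL (lo A₁) (hi A₁) (flat A₁)
      ins₁ = arced-flat A₁ (proj₁ ar₁)
      out₀ : Σ V λ u → u ∈ E' × ¬ Inside (lo A₀) (hi A₀) u
      out₀ = let (x , y , x∈ , y∈ , cr) = to₁ in x , x∈ , touch-¬inside (inj₁ apart) (ins₁ (bag⊑flat A₁ y∈)) cr
      out₁ : Σ V λ u → u ∈ E' × ¬ Inside (lo A₁) (hi A₁) u
      out₁ = let (x , y , x∈ , y∈ , cr) = to₀ in x , x∈ , touch-¬inside (inj₂ apart) (ins₀ (bag⊑flat A₀ y∈)) cr
      rec₀ = sparsify j A₀ (sub-valid s₀ vl) (proj₁ ar₀) (low-sub s₀ ll) (sub ∘ flat₀) E' conn (sub ∘ range') off₀ out₀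
      rec₁ = sparsify j A₁ (sub-valid s₁ vr) (proj₁ ar₁) (low-sub s₁ lr') (sub ∘ flat₁) E' conn (sub ∘ range') off₁ out₁
      finish : IM h ⊎ Σ (Tree j) (Sparse E' A₀) → IM h ⊎ Σ (Tree j) (Sparse E' A₁) → IM h ⊎ Σ (Tree (suc j)) (Sparse U A)
      finish (inj₁ x) _ = inj₁ x
      finish (inj₂ _) (inj₁ x) = inj₁ x
      finish (inj₂ (M₀ , S₀)) (inj₂ (M₁ , S₁)) = inj₂ (node a b E' M₀ M₁ , record
        { valid = (proj₁ ne , from (proj₂ ne)) , conn , touch-mono id P₀.bag⊒ to₀ , touch-mono id P₁.bag⊒ to₁ ,
            (λ x y → off₀ x (P₀.flat⊑ y)) , (λ x y → off₁ x (P₁.flat⊑ y)) ,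
            (λ x y → dlr (sub-flat s₀ (P₀.flat⊑ x)) (sub-flat s₁ (P₁.flat⊑ y))) , P₀.valid , P₁.valid
        ; induced = P₀.anti , P₁.anti ,
            (λ x y → inside-outside-anti (ins₀ (P₀.flat⊑ x)) (inside-apart (inj₂ apart) (ins₁ (P₁.flat⊑ y)))) ,
                P₀.induced , P₁.induced
        ; bag⊒ = from
        ; flat⊑ = ⊑-++ {E'} range' (⊑-++ {flat M₀} (flat₀ ∘ P₀.flat⊑) (flat₁ ∘ P₁.flat⊑))
        ; anti = λ x y → [ (λ p cr → inside-outside-anti (ins₀ (P₀.flat⊑ p)) (o₀ x) (Cr-sym cr)) ,
                           (λ p cr → inside-outside-anti (ins₁ (P₁.flat⊑ p)) (o₁ x) (Cr-sym cr)) ]′ (∈-++⁻ (flat M₀) y) })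
        where
        module P₀ = Sparse S₀
        module P₁ = Sparse S₁

  -- The root bag touches both children, so it contains a straddler of the interval of the left one.
  -- For `k = 0` this is a contradiction; for larger `k` the root bag starts `sparsify` as `U`.
  induced-minor : ∀ k h (T : Tree (induced-height k h)) → Valid T → Arced T → Low k (flat T) T → IM h
  induced-minor k h T vT arT low = go k T vT arT low
    where
    ¬in-left : ∀ {m a b E} {l r : Tree m} → Valid (node a b E l r) → Arced (node a b E l r) → Σ V λ u → u ∈ E ×
        ¬ Inside (lo l) (hi l) u
    ¬in-left {l = l} {r} (_ , _ , _ , (x , y , xE , yr , cr) , _) (_ , _ , (_ , lr , _) , _ , ar) =
      x , xE , touch-¬inside (inj₁ lr) (arced-flat r ar (bag⊑flat r yr)) cr
    go : ∀ k (T : Tree (induced-height k h)) → Valid T → Arced T → Low k (flat T) T → IM h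
    go zero T@(node a b E l r) vT@(_ , cE , (x , y , xE , yl , cr) , _ , _ , _ , _ , _ , _) arT@(_ , _ , _ , al
        , _) (_ , low , _) with ¬in-left {a = a} {b} {E} {l} {r} vT arT
    ... | u , uE , ¬i with straddler cE xE uE (touch-¬outside (arced-flat l al (bag⊑flat l yl)) cr) ¬i
    ... | z , zE , st = ⊥-elim (<-irrefl refl (<-≤-trans (cnt-some (λ v → St? (lo l) (hi l) v ×-dec v ∈? flat
          T) (z , st , ∈-++⁺ˡ zE)) (low-top l low)))
      where
      low-top : ∀ {m k W} (T : Tree m) → Low k W T → cnt (λ v → St? (lo T) (hi T) v ×-dec v ∈? W) ≤ k
      low-top (leaf _ _ _) l = l
      low-top (node _ _ _ _ _) (l , _) = l
    go (suc k) T@(node a b E l r) vT@(_ , cE , _ , _ , dl , _ , _ , vl , _) arT@(_ , _ , _ , al , _) (_ , ll , _)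
      with Sparsify.sparsify k h (go k) (flat T) h l vl al ll (flatˡ {a = a} {b} {E} {l} {r}) E cE ∈-++⁺ˡ dl
          (¬in-left {a = a} {b} {E} {l} {r} vT arT)
    ... | inj₁ im = im
    ... | inj₂ (M , S) = M , Sparse.valid S , Sparse.induced S

-- Induced trees

-- Each branching consumes three levels of bags: one to arrive in, one to branch in, and one to keep
-- the branching away from the subtrees that follow.
triple : ℕ → ℕ
triple zero = 0
triple (suc k) = suc (suc (suc (triple k)))

module VertexTrees {n : ℕ} (𝒢 : SimpleGraph n) where
  open Bags 𝒢

  -- Induced trees, one vertex per constructor.  In ufork the flag tells
  -- whether the tops of the two branches are adjacent (a triangle) or not.
  data UT : Set where
    uend  : V → UT
    uone  : V → UT → UT
    ufork : Bool → V → UT → UT → UT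

  top : UT → V
  top (uend x) = x
  top (uone x _) = x
  top (ufork _ x _ _) = x

  verts : UT → List V
  verts (uend x) = x ∷ []
  verts (uone x T) = x ∷ verts T
  verts (ufork _ x l r) = x ∷ verts l ++ verts r

  Only : V → UT → Set
  Only x T = x ∉ verts T × Adj x (top T) × (∀ {z} → z ∈ verts T → Adj x z → z ≡ top T)

  Sib : Bool → UT → UT → Set
  Sib false l r = Disj (verts l) (verts r) × Anti (verts l) (verts r)
  Sib true l r = Disj (verts l) (verts r) × Adj (top l) (top r) ×
    (∀ {y z} → y ∈ verts l → z ∈ verts r → Adj y z → y ≡ top l × z ≡ top r)

  OK : UT → Set
  OK (uend x) = ⊤
  OK (uone x T) = Only x T × OK T
  OK (ufork f x l r) = Only x l × Only x r × Sib f l r × OK l × OK r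

  Branch : ℕ → UT → Set
  Branch zero T = ⊤
  Branch (suc k) (uend x) = ⊥
  Branch (suc k) (uone x T) = Branch (suc k) T
  Branch (suc k) (ufork f x l r) = Branch k l × Branch k r

  chain : List V → UT → UT
  chain [] T = T
  chain (x ∷ W) T = uone x (chain W T)

  branch-chain : ∀ k W {T} → Branch k T → Branch k (chain W T)
  branch-chain zero W b = tt
  branch-chain (suc k) [] b = b
  branch-chain (suc k) (x ∷ W) b = branch-chain (suc k) W b

  ∈-chain⁻ : ∀ W {T z} → z ∈ verts (chain W T) → z ∈ W ⊎ z ∈ verts T
  ∈-chain⁻ [] p = inj₂ p
  ∈-chain⁻ (x ∷ W) (here e) = inj₁ (here e)
  ∈-chain⁻ (x ∷ W) (there p) = [ inj₁ ∘ there , inj₂ ]′ (∈-chain⁻ W p)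

  module Attach (L : UT) (q : V) (R : UT) (okR : OK (uone q R)) where

    Cross : List V → Set
    Cross W = (∀ {y z} → y ∈ verts (chain W L) → z ∈ verts (uone q R) → Adj y z → z ≡ q × y ∈ W)
            × Disj (verts (chain W L)) (verts (uone q R))

    Adjacent : List V → Set
    Adjacent W = Σ V λ w → w ∈ W × Adj q w

    adjacent? : ∀ W → Dec (Adjacent W)
    adjacent? W = Finₚ.any? (λ w → w ∈? W ×-dec Adj? q w)

    cross-tail : ∀ {x W} → OK (chain (x ∷ W) L) → Cross (x ∷ W) → Cross W
    cross-tail {x} {W} (o , _) (c , d) = (λ y∈ z∈ a → tail y∈ (c (there y∈) z∈ a)) , λ y∈ z∈ → d (there y∈) z∈
      where
      tail : ∀ {y z} → y ∈ verts (chain W L) → z ≡ q × y ∈ x ∷ W → z ≡ q × y ∈ W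
      tail y∈ (e , here refl) = ⊥-elim (proj₁ o y∈)
      tail y∈ (e , there p) = e , p

    record Attached (W : List V) : Set where
      field
        T      : UT
        ok     : OK T
        top≡   : top T ≡ top (chain W L)
        range  : verts T ⊑ verts (chain W L) ++ verts (uone q R)
        branch : ∀ {k} → Branch k L → Branch k R → Branch (suc k) T

    last-adjacent : ∀ W → OK (chain W L) → Cross W → Adjacent W →
      Σ V λ z → Σ (List V) λ rest → OK (chain (z ∷ rest) L) × Cross (z ∷ rest) × Adj q z × ¬ Adjacent rest ×
        verts (chain (z ∷ rest) L) ⊑ verts (chain W L)
    last-adjacent (x ∷ W) ok cr adj with adjacent? W
    ... | yes a with last-adjacent W (proj₂ ok) (cross-tail {x} {W} ok cr) a
    ... | z , rest , ok' , cr' , az , na , sub = z , rest , ok' , cr' , az , na , there ∘ sub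
    last-adjacent (x ∷ W) ok cr (w , here refl , a) | no na = x , W , ok , cr , a , na , id
    last-adjacent (x ∷ W) ok cr (w , there p , a) | no na = ⊥-elim (na (w , p , a))

    -- Let `x` be the first neighbour of `q` on the path, the vertices before it being kept. With no
    -- other neighbour, `x` is the centre of a claw; if its successor is the only other one, there
    -- is a triangle; otherwise the path is cut out between `x` and the last neighbour of `q`, and
    -- `q` becomes the centre of a claw. In each case the top vertex is preserved.
    attach : ∀ x W → OK (chain (x ∷ W) L) → Cross (x ∷ W) → Adjacent (x ∷ W) → Attached (x ∷ W)
    attach x W ok@((x∉ , ax , onlyx) , okW) cr@(c , d) adj with Adj? q x
    attach x [] ok cr (w , here refl , a) | no ¬a = ⊥-elim (¬a a)
    attach x (y ∷ W) ok@((x∉ , ax , onlyx) , okW) cr@(c , d) (w , p , a) | no ¬a = record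
      { T = uone x A.T
      ; ok = ((λ p → [ x∉ , d (here refl) ]′ (∈-++⁻ (verts (chain (y ∷ W) L)) (A.range p))) ,
              subst (Adj x) (sym A.top≡) ax ,
              (λ p a → trans ([ (λ p → onlyx p a) , (λ p → ⊥-elim (¬a (symA (subst (Adj x) (proj₁ (c (here refl) p a)) a)))) ]′
                        (∈-++⁻ (verts (chain (y ∷ W) L)) (A.range p))) (sym A.top≡))) , A.ok
      ; top≡ = refl
      ; range = λ { (here e) → here e ; (there p) → there (A.range p) }
      ; branch = A.branch }
      where
      adj' : w ∈ x ∷ y ∷ W → Adjacent (y ∷ W)
      adj' (here refl) = ⊥-elim (¬a a)
      adj' (there p) = w , p , a
      module A = Attached (attach y W okW (cross-tail {x} {y ∷ W} ok cr) (adj' p))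
    attach x W ok@((x∉ , ax , onlyx) , okW) cr@(c , d) adj | yes a with adjacent? W
    ... | no na = record
      { T = ufork false x (chain W L) (uone q R)
      ; ok = (x∉ , ax , onlyx) , (d (here refl) , symA a , λ p a → proj₁ (c (here refl) p a)) ,
             ((λ p p' → d (there p) p') , (λ {y} y∈ z∈ a' → na (y , proj₂ (c' y∈ z∈ a') , subst (λ z → Adj z y)
                 (proj₁ (c' y∈ z∈ a')) (symA a')))) , okW , okR
      ; top≡ = refl
      ; range = λ { (here e) → here e ; (there p) → there p }
      ; branch = λ {k} bL bR → branch-chain k W bL , branch-chain k (q ∷ []) bR }
      where c' = proj₁ (cross-tail {x} {W} ok cr)
    attach x (y ∷ W) ok@((x∉ , ax , onlyx) , okW@((y∉ , ay , onlyy) , okW')) cr@(c , d) adj | yes a | yes adj' with adjacent? W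
    ... | no na = record
      { T = ufork true x (chain (y ∷ W) L) (uone q R)
      ; ok = (x∉ , ax , onlyx) , (d (here refl) , symA a , λ p a → proj₁ (c (here refl) p a)) ,
             ((λ p p' → d (there p) p') , symA (qy adj') , λ y∈ z∈ a' → ty y∈ z∈ a' , proj₁ (c' y∈ z∈ a')) , okW , okR
      ; top≡ = refl
      ; range = λ { (here e) → here e ; (there p) → there p }
      ; branch = λ {k} bL bR → branch-chain k (y ∷ W) bL , branch-chain k (q ∷ []) bR }
      where
      c' = proj₁ (cross-tail {x} {y ∷ W} ok cr)
      qy : Adjacent (y ∷ W) → Adj q y
      qy (w , here refl , a) = a
      qy (w , there p , a) = ⊥-elim (na (w , p , a))
      ty : ∀ {u z} → u ∈ verts (chain (y ∷ W) L) → z ∈ verts (uone q R) → Adj u z → u ≡ y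
      ty {u} u∈ z∈ a' with c' u∈ z∈ a'
      ... | refl , here e = e
      ... | refl , there p = ⊥-elim (na (u , p , symA a'))
    -- The last neighbour `z` comes after `y`, the only vertex below `x` that `x` sees, so bypassing
    -- `y` leaves no edge from `x` to `z`.
    ... | yes adj'' with last-adjacent W okW' (cross-tail {y} {W} okW (cross-tail {x} {y ∷ W} ok cr)) adj''
    ... | z , rest , okz , (cz , dz) , az , na , sub = record
      { T = uone x (ufork false q C R)
      ; ok = (x∉' , symA a , only') ,
             ((λ p → dz p (here refl)) , az , onlyq) , proj₁ okR ,
             ((λ p p' → dz p (there p')) , (λ p p' a' → proj₁ (proj₁ okR) (subst (_∈ verts R) (proj₁ (cz p
                 (there p') a')) p'))) , okz , proj₂ okR
      ; top≡ = refl
      ; range = λ { (here e) → here e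
                  ; (there (here e)) → ∈-++⁺ʳ (verts (chain (x ∷ y ∷ W) L)) (here e)
                  ; (there (there p)) → [ ∈-++⁺ˡ ∘ there ∘ there ∘ sub , ∈-++⁺ʳ (verts (chain (x ∷ y ∷ W) L)) ∘
                      there ]′ (∈-++⁻ (verts C) p) }
      ; branch = λ {k} bL bR → branch-chain k (z ∷ rest) bL , bR }
      where
      C = chain (z ∷ rest) L
      onlyq : ∀ {u} → u ∈ verts C → Adj q u → u ≡ z
      onlyq {u} u∈ a' with cz u∈ (here refl) (symA a')
      ... | _ , here e = e
      ... | _ , there p = ⊥-elim (na (u , p , a'))
      x∉' : x ∉ verts (ufork false q C R)
      x∉' (here e) = d (here refl) (here e)
      x∉' (there p) = [ x∉ ∘ there ∘ sub , d (here refl) ∘ there ]′ (∈-++⁻ (verts C) p)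
      only' : ∀ {u} → u ∈ verts (ufork false q C R) → Adj x u → u ≡ q
      only' (here e) a' = e
      only' (there p) a' with ∈-++⁻ (verts C) p
      ... | inj₂ r = proj₁ (c (here refl) (there r) a')
      ... | inj₁ r = ⊥-elim (y∉ (subst (_∈ verts (chain W L)) (onlyx (there (sub r)) a') (sub r)))

  -- Induced paths that have only their last vertex in the target, so that a tree hung on at the end
  -- is seen by no other vertex of the path.
  data IPath (Tg : V → Set) : List V → Set where
    last : ∀ {x} → Tg x → IPath Tg (x ∷ [])
    cons : ∀ {x y W} → ¬ Tg x → Adj x y → x ∉ y ∷ W → (∀ {z} → z ∈ W → ¬ Adj x z) → IPath Tg (y ∷ W) → IPath Tg (x ∷ y ∷ W)

  module _ {Tg : V → Set} (Tg? : ∀ v → Dec (Tg v)) where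

    -- Taking the last vertex with `Z` serves to cut loops out of walks, to shorten them to induced
    -- paths, and to leave a given vertex a single neighbour on a path.
    drop-to : ∀ {Z : V → Set} (Z? : ∀ v → Dec (Z v)) {W} → IPath Tg W → (Σ V λ w → w ∈ W × Z w) →
      Σ V λ y → Σ (List V) λ W' → IPath Tg (y ∷ W') × Z y × (∀ {z} → z ∈ W' → ¬ Z z) × y ∷ W' ⊑ W
    drop-to Z? (last t) (w , here refl , zw) = w , [] , last t , zw , (λ ()) , id
    drop-to Z? {W = x ∷ y ∷ W} P@(cons nt a x∉ na P') (w , p , zw) with Finₚ.any? (λ v → v ∈? (y ∷ W) ×-dec Z? v)
    ... | yes e with drop-to Z? P' e
    ... | y' , W' , P'' , zy , nz , sub = y' , W' , P'' , zy , nz , there ∘ sub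
    drop-to Z? {W = x ∷ y ∷ W} P (w , here refl , zw) | no ne = x , y ∷ W , P , zw , (λ p z → ne (_ , p , z)) , id
    drop-to Z? {W = x ∷ y ∷ W} P (w , there p , zw) | no ne = ⊥-elim (ne (w , p , zw))

    from-walk : ∀ {E x y} → Walk E x y → Tg y → Σ (List V) λ W → IPath Tg (x ∷ W) × x ∷ W ⊑ E
    from-walk (stay p) t = [] , last t , λ { (here refl) → p }
    from-walk {x = x} (step {y = y} p a w) t with Tg? x
    ... | yes tx = [] , last tx , λ { (here refl) → p }
    ... | no ¬tx with from-walk w t
    ... | W , P , sub with x ∈? (y ∷ W)
    ... | yes x∈ with drop-to (λ v → v Finₚ.≟ x) P (x , x∈ , refl)
    ... | _ , W' , P' , refl , _ , sub' = W' , P' , sub ∘ sub'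
    from-walk {x = x} (step {y = y} p a w) t | no ¬tx | W , P , sub | no x∉ with drop-to (Adj? x) P (y , here refl , a)
    ... | y' , W' , P' , ay , na , sub' = y' ∷ W' , cons ¬tx ay (x∉ ∘ sub') na P' ,
          λ { (here refl) → p ; (there q) → sub (sub' q) }

    rooted : ∀ {E r} → Conn E → (Σ V λ e → e ∈ E × Adj r e) → (Σ V λ e → e ∈ E × Tg e) →
      Σ V λ y → Σ (List V) λ W → IPath Tg (y ∷ W) × y ∷ W ⊑ E × Adj r y × (∀ {z} → z ∈ W → ¬ Adj r z)
    rooted {r = r} c (e , e∈ , a) (t , t∈ , tt') with from-walk (c e∈ t∈) tt'
    ... | W , P , sub with drop-to (Adj? r) P (e , here refl , a)
    ... | y , W' , P' , ay , na , sub' = y , W' , P' , sub ∘ sub' , ay , na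

  open Subtrees 𝒢
  open InducedMinor 𝒢

  Near : List V → V → Set
  Near E x = Σ V λ y → y ∈ E × Adj x y

  near? : ∀ E x → Dec (Near E x)
  near? E x = Finₚ.any? (λ y → y ∈? E ×-dec Adj? x y)

  flat-cases : ∀ {h} (M : Tree h) {z} → z ∈ flat M → z ∈ bag M ⊎ z ∈ lower M
  flat-cases (leaf _ _ E) p = inj₁ p
  flat-cases (node _ _ E l r) p = ∈-++⁻ E p

  lower⊑flat : ∀ {h} (M : Tree h) → lower M ⊑ flat M
  lower⊑flat (leaf _ _ E) ()
  lower⊑flat (node _ _ E l r) p = ∈-++⁺ʳ E p

  record Grown (k : ℕ) {h} (M : Tree h) (r : V) : Set where
    field
      T      : UT
      ok     : OK T
      only   : Only r T
      branch : Branch k T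
      range  : verts T ⊑ flat M

  record Hung (k : ℕ) {h} (N : Tree h) (W : List V) : Set where
    field
      L      : UT
      ok     : OK (chain W L)
      branch : Branch k L
      range  : verts L ⊑ flat N

  hang : ∀ {k h} {N : Tree h} {F W} → Disj F (flat N) → Anti F (lower N) → W ⊑ F →
    (∀ {x} → x ∈ F → Near (bag N) x → Grown k N x) → IPath (Near (bag N)) W → Hung k N W
  hang {N = N} dj an sub rec (last t) = record { L = T ; ok = only , ok ; branch = branch ; range = range }
    where open Grown (rec (sub (here refl)) t)
  hang {N = N} {F} {x ∷ y ∷ W} dj an sub rec (cons nt a x∉ na P) = record
    { L = L ; ok = (x∉' , a , only) , ok ; branch = branch ; range = range }
    where
    open Hung (hang dj an (sub ∘ there) rec P)
    xF : x ∈ F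
    xF = sub (here refl)
    x∉' : x ∉ verts (chain (y ∷ W) L)
    x∉' p = [ x∉ , dj xF ∘ range ]′ (∈-chain⁻ (y ∷ W) p)
    only : ∀ {z} → z ∈ verts (chain (y ∷ W) L) → Adj x z → z ≡ y
    only p a' with ∈-chain⁻ (y ∷ W) p
    ... | inj₁ (here e) = e
    ... | inj₁ (there q) = ⊥-elim (na q a')
    ... | inj₂ q = ⊥-elim ([ (λ b → nt (_ , b , a')) , (λ b → an xF b a') ]′ (flat-cases N (range q)))

  anti-++ : ∀ {A B C : List V} → Anti A C → Anti B C → Anti (A ++ B) C
  anti-++ {A} f g p q = [ (λ p → f p q) , (λ p → g p q) ]′ (∈-++⁻ A p)

  -- The four bags at the top of an induced minor: Ev with child Ew, whose
  -- children E₁ and E₂ carry the subtrees N₁ and N₂ in which the branches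
  -- continue.
  module Gadget (k : ℕ) {h : ℕ} (N₁ N₂ : Tree h) (Ev Ew E₁ E₂ P₁ P₂ : List V)
    (E₁P : E₁ ⊑ P₁) (N₁P : flat N₁ ⊑ P₁) (E₂P : E₂ ⊑ P₂) (N₂P : flat N₂ ⊑ P₂)
    (cw : Conn Ew) (c₁ : Conn E₁) (c₂ : Conn E₂) (tw₁ : Touch Ew E₁) (tw₂ : Touch Ew E₂)
    (t₁ : Touch E₁ (bag N₁)) (t₂ : Touch E₂ (bag N₂))
    (dv : Disj Ev (Ew ++ P₁ ++ P₂)) (dw₁ : Disj Ew P₁) (dw₂ : Disj Ew P₂) (d₁₂ : Disj P₁ P₂)
    (d₁ : Disj E₁ (flat N₁)) (d₂ : Disj E₂ (flat N₂))
    (av : Anti Ev (P₁ ++ P₂)) (aw₁ : Anti Ew (flat N₁)) (aw₂ : Anti Ew (flat N₂)) (a₁₂ : Anti P₁ P₂)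
    (a₁ : Anti E₁ (lower N₁)) (a₂ : Anti E₂ (lower N₂))
    (grow₁ : ∀ x → x ∉ flat N₁ → Near (bag N₁) x → (∀ {z} → z ∈ lower N₁ → ¬ Adj x z) → Grown k N₁ x)
    (grow₂ : ∀ x → x ∉ flat N₂ → Near (bag N₂) x → (∀ {z} → z ∈ lower N₂ → ¬ Adj x z) → Grown k N₂ x) where

    Fw F₁ F₂ : List V
    Fw = Ew ++ P₁ ++ P₂
    F₁ = Ew ++ E₁
    F₂ = Ew ++ E₂

    P₁w : P₁ ⊑ Fw
    P₁w = ∈-++⁺ʳ Ew ∘ ∈-++⁺ˡ
    P₂w : P₂ ⊑ Fw
    P₂w = ∈-++⁺ʳ Ew ∘ ∈-++⁺ʳ P₁
    cF₁ : Conn F₁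
    cF₁ = conn-touch cw c₁ tw₁
    cF₂ : Conn F₂
    cF₂ = conn-touch cw c₂ tw₂
    F₁w : F₁ ⊑ Fw
    F₁w = ⊑-++ {Ew} ∈-++⁺ˡ (P₁w ∘ E₁P)
    F₂w : F₂ ⊑ Fw
    F₂w = ⊑-++ {Ew} ∈-++⁺ˡ (P₂w ∘ E₂P)
    dF₁ : Disj F₁ (flat N₁)
    dF₁ = disj-++ˡ (λ p q → dw₁ p (N₁P q)) d₁
    dF₂ : Disj F₂ (flat N₂)
    dF₂ = disj-++ˡ (λ p q → dw₂ p (N₂P q)) d₂
    dF₁-N₂ : Disj F₁ (flat N₂)
    dF₁-N₂ = disj-++ˡ (λ p q → dw₂ p (N₂P q)) (λ p q → d₁₂ (E₁P p) (N₂P q))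
    dF₂-N₁ : Disj F₂ (flat N₁)
    dF₂-N₁ = disj-++ˡ (λ p q → dw₁ p (N₁P q)) (λ p q → d₁₂ (N₁P q) (E₂P p))
    aF₁ : Anti F₁ (lower N₁)
    aF₁ = anti-++ {Ew} (λ p q → aw₁ p (lower⊑flat N₁ q)) a₁
    aF₂ : Anti F₂ (lower N₂)
    aF₂ = anti-++ {Ew} (λ p q → aw₂ p (lower⊑flat N₂ q)) a₂
    aF₁-N₂ : Anti F₁ (flat N₂)
    aF₁-N₂ = anti-++ {Ew} aw₂ (λ p q → a₁₂ (E₁P p) (N₂P q))
    aF₂-N₁ : Anti F₂ (flat N₁)
    aF₂-N₁ = anti-++ {Ew} aw₁ (λ p q a → a₁₂ (N₁P q) (E₂P p) (symA a))

    in-Ew : ∀ {x} → x ∈ F₁ → x ∈ F₂ → x ∈ Ew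
    in-Ew p₁ p₂ with ∈-++⁻ Ew p₁ | ∈-++⁻ Ew p₂
    ... | inj₁ p | _ = p
    ... | inj₂ _ | inj₁ p = p
    ... | inj₂ p | inj₂ p' = ⊥-elim (d₁₂ (E₁P p) (E₂P p'))

    record Below (x₀ : V) (W : List V) : Set where
      field
        T      : UT
        ok     : OK T
        top≡   : top T ≡ x₀
        branch : Branch (suc k) T
        range  : ∀ {z} → z ∈ verts T → z ∈ x₀ ∷ W ⊎ z ∈ Fw

    module Tripod (r : V) (r∈ : r ∈ Ev) (y : V) (W : List V) (sub : y ∷ W ⊑ F₂) (ay : Adj r y) (nay : ∀ {z} → z ∈ W → ¬ Adj r z)
      (H₂ : Hung k N₂ (y ∷ W)) (q : V) (Q : List V) (QF : q ∷ Q ⊑ F₁) (H₁ : Hung k N₁ (q ∷ Q))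
      (PQ : IPath (Near (bag N₁)) (q ∷ Q)) (Zq : q ∈ y ∷ W ⊎ Near (r ∷ y ∷ W) q)
      (nZ : ∀ {z} → z ∈ Q → ¬ (z ∈ y ∷ W ⊎ Near (r ∷ y ∷ W) z)) where
      module H₁ = Hung H₁
      module H₂ = Hung H₂

      Ws : List V
      Ws = y ∷ W
      L R : UT
      L = H₂.L
      R = chain Q H₁.L

      -- The two paths can meet only in `Ew`, which sees nothing of `N₁`. So the second path cannot
      -- end at a common vertex `q`, and its next vertex would be adjacent to the first path,
      -- against the choice of `q` as the last contact.
      q∉Ws : q ∉ Ws
      q∉Ws q∈ = bad PQ nZ
        where
        bad : ∀ {Q} → IPath (Near (bag N₁)) (q ∷ Q) → (∀ {z} → z ∈ Q → ¬ (z ∈ Ws ⊎ Near (r ∷ Ws) z)) → ⊥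
        bad (last (z , z∈ , a)) nZ = aw₁ (in-Ew (QF (here refl)) (sub q∈)) (bag⊑flat N₁ z∈) a
        bad (cons _ a _ _ _) nZ = nZ (here refl) (inj₂ (q , there q∈ , symA a))

      r∉ : r ∉ verts (chain Ws L)
      r∉ p = dv r∈ ([ F₂w ∘ sub , P₂w ∘ N₂P ∘ H₂.range ]′ (∈-chain⁻ Ws p))

      only-r : ∀ {z} → z ∈ verts (chain Ws L) → Adj r z → z ≡ y
      only-r p a with ∈-chain⁻ Ws p
      ... | inj₁ (here e) = e
      ... | inj₁ (there p') = ⊥-elim (nay p' a)
      ... | inj₂ p' = ⊥-elim (av r∈ (∈-++⁺ʳ P₁ (N₂P (H₂.range p'))) a)

      where-left : ∀ {z} → z ∈ verts (chain (r ∷ Ws) L) → z ∈ r ∷ Ws ⊎ z ∈ flat N₂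
      where-left p = [ inj₁ , inj₂ ∘ H₂.range ]′ (∈-chain⁻ (r ∷ Ws) p)
      where-right : ∀ {z} → z ∈ verts (uone q R) → z ≡ q ⊎ z ∈ Q ⊎ z ∈ flat N₁
      where-right (here e) = inj₁ e
      where-right (there p) = inj₂ ([ inj₁ , inj₂ ∘ H₁.range ]′ (∈-chain⁻ Q p))

      adjs : ∀ {y z} → y ∈ verts (chain (r ∷ Ws) L) → z ∈ verts (uone q R) → Adj y z → z ≡ q × y ∈ r ∷ Ws
      adjs p p' a with where-left p | where-right p'
      ... | inj₁ l | inj₁ e = e , l
      ... | inj₁ l | inj₂ (inj₁ m) = ⊥-elim (nZ m (inj₂ (_ , l , symA a)))
      ... | inj₁ (here refl) | inj₂ (inj₂ m) = ⊥-elim (av r∈ (∈-++⁺ˡ (N₁P m)) a)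
      ... | inj₁ (there l) | inj₂ (inj₂ m) = ⊥-elim (aF₂-N₁ (sub l) m a)
      ... | inj₂ l | inj₁ refl = ⊥-elim (aF₁-N₂ (QF (here refl)) l (symA a))
      ... | inj₂ l | inj₂ (inj₁ m) = ⊥-elim (aF₁-N₂ (QF (there m)) l (symA a))
      ... | inj₂ l | inj₂ (inj₂ m) = ⊥-elim (a₁₂ (N₁P m) (N₂P l) (symA a))

      disj : Disj (verts (chain (r ∷ Ws) L)) (verts (uone q R))
      disj p p' with where-left p | where-right p'
      ... | inj₁ (here refl) | inj₁ refl = dv r∈ (F₁w (QF (here refl)))
      ... | inj₁ (here refl) | inj₂ (inj₁ m) = dv r∈ (F₁w (QF (there m)))
      ... | inj₁ (here refl) | inj₂ (inj₂ m) = dv r∈ (P₁w (N₁P m))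
      ... | inj₁ (there l) | inj₁ refl = q∉Ws l
      ... | inj₁ (there l) | inj₂ (inj₁ m) = nZ m (inj₁ l)
      ... | inj₁ (there l) | inj₂ (inj₂ m) = dF₂-N₁ (sub l) m
      ... | inj₂ l | inj₁ refl = dF₁-N₂ (QF (here refl)) l
      ... | inj₂ l | inj₂ (inj₁ m) = dF₁-N₂ (QF (there m)) l
      ... | inj₂ l | inj₂ (inj₂ m) = d₁₂ (N₁P m) (N₂P l)

      attached : Attach.Attached L q R H₁.ok (r ∷ Ws)
      attached = Attach.attach L q R H₁.ok r Ws ((r∉ , ay , only-r) , H₂.ok) (adjs , disj)
                   ([ (λ q∈ → ⊥-elim (q∉Ws q∈)) , id ]′ Zq)

      in-left : ∀ {z} → z ∈ verts (chain (r ∷ Ws) L) → z ∈ r ∷ [] ⊎ z ∈ Fw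
      in-left p with where-left p
      ... | inj₁ (here e) = inj₁ (here e)
      ... | inj₁ (there l) = inj₂ (F₂w (sub l))
      ... | inj₂ l = inj₂ (P₂w (N₂P l))

      in-right : ∀ {z} → z ∈ verts (uone q R) → z ∈ Fw
      in-right p with where-right p
      ... | inj₁ refl = F₁w (QF (here refl))
      ... | inj₂ (inj₁ m) = F₁w (QF (there m))
      ... | inj₂ (inj₂ m) = P₁w (N₁P m)

      tripod : Below r []
      tripod = record { T = T ; ok = ok ; top≡ = top≡ ; branch = branch H₂.branch (branch-chain k Q H₁.branch)
                      ; range = λ p → [ in-left , inj₂ ∘ in-right ]′ (∈-++⁻ (verts (chain (r ∷ Ws) L)) (range p)) }
        where open Attach.Attached attached

    -- A first path leads from `r` through `F₂` to `N₂`. A second one leads through `F₁` to `N₁` and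
    -- is cut off before its last contact `q` with the first or with `r`; thus `q` alone has to be
    -- attached.
    inner : ∀ r → r ∈ Ev → Near Ew r → Below r []
    inner r r∈ (e , e∈ , ae) =
      let (x₁ , z₁ , x₁∈ , z₁∈ , b₁) = t₁
          (x₂ , z₂ , x₂∈ , z₂∈ , b₂) = t₂
          (y , W , P , sub , ay , nay) = rooted (near? (bag N₂)) cF₂ (e , ∈-++⁺ˡ e∈ , ae) (x₂ , ∈-++⁺ʳ Ew x₂∈ , z₂ , z₂∈ , b₂)
          (Q₀ , PQ₀ , subQ₀) = from-walk (near? (bag N₁)) (cF₁ (∈-++⁺ˡ e∈) (∈-++⁺ʳ Ew x₁∈)) (z₁ , z₁∈ , b₁)
          (q , Q , PQ , Zq , nZ , subQ) = drop-to (near? (bag N₁)) (λ v → v ∈? (y ∷ W) ⊎-dec near? (r ∷ y ∷ W) v) PQ₀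
                                            (e , here refl , inj₂ (r , here refl , symA ae))
      in Tripod.tripod r r∈ y W sub ay nay
           (hang dF₂ aF₂ sub (λ {x} x∈ nr → grow₂ x (dF₂ x∈) nr (aF₂ x∈)) P) q Q (subQ₀ ∘ subQ)
           (hang dF₁ aF₁ (subQ₀ ∘ subQ) (λ {x} x∈ nr → grow₁ x (dF₁ x∈) nr (aF₁ x∈)) PQ) PQ Zq nZ

    below : ∀ {x W} → x ∷ W ⊑ Ev → IPath (Near Ew) (x ∷ W) → Below x W
    below {x} {[]} sub (last t) = inner x (sub (here refl)) t
    below {x} {y ∷ W} sub (cons nt a x∉ na P) = record
      { T = uone x B.T
      ; ok = (x∉T , subst (Adj x) (sym B.top≡) a , only) , B.ok
      ; top≡ = refl
      ; branch = B.branch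
      ; range = λ { (here e) → inj₁ (here e) ; (there p) → [ inj₁ ∘ there , inj₂ ]′ (B.range p) } }
      where
      module B = Below (below (sub ∘ there) P)
      x∉T : x ∉ verts B.T
      x∉T p = [ x∉ , dv (sub (here refl)) ]′ (B.range p)
      only : ∀ {z} → z ∈ verts B.T → Adj x z → z ≡ top B.T
      only p a' with B.range p
      ... | inj₁ (here e) = trans e (sym B.top≡)
      ... | inj₁ (there p') = ⊥-elim (na p' a')
      ... | inj₂ p' = ⊥-elim ([ (λ b → nt (_ , b , a')) , (λ b → av (sub (here refl)) b a') ]′ (∈-++⁻ Ew p'))

    Rooted : V → Set
    Rooted r = Σ UT λ T → OK T × Only r T × Branch (suc k) T × (∀ {z} → z ∈ verts T → z ∈ Ev ⊎ z ∈ Fw)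

    root-below : ∀ r → r ∉ Ev → r ∉ Fw → (∀ {z} → z ∈ Fw → ¬ Adj r z) → ∀ {y W} → y ∷ W ⊑ Ev →
      Adj r y → (∀ {z} → z ∈ W → ¬ Adj r z) → Below y W → Rooted r
    root-below r r∉v r∉w anti {y} {W} sub ar nar B =
      B.T , B.ok , (r∉T , subst (Adj r) (sym B.top≡) ar , only) , B.branch , λ p → [ inj₁ ∘ sub , inj₂ ]′ (B.range p)
      where
      module B = Below B
      r∉T : r ∉ verts B.T
      r∉T p = [ r∉v ∘ sub , r∉w ]′ (B.range p)
      only : ∀ {z} → z ∈ verts B.T → Adj r z → z ≡ top B.T
      only p a with B.range p
      ... | inj₁ (here e) = trans e (sym B.top≡)
      ... | inj₁ (there q) = ⊥-elim (nar q a)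
      ... | inj₂ q = ⊥-elim (anti q a)

    from-root : ∀ r → r ∉ Ev → r ∉ Fw → Near Ev r → (∀ {z} → z ∈ Fw → ¬ Adj r z) → Conn Ev → Touch Ev Ew → Rooted r
    from-root r r∉v r∉w nr anti cv (x , z , x∈ , z∈ , b) =
      let (y , W , P , sub , ar , nar) = rooted (near? Ew) cv nr (x , x∈ , z , z∈ , b)
      in root-below r r∉v r∉w anti sub ar nar (below sub P)

  grow : ∀ k {h} (M : Tree h) → triple k ≤ h → Valid M → Induced M → ∀ r → r ∉ flat M → Near (bag M) r →
    (∀ {z} → z ∈ lower M → ¬ Adj r z) → Grown k M r
  grow zero M _ _ _ r r∉ (y , y∈ , a) _ = record
    { T = uend y ; ok = tt ; only = (λ { (here refl) → r∉ (bag⊑flat M y∈) }) , a , (λ { (here e) _ → e })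
    ; branch = tt ; range = λ { (here refl) → bag⊑flat M y∈ } }
  -- The tree branches only at `Ew` and follows a single child of `Ev`, `E₁` and `E₂`; hence one
  -- branching per three levels.
  grow (suc k) (node _ _ Ev (node _ _ Ew (node _ _ E₁ N₁ N₁') (node _ _ E₂ N₂ N₂')) w') (s≤s (s≤s (s≤s 3k)))
    (_ , cv , tv , _ , dv , _ , _ , (_ , cw , tw₁ , tw₂ , dw₁ , dw₂ , d₁₂ , (_ , c₁ , t₁ , _ , d₁ , _ , _ , v₁
        , _) , (_ , c₂ , t₂ , _ , d₂ , _ , _ , v₂ , _)) , _)
    (av , _ , _ , (aw₁ , aw₂ , a₁₂ , (a₁ , _ , _ , i₁ , _) , (a₂ , _ , _ , i₂ , _)) , _)
    r r∉ near-r anti-r =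
    let (T , ok , only , branch , range) = Gadget.from-root k N₁ N₂ Ev Ew E₁ E₂ (E₁ ++ flat N₁ ++ flat N₁') (E₂ ++ flat N₂ ++ flat N₂')
          ∈-++⁺ˡ (∈-++⁺ʳ E₁ ∘ ∈-++⁺ˡ) ∈-++⁺ˡ (∈-++⁺ʳ E₂ ∘ ∈-++⁺ˡ) cw c₁ c₂ tw₁ tw₂ t₁ t₂ dv dw₁ dw₂ d₁₂ d₁ d₂
          av (λ p q → aw₁ p (∈-++⁺ˡ q)) (λ p q → aw₂ p (∈-++⁺ˡ q)) a₁₂ a₁ a₂
          (grow k N₁ 3k v₁ i₁) (grow k N₂ 3k v₂ i₂)
          r (r∉ ∘ ∈-++⁺ˡ) (r∉ ∘ ∈-++⁺ʳ Ev ∘ ∈-++⁺ˡ) near-r (anti-r ∘ ∈-++⁺ˡ) cv tv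
    in record { T = T ; ok = ok ; only = only ; branch = branch ; range = λ p → [ ∈-++⁺ˡ , ∈-++⁺ʳ Ev ∘ ∈-++⁺ˡ ]′ (range p) }

  -- The additional top level provides the vertex outside `l` from which `grow` starts.
  vertex-tree : ∀ k (M : Tree (suc (triple k))) → Valid M → Induced M → Σ UT λ T → OK T × Branch k T
  vertex-tree k (node _ _ E l r) (_ , _ , (x , y , x∈ , y∈ , a) , _ , dl , _ , _ , vl , _) (al , _ , _ , il , _) =
    T , ok , branch
    where open Grown (grow k l ≤-refl vl il x (dl x∈) (y , y∈ , a) (al x∈))

  -- Forks beyond the `k`-th on a line may have either flag, as the embedding places no vertex below
  -- the next fork.
  Mono : Bool → ℕ → UT → Set
  Mono f zero T = ⊤
  Mono f (suc k) (uend x) = ⊥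
  Mono f (suc k) (uone x T) = Mono f (suc k) T
  Mono f (suc k) (ufork g x l r) = g ≡ f × Mono f k l × Mono f k r

  record Thinned (f : Bool) (k : ℕ) (T : UT) : Set where
    field
      T'    : UT
      ok    : OK T'
      mono  : Mono f k T'
      top≡  : top T' ≡ top T
      range : verts T' ⊑ verts T

  only-thin : ∀ {f k x T} → Only x T → (t : Thinned f k T) → Only x (Thinned.T' t)
  only-thin {x = x} (p , q , r) t = p ∘ range , subst (Adj x) (sym top≡) q , λ z a → trans (r (range z) a) (sym top≡)
    where open Thinned t

  sib-thin : ∀ {f k f' k'} g {l r} → Sib g l r → (t : Thinned f k l) (t' : Thinned f' k' r) → Sib g (Thinned.T' t) (Thinned.T' t')
  sib-thin false (d , a) t t' = (λ p q → d (Thinned.range t p) (Thinned.range t' q)) , λ p q → a (Thinned.range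
      t p) (Thinned.range t' q)
  sib-thin true (d , a , o) t t' = (λ p q → d (Thinned.range t p) (Thinned.range t' q)) ,
    subst (λ x → Adj x _) (sym (Thinned.top≡ t)) (subst (Adj _) (sym (Thinned.top≡ t')) a) ,
    λ p q a' → let (e , e') = o (Thinned.range t p) (Thinned.range t' q) a' in trans e (sym (Thinned.top≡ t)) , trans e' (sym (Thinned.top≡ t'))

  keep : ∀ {f k x T T₀} → Only x T → top T₀ ≡ x → verts T ⊑ verts T₀ → x ∈ verts T₀ → Thinned f (suc k) T → Thinned f (suc k) T₀
  keep {x = x} o e sub x∈ t = record { T' = uone x T' ; ok = only-thin o t , ok ; mono = mono ; top≡ = sym e
    ; range = λ { (here refl) → x∈ ; (there p) → sub (range p) } }
    where open Thinned t

  -- The flag of a fork decides which number decreases. If both branches yield a tree of that kind,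
  -- the fork joins them; if one yields a tree of the other kind, that tree already has full height,
  -- and the fork shrinks to a vertex of a path.
  ramsey : ∀ a b T → OK T → Branch (a + b) T → Thinned false a T ⊎ Thinned true b T
  ramsey zero b T ok br = inj₁ (record { T' = T ; ok = ok ; mono = tt ; top≡ = refl ; range = id })
  ramsey (suc a) zero T ok br = inj₂ (record { T' = T ; ok = ok ; mono = tt ; top≡ = refl ; range = id })
  ramsey (suc a) (suc b) (uone x T) (o , ok) br with ramsey (suc a) (suc b) T ok br
  ... | inj₁ t = inj₁ (keep o refl there (here refl) t)
  ... | inj₂ t = inj₂ (keep o refl there (here refl) t)
  ramsey (suc a) (suc b) (ufork false x l r) (ol , or , sb , okl , okr) (bl , br)
    with ramsey a (suc b) l okl bl | ramsey a (suc b) r okr br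
  ... | inj₂ t | _ = inj₂ (keep ol refl (there ∘ ∈-++⁺ˡ) (here refl) t)
  ... | inj₁ _ | inj₂ t = inj₂ (keep or refl (there ∘ ∈-++⁺ʳ (verts l)) (here refl) t)
  ... | inj₁ t | inj₁ t' = inj₁ (record { T' = ufork false x (Thinned.T' t) (Thinned.T' t')
    ; ok = only-thin ol t , only-thin or t' , sib-thin false sb t t' , Thinned.ok t , Thinned.ok t'
    ; mono = refl , Thinned.mono t , Thinned.mono t' ; top≡ = refl
    ; range = λ { (here e) → here e ; (there p) → there (⊑-++ {verts (Thinned.T' t)} (∈-++⁺ˡ ∘ Thinned.range t)
        (∈-++⁺ʳ (verts l) ∘ Thinned.range t') p) } })
  ramsey (suc a) (suc b) (ufork true x l r) (ol , or , sb , okl , okr) (bl , br)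
    with ramsey (suc a) b l okl (subst (λ m → Branch m l) (+-suc a b) bl) | ramsey (suc a) b r okr (subst (λ m
        → Branch m r) (+-suc a b) br)
  ... | inj₁ t | _ = inj₁ (keep ol refl (there ∘ ∈-++⁺ˡ) (here refl) t)
  ... | inj₂ _ | inj₁ t = inj₁ (keep or refl (there ∘ ∈-++⁺ʳ (verts l)) (here refl) t)
  ... | inj₂ t | inj₂ t' = inj₂ (record { T' = ufork true x (Thinned.T' t) (Thinned.T' t')
    ; ok = only-thin ol t , only-thin or t' , sib-thin true sb t t' , Thinned.ok t , Thinned.ok t'
    ; mono = refl , Thinned.mono t , Thinned.mono t' ; top≡ = refl
    ; range = λ { (here e) → here e ; (there p) → there (⊑-++ {verts (Thinned.T' t)} (∈-++⁺ˡ ∘ Thinned.range t)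
        (∈-++⁺ʳ (verts l) ∘ Thinned.range t') p) } })

-- Embeddings of subdivided trees and their line graphs

module Embedding {n : ℕ} (𝒢 : SimpleGraph n) where
  open Bags 𝒢
  open VertexTrees 𝒢

  -- The number of uone constructors above the first branching, and the
  -- vertices of this initial path counted upwards from that branching.
  len : UT → ℕ
  len (uend x) = 0
  len (uone x T) = suc (len T)
  len (ufork f x l r) = 0

  at : UT → ℕ → V
  at (uend x) k = x
  at (ufork f x l r) k = x
  at (uone x T) k with k ≤? len T
  ... | yes _ = at T k
  ... | no _ = x

  kid : Bool → UT → UT
  -- A default value: by `Mono`, addresses of length at most `t` do not lead past an end.
  kid b (uend x) = uend x
  kid b (uone x T) = kid b T
  kid false (ufork f x l r) = l
  kid true (ufork f x l r) = r

  flag : UT → Bool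
  flag (uend x) = false
  flag (uone x T) = flag T
  flag (ufork f x l r) = f

  top-at : ∀ T → at T (len T) ≡ top T
  top-at (uend x) = refl
  top-at (ufork f x l r) = refl
  top-at (uone x T) with suc (len T) ≤? len T
  ... | yes le = ⊥-elim (<-irrefl refl le)
  ... | no _ = refl

  ok-kid : ∀ b T → OK T → OK (kid b T)
  ok-kid b (uend x) ok = tt
  ok-kid b (uone x T) (_ , ok) = ok-kid b T ok
  ok-kid false (ufork f x l r) (_ , _ , _ , ok , _) = ok
  ok-kid true (ufork f x l r) (_ , _ , _ , _ , ok) = ok

  mono-kid : ∀ {f m} b T → Mono f (suc m) T → Mono f m (kid b T)
  mono-kid b (uone x T) h = mono-kid b T h
  mono-kid false (ufork g x l r) (_ , h , _) = h
  mono-kid true (ufork g x l r) (_ , _ , h) = h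

  mono-flag : ∀ {f m} T → Mono f (suc m) T → flag T ≡ f
  mono-flag (uone x T) h = mono-flag T h
  mono-flag (ufork g x l r) (e , _) = e

  along-adj : ∀ T k → OK T → suc k ≤ len T → Adj (at T k) (at T (suc k))
  along-adj (uone x T) k (o , ok) (s≤s le) with k ≤? len T | suc k ≤? len T
  ... | no gt | _ = ⊥-elim (gt le)
  ... | yes _ | yes lt = along-adj T k ok lt
  ... | yes _ | no ge = subst (λ v → Adj v x) (trans (sym (top-at T)) (cong (at T) (≤-antisym (≮⇒≥ ge) le)))
        (symA (proj₁ (proj₂ o)))

  up-adj : ∀ {f m} b T → Mono f (suc m) T → OK T → Adj (top (kid b T)) (at T 0)
  up-adj b (uone x T) h (_ , ok) = up-adj b T h ok
  up-adj false (ufork g x l r) h (o , _) = symA (proj₁ (proj₂ o))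
  up-adj true (ufork g x l r) h (_ , o , _) = symA (proj₁ (proj₂ o))

  sib-adj : ∀ {m} T → Mono true (suc m) T → OK T → Adj (top (kid false T)) (top (kid true T))
  sib-adj (uone x T) h (_ , ok) = sib-adj T h ok
  sib-adj (ufork true x l r) h (_ , _ , (_ , a , _) , _) = a
  sib-adj (ufork false x l r) (() , _) _

  -- Loc u T x w k: below the address u, the vertex x of T sits at address w,
  -- at height k of the path of that address.
  data Loc : List Bool → UT → V → List Bool → ℕ → Set where
    l-end   : ∀ {u x} → Loc u (uend x) x u 0
    l-fork  : ∀ {u f x l r} → Loc u (ufork f x l r) x u 0
    l-top   : ∀ {u x T} → Loc u (uone x T) x u (suc (len T))
    l-below : ∀ {u x T y w k} → Loc u T y w k → Loc u (uone x T) y w k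
    l-left  : ∀ {u f x l r y w k} → Loc (false ∷ u) l y w k → Loc u (ufork f x l r) y w k
    l-right : ∀ {u f x l r y w k} → Loc (true ∷ u) r y w k → Loc u (ufork f x l r) y w k

  loc-∈ : ∀ {u T y w k} → Loc u T y w k → y ∈ verts T
  loc-∈ l-end = here refl
  loc-∈ l-fork = here refl
  loc-∈ l-top = here refl
  loc-∈ (l-below p) = there (loc-∈ p)
  loc-∈ (l-left p) = there (∈-++⁺ˡ (loc-∈ p))
  loc-∈ (l-right {l = l} p) = there (∈-++⁺ʳ (verts l) (loc-∈ p))

  at-loc : ∀ u T k → k ≤ len T → Loc u T (at T k) u k
  at-loc u (uend x) zero le = l-end
  at-loc u (ufork f x l r) zero le = l-fork
  at-loc u (uone x T) k le with k ≤? len T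
  ... | yes le' = l-below (at-loc u T k le')
  ... | no gt = subst (Loc u (uone x T) x u) (≤-antisym (≰⇒> gt) le) l-top

  loc-top : ∀ u T → Loc u T (top T) u (len T)
  loc-top u T = subst (λ v → Loc u T v u (len T)) (top-at T) (at-loc u T (len T) ≤-refl)

  lift : ∀ {f m u y w k} b T → Mono f (suc m) T → Loc (b ∷ u) (kid b T) y w k → Loc u T y w k
  lift b (uone x T) h p = l-below (lift b T h p)
  lift false (ufork g x l r) h p = l-left p
  lift true (ufork g x l r) h p = l-right p

  loc-unique : ∀ {u T y w k w' k'} → OK T → Loc u T y w k → Loc u T y w' k' → w ≡ w' × k ≡ k'
  loc-unique ok l-end l-end = refl , refl
  loc-unique ok l-fork l-fork = refl , refl
  loc-unique (o , _) l-fork (l-left q) = ⊥-elim (proj₁ o (loc-∈ q))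
  loc-unique (_ , o , _) l-fork (l-right q) = ⊥-elim (proj₁ o (loc-∈ q))
  loc-unique (o , _) (l-left p) l-fork = ⊥-elim (proj₁ o (loc-∈ p))
  loc-unique (_ , _ , _ , ok , _) (l-left p) (l-left q) = loc-unique ok p q
  loc-unique (_ , _ , s , _) (l-left {f = false} p) (l-right q) = ⊥-elim (proj₁ s (loc-∈ p) (loc-∈ q))
  loc-unique (_ , _ , s , _) (l-left {f = true} p) (l-right q) = ⊥-elim (proj₁ s (loc-∈ p) (loc-∈ q))
  loc-unique (_ , o , _) (l-right p) l-fork = ⊥-elim (proj₁ o (loc-∈ p))
  loc-unique (_ , _ , s , _) (l-right {f = false} p) (l-left q) = ⊥-elim (proj₁ s (loc-∈ q) (loc-∈ p))
  loc-unique (_ , _ , s , _) (l-right {f = true} p) (l-left q) = ⊥-elim (proj₁ s (loc-∈ q) (loc-∈ p))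
  loc-unique (_ , _ , _ , _ , ok) (l-right p) (l-right q) = loc-unique ok p q
  loc-unique ok l-top l-top = refl , refl
  loc-unique (o , _) l-top (l-below q) = ⊥-elim (proj₁ o (loc-∈ q))
  loc-unique (o , _) (l-below p) l-top = ⊥-elim (proj₁ o (loc-∈ p))
  loc-unique (_ , ok) (l-below p) (l-below q) = loc-unique ok p q

  module Addresses (T₀ : UT) (ok₀ : OK T₀) (f : Bool) (t : ℕ) (mono₀ : Mono f t T₀) where

    sub : List Bool → UT
    sub [] = T₀
    sub (b ∷ w) = kid b (sub w)

    -- The edge above `w` gets one subdivision vertex for each path vertex over the branching at
    -- `w`. The root has height 0, so the path above the first branching of `T₀` stays outside the
    -- embedding.
    s : List Bool → ℕ
    s w = len (sub w)

    Addr : Set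
    Addr = List Bool × ℕ

    Along Up Sibs : Addr → Addr → Set
    Along (w , k) (w' , k') = w ≡ w' × k' ≡ suc k
    Up (w , k) (w' , k') = Σ Bool λ b → w ≡ b ∷ w' × k ≡ s w × k' ≡ 0
    Sibs (w , k) (w' , k') = Σ (List Bool) λ v → w ≡ false ∷ v × w' ≡ true ∷ v × k ≡ s w × k' ≡ s w' × flag (sub v) ≡ true

    Rel : Addr → Addr → Set
    Rel a a' = (Along a a' ⊎ Up a a') ⊎ Sibs a a'

    sub-ok : ∀ w → OK (sub w)
    sub-ok [] = ok₀
    sub-ok (b ∷ w) = ok-kid b (sub w) (sub-ok w)

    sub-mono : ∀ w m → m + length w ≡ t → Mono f m (sub w)
    sub-mono [] m e = subst (λ k → Mono f k T₀) (trans (sym e) (+-identityʳ m)) mono₀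
    sub-mono (b ∷ w) m e = mono-kid b (sub w) (sub-mono w (suc m) (trans (sym (+-suc m (length w))) e))

    lift-all : ∀ w m {y w' k} → m + length w ≡ t → Loc w (sub w) y w' k → Loc [] T₀ y w' k
    lift-all [] m e p = p
    lift-all (b ∷ w) m e p = lift-all w (suc m) e' (lift b (sub w) (sub-mono w (suc m) e') p)
      where e' = trans (sym (+-suc m (length w))) e

    loc₀ : ∀ w k → length w ≤ t → k ≤ s w → Loc [] T₀ (at (sub w) k) w k
    loc₀ w k lw le = lift-all w (t ∸ length w) (m∸n+n≡m lw) (at-loc w (sub w) k le)

    -- The half of inducedness that excludes edges: `OK` permits only those named in `Rel`. `T` runs
    -- through the tails of the initial path of `sub u`, which is why it is tied to `sub u` only by
    -- its branches and its flag.
    adj-rel : ∀ {u x y w k w' k'} T → (∀ b → kid b T ≡ sub (b ∷ u)) → flag T ≡ flag (sub u) → OK T →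
      Loc u T x w k → Loc u T y w' k' → Adj x y → Rel (w , k) (w' , k') ⊎ Rel (w' , k') (w , k)
    adj-rel T e g ok l-end l-end a = ⊥-elim (irrefl a)
    adj-rel T e g ok l-fork l-fork a = ⊥-elim (irrefl a)
    adj-rel T e g ok l-top l-top a = ⊥-elim (irrefl a)
    adj-rel (uone x T) e g (_ , ok) (l-below p) (l-below q) a = adj-rel T e g ok p q a
    adj-rel {u} (uone x T) e g ((_ , _ , o) , ok) l-top (l-below q) a with o (loc-∈ q) a
    ... | refl with loc-unique ok q (loc-top u T)
    ... | refl , refl = inj₂ (inj₁ (inj₁ (refl , refl)))
    adj-rel {u} (uone x T) e g ((_ , _ , o) , ok) (l-below p) l-top a with o (loc-∈ p) (symA a)
    ... | refl with loc-unique ok p (loc-top u T)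
    ... | refl , refl = inj₁ (inj₁ (inj₁ (refl , refl)))
    adj-rel {u} (ufork h x l r) e g (_ , _ , _ , ok , _) (l-left p) (l-left q) a =
      adj-rel l (λ b → cong (kid b) (e false)) (cong flag (e false)) ok p q a
    adj-rel {u} (ufork h x l r) e g (_ , _ , _ , _ , ok) (l-right p) (l-right q) a =
      adj-rel r (λ b → cong (kid b) (e true)) (cong flag (e true)) ok p q a
    adj-rel {u} (ufork h x l r) e g ((_ , _ , o) , _ , _ , ok , _) l-fork (l-left q) a with o (loc-∈ q) a
    ... | refl with loc-unique ok q (loc-top (false ∷ u) l)
    ... | refl , refl = inj₂ (inj₁ (inj₂ (false , refl , cong len (e false) , refl)))
    adj-rel {u} (ufork h x l r) e g (_ , (_ , _ , o) , _ , _ , ok) l-fork (l-right q) a with o (loc-∈ q) a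
    ... | refl with loc-unique ok q (loc-top (true ∷ u) r)
    ... | refl , refl = inj₂ (inj₁ (inj₂ (true , refl , cong len (e true) , refl)))
    adj-rel {u} (ufork h x l r) e g ((_ , _ , o) , _ , _ , ok , _) (l-left q) l-fork a with o (loc-∈ q) (symA a)
    ... | refl with loc-unique ok q (loc-top (false ∷ u) l)
    ... | refl , refl = inj₁ (inj₁ (inj₂ (false , refl , cong len (e false) , refl)))
    adj-rel {u} (ufork h x l r) e g (_ , (_ , _ , o) , _ , _ , ok) (l-right q) l-fork a with o (loc-∈ q) (symA a)
    ... | refl with loc-unique ok q (loc-top (true ∷ u) r)
    ... | refl , refl = inj₁ (inj₁ (inj₂ (true , refl , cong len (e true) , refl)))
    adj-rel {u} (ufork false x l r) e g (_ , _ , (_ , an) , _) (l-left p) (l-right q) a = ⊥-elim (an (loc-∈ p) (loc-∈ q) a)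
    adj-rel {u} (ufork false x l r) e g (_ , _ , (_ , an) , _) (l-right p) (l-left q) a = ⊥-elim (an (loc-∈ q) (loc-∈ p) (symA a))
    adj-rel {u} (ufork true x l r) e g (_ , _ , (_ , _ , o) , okl , okr) (l-left p) (l-right q) a with o (loc-∈ p) (loc-∈ q) a
    ... | refl , refl with loc-unique okl p (loc-top (false ∷ u) l) | loc-unique okr q (loc-top (true ∷ u) r)
    ... | refl , refl | refl , refl = inj₁ (inj₂ (u , refl , refl , cong len (e false) , cong len (e true) , sym g))
    adj-rel {u} (ufork true x l r) e g (_ , _ , (_ , _ , o) , okl , okr) (l-right q) (l-left p) a with o (loc-∈
        p) (loc-∈ q) (symA a)
    ... | refl , refl with loc-unique okl p (loc-top (false ∷ u) l) | loc-unique okr q (loc-top (true ∷ u) r)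
    ... | refl , refl | refl , refl = inj₂ (inj₂ (u , refl , refl , cong len (e false) , cong len (e true) , sym g))

    addr : TVert t s → Addr
    addr root = [] , 0
    addr (Defs.node b w _ i) = b ∷ w , toℕ i

    word : TVert t s → List Bool
    word = proj₁ ∘ addr

    height : TVert t s → ℕ
    height = proj₂ ∘ addr

    word≤ : ∀ x → length (word x) ≤ t
    word≤ root = z≤n
    word≤ (Defs.node b w p i) = p

    height≤ : ∀ x → height x ≤ s (word x)
    height≤ root = z≤n
    height≤ (Defs.node b w p i) = Finₚ.toℕ≤pred[n] i

    addr-inj : ∀ x y → word x ≡ word y → height x ≡ height y → x ≡ y
    addr-inj root root _ _ = refl
    addr-inj (Defs.node b w p i) (Defs.node .b .w p' i') refl e with ≤-irrelevant p p' | Finₚ.toℕ-injective e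
    ... | refl | refl = refl

    emb : TVert t s → V
    emb x = at (sub (word x)) (height x)

    loc : ∀ x → Loc [] T₀ (emb x) (word x) (height x)
    loc x = loc₀ (word x) (height x) (word≤ x) (height≤ x)

    emb-inj : ∀ x y → emb x ≡ emb y → x ≡ y
    emb-inj x y e with loc-unique ok₀ (loc x) (subst (λ v → Loc [] T₀ v (word y) (height y)) (sym e) (loc y))
    ... | p , q = addr-inj x y p q

    emb-rel : ∀ x y → Adj (emb x) (emb y) → Rel (addr x) (addr y) ⊎ Rel (addr y) (addr x)
    emb-rel x y = adj-rel T₀ (λ _ → refl) refl ok₀ (loc x) (loc y)

    arc-rel : ∀ {x y} → TArc x y → Along (addr x) (addr y) ⊎ Up (addr x) (addr y)
    arc-rel (along j) = inj₁ (refl , cong suc (sym (Finₚ.toℕ-inject₁ j)))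
    arc-rel (toRoot {b}) = inj₂ (b , refl , Finₚ.toℕ-fromℕ _ , refl)
    arc-rel (toParent {b}) = inj₂ (b , refl , Finₚ.toℕ-fromℕ _ , refl)

    rel-arc : ∀ x y → Along (addr x) (addr y) ⊎ Up (addr x) (addr y) → TArc x y
    rel-arc root root (inj₁ (_ , ()))
    rel-arc (Defs.node b w p i) (Defs.node .b .w p' (fsuc j)) (inj₁ (refl , e)) with ≤-irrelevant p p'
    ... | refl with Finₚ.toℕ-injective (trans (sym (suc-injective e)) (sym (Finₚ.toℕ-inject₁ j)))
    ... | refl = along j
    rel-arc (Defs.node b .[] p i) root (inj₂ (.b , refl , e , _)) with Finₚ.toℕ-injective {j = fromℕ _} (trans
        e (sym (Finₚ.toℕ-fromℕ _)))
    ... | refl = toRoot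
    rel-arc (Defs.node b .(b' ∷ w') p i) (Defs.node b' w' p' fzero) (inj₂ (.b , refl , e , _))
      with Finₚ.toℕ-injective {j = fromℕ _} (trans e (sym (Finₚ.toℕ-fromℕ _)))
    ... | refl = toParent

    rel-adj : ∀ x y → Along (addr x) (addr y) ⊎ Up (addr x) (addr y) → Adj (emb x) (emb y)
    rel-adj x y (inj₁ (e , e')) = subst (λ w → Adj (emb x) (at (sub w) (height y))) e
      (subst (λ k → Adj (emb x) (at (sub (word x)) k)) (sym e')
        (along-adj (sub (word x)) (height x) (sub-ok (word x)) (subst (_≤ s (word x)) e' (subst (λ w → height y
            ≤ s w) (sym e) (height≤ y)))))
    rel-adj x y (inj₂ (b , e , e' , e'')) =
      subst (λ k → Adj (emb x) (at (sub (word y)) k)) (sym e'')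
        (subst (λ v → Adj v (at (sub (word y)) 0)) (sym emb-top)
          (up-adj b (sub (word y)) (sub-mono (word y) (suc (t ∸ suc (length (word y)))) eq) (sub-ok (word y))))
      where
      emb-top : emb x ≡ top (kid b (sub (word y)))
      emb-top = trans (cong (at (sub (word x))) e') (trans (top-at (sub (word x))) (cong (top ∘ sub) e))
      lt : suc (length (word y)) ≤ t
      lt = subst (λ w → length w ≤ t) e (word≤ x)
      eq : suc (t ∸ suc (length (word y))) + length (word y) ≡ t
      eq = trans (sym (+-suc _ (length (word y)))) (m∸n+n≡m lt)

    arc-adj : ∀ {x y} → TArc x y → Adj (emb x) (emb y)
    arc-adj {x} {y} a = rel-adj x y (arc-rel a)

    flag-short : ∀ {v b x} → word x ≡ b ∷ v → flag (sub v) ≡ f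
    flag-short {v} {b} {x} e = mono-flag (sub v) (sub-mono v (suc (t ∸ suc (length v)))
      (trans (sym (+-suc _ (length v))) (m∸n+n≡m (subst (λ w → length w ≤ t) e (word≤ x)))))

    -- An `Up` arc leaves from the top of a path, where no `Along` arc starts. Hence the lower end
    -- determines an edge.
    functional : ∀ {x y y'} → TArc x y → TArc x y' → y ≡ y'
    functional {x} {y} {y'} a a' with arc-rel a | arc-rel a'
    ... | inj₁ (e , k) | inj₁ (e' , k') = addr-inj y y' (trans (sym e) e') (trans k (sym k'))
    ... | inj₂ (b , e , _ , k) | inj₂ (b' , e' , _ , k') = addr-inj y y' (Listₚ.∷-injectiveʳ (trans (sym e)
          e')) (trans k (sym k'))
    ... | inj₁ (e , k) | inj₂ (_ , _ , h , _) =
      ⊥-elim (<-irrefl refl (subst (_≤ height x) k (≤-trans (height≤ y) (≤-reflexive (trans (cong s (sym e)) (sym h))))))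
    ... | inj₂ (_ , _ , h , _) | inj₁ (e , k) =
      ⊥-elim (<-irrefl refl (subst (_≤ height x) k (≤-trans (height≤ y') (≤-reflexive (trans (cong s (sym e)) (sym h))))))

  tree-embedding : ∀ t T → OK T → Mono false t T → Σ (List Bool → ℕ) λ s → InducedIn (SubdivTree t s) (finGraph n Adj)
  tree-embedding t T ok mono = s , record
    { emb = emb ; inj = emb-inj
    ; adj = λ x y → [ arc-adj , symA ∘ arc-adj ]′ , λ a → back x y (emb-rel x y a) }
    where
    open Addresses T ok false t mono
    no-sibs : ∀ x y → ¬ Sibs (addr x) (addr y)
    no-sibs x y (v , e , _ , _ , _ , g) with trans (sym (flag-short {x = x} e)) g
    ... | ()
    back : ∀ x y → Rel (addr x) (addr y) ⊎ Rel (addr y) (addr x) → TArc x y ⊎ TArc y x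
    back x y (inj₁ (inj₁ r)) = inj₁ (rel-arc x y r)
    back x y (inj₁ (inj₂ r)) = ⊥-elim (no-sibs x y r)
    back x y (inj₂ (inj₁ r)) = inj₂ (rel-arc y x r)
    back x y (inj₂ (inj₂ r)) = ⊥-elim (no-sibs y x r)

  -- An edge is represented by its lower end. At a branching, the two edges from below become the
  -- tops of the two branches and the edge upwards becomes the fork vertex itself: the triangle of a
  -- fork with flag `true`.
  line-embedding : ∀ t T → OK T → Mono true t T → Σ (List Bool → ℕ) λ s → InducedIn (LineSubdivTree t s) (finGraph n Adj)
  line-embedding t T ok mono = s , record
    { emb = λ (x , _) → emb x
    ; inj = λ { (x , y , a) (x' , y' , a') e → edge-≡ a a' (emb-inj x x' e) }
    ; adj = λ { (x , y , a) (x' , y' , a') → forth a a' , λ p → back a a' p } }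
    where
    open Addresses T ok true t mono

    arc-irrelevant : ∀ {x y : TVert t s} (a a' : TArc x y) → a ≡ a'
    arc-irrelevant (along j) (along .j) = refl
    arc-irrelevant toRoot toRoot = refl
    arc-irrelevant toParent toParent = refl

    edge-≡ : ∀ {x y x' y'} (a : TArc x y) (a' : TArc x' y') → x ≡ x' → _≡_ {A = TEdge t s} (x , y , a) (x' , y' , a')
    edge-≡ a a' refl with functional a a'
    ... | refl = cong (λ a → _ , _ , a) (arc-irrelevant a a')

    emb-top : ∀ x b v → word x ≡ b ∷ v → height x ≡ s (word x) → emb x ≡ top (kid b (sub v))
    emb-top x b v e h = trans (cong (at (sub (word x))) h) (trans (top-at (sub (word x))) (cong (top ∘ sub) e))

    sibling-adj : ∀ x x' v → word x ≡ false ∷ v → height x ≡ s (word x) → word x' ≡ true ∷ v → height x' ≡ s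
        (word x') → Adj (emb x) (emb x')
    sibling-adj x x' v e h e' h' =
      subst (λ z → Adj z (emb x')) (sym (emb-top x false v e h)) (subst (Adj (top (kid false (sub v)))) (sym
          (emb-top x' true v e' h'))
        (sib-adj (sub v) (sub-mono v (suc (t ∸ suc (length v))) (trans (sym (+-suc _ (length v))) (m∸n+n≡m
            (subst (λ w → length w ≤ t) e (word≤ x))))) (sub-ok v)))

    common : ∀ {x x' y} → TArc x y → TArc x' y → x ≢ x' → Adj (emb x) (emb x')
    common {x} {x'} {y} a a' ne with arc-rel a | arc-rel a'
    ... | inj₁ (e , k) | inj₁ (e' , k') = ⊥-elim (ne (addr-inj x x' (trans e (sym e')) (suc-injective (trans (sym k) k'))))
    ... | inj₁ (_ , k) | inj₂ (_ , _ , _ , k') with trans (sym k) k'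
    ... | ()
    common {x} {x'} {y} a a' ne | inj₂ (_ , _ , _ , k') | inj₁ (_ , k) with trans (sym k) k'
    ... | ()
    common {x} {x'} {y} a a' ne | inj₂ (false , e , h , _) | inj₂ (true , e' , h' , _) = sibling-adj x x' (word y) e h e' h'
    common {x} {x'} {y} a a' ne | inj₂ (true , e , h , _) | inj₂ (false , e' , h' , _) = symA (sibling-adj x' x
        (word y) e' h' e h)
    common {x} {x'} {y} a a' ne | inj₂ (false , e , h , _) | inj₂ (false , e' , h' , _) =
      ⊥-elim (ne (addr-inj x x' (trans e (sym e')) (trans h (trans (cong s (trans e (sym e'))) (sym h')))))
    common {x} {x'} {y} a a' ne | inj₂ (true , e , h , _) | inj₂ (true , e' , h' , _) =
      ⊥-elim (ne (addr-inj x x' (trans e (sym e')) (trans h (trans (cong s (trans e (sym e'))) (sym h')))))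

    forth : ∀ {x y x' y'} (a : TArc x y) (a' : TArc x' y') → ¬ (x ≡ x' × y ≡ y') × (x ≡ x' ⊎ x ≡ y' ⊎ y ≡ x' ⊎
        y ≡ y') → Adj (emb x) (emb x')
    forth a a' (ne , inj₁ refl) = ⊥-elim (ne (refl , functional a a'))
    forth a a' (ne , inj₂ (inj₁ refl)) = symA (arc-adj a')
    forth a a' (ne , inj₂ (inj₂ (inj₁ refl))) = arc-adj a
    forth a a' (ne , inj₂ (inj₂ (inj₂ refl))) = common a a' λ e → ne (e , refl)

    parent : ∀ {x y} b v → TArc x y → word x ≡ b ∷ v → height x ≡ s (word x) → word y ≡ v × height y ≡ 0
    parent {x} {y} b v a e h with arc-rel a
    ... | inj₂ (b' , e' , _ , k) = Listₚ.∷-injectiveʳ (trans (sym e') e) , k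
    ... | inj₁ (e' , k) = ⊥-elim (<-irrefl refl (subst (_≤ height x) k (≤-trans (height≤ y) (≤-reflexive (trans
          (cong s (sym e')) (sym h))))))

    back : ∀ {x y x' y'} (a : TArc x y) (a' : TArc x' y') → Adj (emb x) (emb x') → ¬ (x ≡ x' × y ≡ y') × (x ≡
        x' ⊎ x ≡ y' ⊎ y ≡ x' ⊎ y ≡ y')
    back {x} {y} {x'} {y'} a a' p = (λ { (refl , _) → irrefl p }) , go (emb-rel x x' p)
      where
      sibs : ∀ {x y x' y'} → TArc x y → TArc x' y' → Sibs (addr x) (addr x') → y ≡ y'
      sibs {y = y} {y' = y'} a a' (v , e , e' , h , h' , _) with parent false v a e h | parent true v a' e' h'
      ... | p , q | p' , q' = addr-inj y y' (trans p (sym p')) (trans q (sym q'))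
      go : Rel (addr x) (addr x') ⊎ Rel (addr x') (addr x) → x ≡ x' ⊎ x ≡ y' ⊎ y ≡ x' ⊎ y ≡ y'
      go (inj₁ (inj₁ r)) = inj₂ (inj₂ (inj₁ (functional a (rel-arc x x' r))))
      go (inj₂ (inj₁ r)) = inj₂ (inj₁ (functional (rel-arc x' x r) a'))
      go (inj₁ (inj₂ r)) = inj₂ (inj₂ (inj₂ (sibs a a' r)))
      go (inj₂ (inj₂ r)) = inj₂ (inj₂ (inj₂ (sym (sibs a' a r))))

-- Distinct endpoints and conclusion

-- Chords may share endpoints.  At a common point, right ends come before left
-- ends and, among ends of the same kind, the longer chord contains the shorter.
module Perturb {n : ℕ} (c : Fin n → Chord)
  (c-inj : ∀ u v → Defs.lo (c u) ≡ Defs.lo (c v) → Defs.hi (c u) ≡ Defs.hi (c v) → u ≡ v) where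

  lo hi : Fin n → ℕ
  lo = Defs.lo ∘ c
  hi = Defs.hi ∘ c

  lo<hi : ∀ v → lo v < hi v
  lo<hi v = Defs.lo<hi (c v)

  B N : ℕ
  B = suc (maxi hi)
  N = B + B

  hi<B : ∀ v → hi v < B
  hi<B v = s≤s (≤maxi hi v)

  lo<B : ∀ v → lo v < B
  lo<B v = <-trans (lo<hi v) (hi<B v)

  key : ℕ → ℕ → ℕ
  key a r = a * N + r

  key-< : ∀ {a r a' r'} → a < a' → r < N → key a r < key a' r'
  key-< {a} {r} {a'} {r'} lt rN =
    <-≤-trans (+-monoʳ-< (a * N) rN)
      (≤-trans (≤-reflexive (+-comm (a * N) N)) (≤-trans (*-monoˡ-≤ N lt) (m≤m+n (a' * N) r')))

  key-<⁻ : ∀ {a r a' r'} → r' < N → key a r < key a' r' → a < a' ⊎ (a ≡ a' × r < r')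
  key-<⁻ {a} {r} {a'} {r'} rN lt with <-cmp a a'
  ... | tri< p _ _ = inj₁ p
  ... | tri≈ _ refl _ = inj₂ (refl , +-cancelˡ-< (a * N) r r' lt)
  ... | tri> _ _ p = ⊥-elim (<-irrefl refl (<-trans lt (key-< p rN)))

  key-inj : ∀ {a r a' r'} → r < N → r' < N → key a r ≡ key a' r' → a ≡ a' × r ≡ r'
  key-inj {a} {r} {a'} {r'} rN rN' e with <-cmp a a'
  ... | tri< p _ _ = ⊥-elim (<-irrefl e (key-< p rN))
  ... | tri≈ _ refl _ = refl , +-cancelˡ-≡ (a * N) r r' e
  ... | tri> _ _ p = ⊥-elim (<-irrefl (sym e) (key-< p rN'))

  -- `rH` is at most `B` and `rL` exceeds it. With these ranks, chords that share an end become
  -- disjoint or nested, never crossing.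
  rL rH : Fin n → ℕ
  rL v = B + (B ∸ hi v)
  rH v = B ∸ lo v

  rL<N : ∀ v → rL v < N
  rL<N v = +-monoʳ-< B (∸-monoʳ-< {B} {hi v} {0} (≤-<-trans z≤n (lo<hi v)) (<⇒≤ (hi<B v)))

  rH<rL : ∀ u v → rH u < rL v
  rH<rL u v = ≤-<-trans (m∸n≤m B (lo u)) (m<m+n B (m<n⇒0<n∸m (hi<B v)))

  rH<N : ∀ v → rH v < N
  rH<N v = <-trans (rH<rL v v) (rL<N v)

  newL newH : Fin n → ℕ
  newL v = key (lo v) (rL v)
  newH v = key (hi v) (rH v)

  ∸-flip : ∀ {x y} → B ∸ x < B ∸ y → y < x
  ∸-flip {x} {y} lt = ≰⇒> λ le → <-irrefl refl (<-≤-trans lt (∸-monoʳ-≤ B le))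

  system : ChordSystem n
  system = record
    { L = newL ; H = newH
    ; L<H = λ v → key-< (lo<hi v) (rL<N v)
    ; L-inj = λ {u} {v} e → let (p , q) = key-inj (rL<N u) (rL<N v) e in
        c-inj u v p (∸-cancelˡ-≡ (<⇒≤ (hi<B u)) (<⇒≤ (hi<B v)) (+-cancelˡ-≡ B _ _ q))
    ; H-inj = λ {u} {v} e → let (p , q) = key-inj (rH<N u) (rH<N v) e in
        c-inj u v (∸-cancelˡ-≡ (<⇒≤ (lo<B u)) (<⇒≤ (lo<B v)) q) p
    ; L≢H = λ {u} {v} e → <-irrefl (sym (proj₂ (key-inj {lo u} {rL u} {hi v} {rH v} (rL<N u) (rH<N v) e))) (rH<rL v u)
    ; M = maxi newH ; H≤M = ≤maxi newH }

  open Chords system using (Cr)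

  half→ : ∀ {u v} → lo u < lo v × lo v < hi u × hi u < hi v → newL u < newL v × newL v < newH u × newH u < newH v
  half→ {u} {v} (p , q , r) = key-< p (rL<N u) , key-< q (rL<N v) , key-< r (rH<N u)

  half← : ∀ {u v} → newL u < newL v × newL v < newH u × newH u < newH v → lo u < lo v × lo v < hi u × hi u < hi v
  half← {u} {v} (p , q , r) with key-<⁻ (rL<N v) p | key-<⁻ (rH<N u) q | key-<⁻ (rH<N v) r
  ... | _ | inj₂ (_ , bad) | _ = ⊥-elim (<-irrefl refl (<-trans bad (rH<rL u v)))
  ... | inj₁ a | inj₁ b | inj₁ d = a , b , d
  ... | inj₁ a | inj₁ b | inj₂ (_ , d) = ⊥-elim (<-irrefl refl (<-trans a (∸-flip d)))
  ... | inj₂ (_ , a) | inj₁ b | inj₁ d = ⊥-elim (<-irrefl refl (<-trans d (∸-flip (+-cancelˡ-< B _ _ a))))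
  ... | inj₂ (_ , a) | inj₁ b | inj₂ (e , d) = ⊥-elim (<-irrefl (sym e) (∸-flip (+-cancelˡ-< B _ _ a)))

  cross→ : ∀ u v → Defs.Cross (c u) (c v) → Cr u v
  cross→ u v (inj₁ p) = inj₁ (half→ {u} {v} p)
  cross→ u v (inj₂ p) = inj₂ (half→ {v} {u} p)

  cross← : ∀ u v → Cr u v → Defs.Cross (c u) (c v)
  cross← u v (inj₁ p) = inj₁ (half← {u} {v} p)
  cross← u v (inj₂ p) = inj₂ (half← {v} {u} p)

module Transport {n : ℕ} {E F : Fin n → Fin n → Set} (to : ∀ u v → F u v → E u v) (from : ∀ u v → E u v → F u v) where

  induced : ∀ {X} → InducedIn X (finGraph n F) → InducedIn X (finGraph n E)
  induced I = record { emb = emb ; inj = inj ; adj = λ x y → to _ _ ∘ proj₁ (adj x y) , proj₂ (adj x y) ∘ from _ _ }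
    where open InducedIn I

  cycles : ∀ {t} → CycleOutcome t n F → CycleOutcome t n E
  cycles (C , disj , twice , few) =
    (λ i → record { len = Cycle.len (C i) ; 3≤len = Cycle.3≤len (C i) ; vert = Cycle.vert (C i) ; inj = Cycle.inj (C i)
                  ; consec = λ a b s → to _ _ (Cycle.consec (C i) a b s) }) ,
    disj ,
    (λ i j lt a → let (b , b' , ne , p , q) = twice i j lt a in b , b' , ne , to _ _ p , to _ _ q) ,
    λ v i e inj nb → few v i e inj λ k → from _ _ (nb k)

  pathwidth : ∀ {k} → PathwidthAtLeast n E k → PathwidthAtLeast n F k
  pathwidth pw D = pw (record { m = m ; bag = bag ; cover = cover ; edge = λ u v e → edge u v (from u v e) ; interp = interp })
    where open PathDecomposition D

-- The constant `K t`, restated without a chord system because `f` has to be fixed before the graph.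
cut-bound : ℕ → ℕ
cut-bound t = (suc (2 * t) + suc (2 * t)) + (suc (2 * t) + suc (2 * t))

-- From the inside out: `t + t` branchings for `ramsey`, three levels for each and one to start
-- from, then the height for an induced minor, then the height for assigning intervals.
model-height : ℕ → ℕ
model-height t = nested-height (cut-bound t) (induced-height (cut-bound t) (suc (triple (t + t))))

module Main {n : ℕ} (𝒞 : ChordSystem n) (t : ℕ) (pw : PathwidthAtLeast n (Chords.Cr 𝒞) (sz (model-height t))) where
  open ChordSystem 𝒞
  open Chords 𝒞 using (Cr)
  open Cuts 𝒞
  open Bags (crossing 𝒞)
  open Intervals 𝒞
  open ArcTrees 𝒞
  open VertexTrees (crossing 𝒞)
  open Embedding (crossing 𝒞)

  Result : Set
  Result = (Σ (List Bool → ℕ) λ s → InducedIn (SubdivTree t s) (finGraph n Cr))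
         ⊎ (Σ (List Bool → ℕ) λ s → InducedIn (LineSubdivTree t s) (finGraph n Cr))
         ⊎ CycleOutcome t n Cr

  whole-cost : cost 0 (suc M) ≤ K t
  whole-cost = ≤-trans (≤-reflexive (cnt-zero (St? 0 (suc M)) free)) z≤n
    where
    free : ∀ v → ¬ St 0 (suc M) v
    free v (inj₁ ((() , _) , _))
    free v (inj₂ (_ , (_ , le))) = <-irrefl refl (≤-trans le (H≤M v))

  from-minor : IM (suc (triple (t + t))) → Result
  from-minor (M , valid , induced) =
    let (T , ok , branch) = vertex-tree (t + t) M valid induced
    in [ (λ s → inj₁ (tree-embedding t (Thinned.T' s) (Thinned.ok s) (Thinned.mono s))) ,
         (λ s → inj₂ (inj₁ (line-embedding t (Thinned.T' s) (Thinned.ok s) (Thinned.mono s)))) ]′ (ramsey t t T ok branch)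

  main : Result
  main =
    let (S , valid) = minor (model-height t) pw
    in [ (λ (T , A) → from-minor (induced-minor (K t) _ T (Assign.Assigned.valid A) (Assign.Assigned.arced A) (Assign.Assigned.low A (flat T)))) ,
         inj₂ ∘ inj₂ ]′
         (Assign.assign t (induced-height (K t) (suc (triple (t + t)))) 0 (suc M) S valid z≤n (λ {x} _ → z≤n ,
             s≤s (H≤M x)) whole-cost)

theorem22 : Σ (ℕ → ℕ) λ f →
    ∀ (t n : ℕ) (E : Fin n → Fin n → Set) →
    IsCircleGraph n E →
    PathwidthAtLeast n E (f t) →
    (Σ (List Bool → ℕ) λ s → InducedIn (SubdivTree t s) (finGraph n E))
    ⊎ (Σ (List Bool → ℕ) λ s → InducedIn (LineSubdivTree t s) (finGraph n E))
    ⊎ CycleOutcome t n E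
theorem22 = sz ∘ model-height , λ t n E (c , c-inj , crossing-iff) pw →
  let module P = Perturb c c-inj
      module X = Transport {E = E} {Chords.Cr P.system} (λ u v → proj₂ (crossing-iff u v) ∘ P.cross← u v)
                                                       (λ u v → P.cross→ u v ∘ proj₁ (crossing-iff u v))
  in [ (λ (s , I) → inj₁ (s , X.induced I)) ,
       [ (λ (s , I) → inj₂ (inj₁ (s , X.induced I))) , inj₂ ∘ inj₂ ∘ X.cycles ]′ ]′ (Main.main P.system t (X.pathwidth pw))
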